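{- Let $\alpha$ and $\beta$ be fixed partitions and $n,m$ fixed nonnegative integers. The map $\Phi$ (skew domino Schensted map, defined in the context) is well defined on the set $$\bigcup_{j\geq0}\ \bigcup_{\substack{\mu:\ \beta/\mu\vdash 2(m-j)\\ \alpha/\mu\vdash 2(n-j)}} \mathcal{D}(\beta/\mu)\times\mathcal{D}(\alpha/\mu)\times\mathfrak{M}_{n,m}^j$$ and is a bijection from this set onto $$\bigcup_{\substack{\lambda:\ \lambda/\alpha\vdash 2m\\ \lambda/\beta\vdash 2n}} \mathcal{D}(\lambda/\alpha)\times\mathcal{D}(\lambda/\beta).$$
   Context: Partitions are identified with Young diagrams (cell $(i,j)$ in row $i$, column $j$). For partitions $\mu\subseteq\lambda$, the skew shape $\lambda/\mu$ is the set of cells of $\lambda$ not in $\mu$; $\lambda/\mu\vdash n$ means $\mu\subseteq\lambda$ and $\lambda/\mu$ has $n$ cells. A domino is a pair of horizontally or vertically adjacent cells. A standard domino tableau (SDT) of shape $\lambda/\mu\vdash 2n$ is a bijection $T$ from the cells of $\lambda/\mu$ to $\{1,\dots,2n\}$ with $T(i,j)\le T(i',j')$ whenever $i\le i'$, $j\le j'$, such that for each $k$ the cells with entries $2k-1,2k$ form a domino; it is viewed as dominoes labelled $1,\dots,n$. $\mathcal{D}(\lambda/\mu)$ is the set of SDTs of shape $\lambda/\mu$. Write $\mu<_{\rm d}\lambda$ if $\mu\subset\lambda$ and $\lambda/\mu$ is a domino, and $\mu\le_{\rm d}\lambda$ if $\mu=\lambda$ or $\mu<_{\rm d}\lambda$.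 An $n\times m$ partial permutation matrix (PPM) is an $n\times m$ matrix with entries in $\{1,-1,0\}$ with at most one nonzero entry in each row and column; $\mathfrak{M}_{n,m}^j$ is the set of those with exactly $j$ nonzero entries. Definition of $\Phi$: given $U\in\mathcal{D}(\beta/\mu)$ ($\beta/\mu\vdash2(m-j)$), $V\in\mathcal{D}(\alpha/\mu)$ ($\alpha/\mu\vdash 2(n-j)$) and $M\in\mathfrak{M}^j_{n,m}$, build partitions $\Gamma_{(i,k)}$, $0\le i\le n$, $0\le k\le m$. The top row $\Gamma_{(0,0)}\le_{\rm d}\cdots\le_{\rm d}\Gamma_{(0,m)}$ is the multichain from $\mu$ to $\beta$ with $\Gamma_{(0,k-1)}=\Gamma_{(0,k)}$ exactly when column $k$ of $M$ has a nonzero entry, whose nonempty successive differences are the dominoes of $U$ labelled $1,2,\dots$ in order. The left column $\Gamma_{(0,0)}\le_{\rm d}\cdots\le_{\rm d}\Gamma_{(n,0)}$ is the multichain from $\mu$ to $\alpha$ with $\Gamma_{(i-1,0)}=\Gamma_{(i,0)}$ exactly when row $i$ of $M$ has a nonzero entry, its nonempty differences being the dominoes of $V$ in order. The other entries are determined by the local rules: for $1\le i\le n$, $1\le k\le m$, with $\nu=\Gamma_{(i-1,k-1)}$, $\kappa=\Gamma_{(i-1,k)}$, $\rho=\Gamma_{(i,k-1)}$, the partition $\Gamma_{(i,k)}$ is: (1) if $M(i,k)=1$ (then $\nu=\kappa=\rho$), $\kappa$ with a horizontal domino added to the first row; (2) if $M(i,k)=-1$ (then $\nu=\kappa=\rho$),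 $\kappa$ with a vertical domino added to the first column; (3) if $M(i,k)=0$: (a) if $\nu=\kappa$ or $\nu=\rho$, the largest of $\nu,\kappa,\rho$; (b) if $\nu<_{\rm d}\kappa$, $\nu<_{\rm d}\rho$, $\kappa\ne\rho$ and $\kappa/\nu\cap\rho/\nu=\emptyset$, then $\kappa\cup\rho$; (c) if $\nu<_{\rm d}\kappa$, $\nu<_{\rm d}\rho$, $\kappa\neq\rho$ and $\kappa/\nu\cap\rho/\nu\ne\emptyset$, these share exactly one cell $(p,q)$ and the result is $\kappa\cup\rho$ with the cell $(p+1,q+1)$ added; (d) if $\nu<_{\rm d}\kappa=\rho$ and $\kappa/\nu$ is a horizontal domino in row $r$, then $\kappa$ with a horizontal domino added in row $r+1$; (e) if $\nu<_{\rm d}\kappa=\rho$ and $\kappa/\nu$ is a vertical domino in column $c$, then $\kappa$ with a vertical domino added in column $c+1$. With $\lambda=\Gamma_{(n,m)}$, let $P$ be the SDT of shape $\lambda/\alpha$ whose domino labelled $k$ is $\Gamma_{(n,k)}/\Gamma_{(n,k-1)}$ ($k=1,\dots,m$) and $Q$ the SDT of shape $\lambda/\beta$ whose domino labelled $i$ is $\Gamma_{(i,m)}/\Gamma_{(i-1,m)}$ ($i=1,\dots,n$). Then $\Phi(U,V,M)=(P,Q)$. -}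

module Defs where

open import Data.Nat using (ℕ; zero; suc; _+_; _*_; _∸_; _≤_; _<_)
open import Data.Bool using (Bool; true; false; _∧_; if_then_else_)
open import Data.Integer using (ℤ; +_; -[1+_])
open import Data.List using (List; []; _∷_; length; concat; map; upTo)
open import Data.Nat.ListAction using (sum)
open import Data.List.Relation.Unary.All using (All)
open import Data.List.Relation.Binary.Permutation.Propositional using (_↭_)
open import Data.Vec using (Vec; []; _∷_; lookup)
open import Data.Fin using (Fin; toℕ)
open import Data.Product using (Σ; _×_; _,_)
open import Data.Sum using (_⊎_)
open import Relation.Nullary using (¬_)
open import Relation.Binary.PropositionalEquality using (_≡_)
open import Function.Bundles using (_⇔_)

-- Cells, partitions, Young diagrams  (cells are 0-indexed: (row , column))

Cell : Set
Cell = ℕ × ℕ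

lookupD : List ℕ → ℕ → ℕ
lookupD []       _       = 0
lookupD (x ∷ xs) zero    = x
lookupD (x ∷ xs) (suc i) = lookupD xs i

row : List ℕ → ℕ → ℕ
row = lookupD

IsPartition : List ℕ → Set
IsPartition p = (∀ i → row p (suc i) ≤ row p i) × All (λ a → 0 < a) p

InPart : List ℕ → Cell → Set
InPart p (i , j) = j < row p i

InSkew : List ℕ → List ℕ → Cell → Set
InSkew l m x = InPart l x × ¬ InPart m x

_⊆ₚ_ : List ℕ → List ℕ → Set
p ⊆ₚ q = ∀ x → InPart p x → InPart q x

_≋_ : List ℕ → List ℕ → Set
p ≋ q = ∀ x → InPart p x ⇔ InPart q x

-- number of cells of λ / μ (for μ ⊆ λ)
size : List ℕ → List ℕ → ℕ
size l m = sum l ∸ sum m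

data Domino : Cell → Cell → Set where
  hor : ∀ i j → Domino (i , j) (i , suc j)
  ver : ∀ i j → Domino (i , j) (suc i , j)

_<d_ : List ℕ → List ℕ → Set
ν <d κ = ν ⊆ₚ κ × Σ Cell λ c → Σ Cell λ c' → Domino c c' ×
         (∀ x → InSkew κ ν x ⇔ (x ≡ c ⊎ x ≡ c'))

HorDomInRow : List ℕ → List ℕ → ℕ → Set
HorDomInRow κ γ r = κ ⊆ₚ γ × Σ ℕ λ q →
  (∀ x → InSkew γ κ x ⇔ (x ≡ (r , q) ⊎ x ≡ (r , suc q)))

VerDomInCol : List ℕ → List ℕ → ℕ → Set
VerDomInCol κ γ c = κ ⊆ₚ γ × Σ ℕ λ p →
  (∀ x → InSkew γ κ x ⇔ (x ≡ (p , c) ⊎ x ≡ (suc p , c)))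

-- Standard domino tableaux.
-- A filling of λ/μ is stored row by row: row i of T lists the entries of the
-- cells (i , row μ i), (i , row μ i + 1), …, (i , row λ i - 1), left to right.

Tableau : Set
Tableau = List (List ℕ)

rowT : Tableau → ℕ → List ℕ
rowT []       _       = []
rowT (r ∷ rs) zero    = r
rowT (r ∷ rs) (suc i) = rowT rs i

ent : Tableau → List ℕ → Cell → ℕ
ent T μ (i , j) = lookupD (rowT T i) (j ∸ row μ i)

IsSDT : List ℕ → List ℕ → Tableau → Set
IsSDT l m T =
  (length T ≡ length l) ×
  (∀ i → length (rowT T i) ≡ row l i ∸ row m i) ×
  (concat T ↭ map suc (upTo (size l m))) ×
  (∀ x y → InSkew l m x → InSkew l m y →
     Data.Product.proj₁ x ≤ Data.Product.proj₁ y →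
     Data.Product.proj₂ x ≤ Data.Product.proj₂ y →
     ent T m x ≤ ent T m y) ×
  (∀ k x y → InSkew l m x → InSkew l m y →
     ent T m x ≡ suc (2 * k) → ent T m y ≡ 2 + 2 * k →
     Domino x y ⊎ Domino y x)

Matrix : ℕ → ℕ → Set
Matrix n m = Vec (Vec ℤ m) n

_⟨_,_⟩ : ∀ {n m} → Matrix n m → Fin n → Fin m → ℤ
M ⟨ i , k ⟩ = lookup (lookup M i) k

IsPPM : ∀ {n m} → Matrix n m → Set
IsPPM {n} {m} M =
  (∀ i k → M ⟨ i , k ⟩ ≡ + 1 ⊎ M ⟨ i , k ⟩ ≡ -[1+ 0 ] ⊎ M ⟨ i , k ⟩ ≡ + 0) ×
  (∀ i k k' → ¬ M ⟨ i , k ⟩ ≡ + 0 → ¬ M ⟨ i , k' ⟩ ≡ + 0 → k ≡ k') ×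
  (∀ i i' k → ¬ M ⟨ i , k ⟩ ≡ + 0 → ¬ M ⟨ i' , k ⟩ ≡ + 0 → i ≡ i')

isZero : ℤ → Bool
isZero (+ zero) = true
isZero _        = false

countNZ : ∀ {m} → Vec ℤ m → ℕ
countNZ []       = 0
countNZ (z ∷ zs) = (if isZero z then 0 else 1) + countNZ zs

-- number of nonzero entries (M ∈ 𝔐^j_{n,m} with j = nonzeros M)
nonzeros : ∀ {n m} → Matrix n m → ℕ
nonzeros []       = 0
nonzeros (r ∷ rs) = countNZ r + nonzeros rs

lookupZ : ∀ {m} → Vec ℤ m → ℕ → ℤ
lookupZ []       _       = + 0
lookupZ (z ∷ zs) zero    = z
lookupZ (z ∷ zs) (suc k) = lookupZ zs k

colIsZero : ∀ {n m} → Matrix n m → ℕ → Bool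
colIsZero []       k = true
colIsZero (r ∷ rs) k = isZero (lookupZ r k) ∧ colIsZero rs k

rowIsZero : ∀ {n m} → Matrix n m → ℕ → Bool
rowIsZero []       i       = true
rowIsZero (r ∷ rs) zero    = allZ r
  where
  allZ : ∀ {k} → Vec ℤ k → Bool
  allZ []       = true
  allZ (z ∷ zs) = isZero z ∧ allZ zs
rowIsZero (r ∷ rs) (suc i) = rowIsZero rs i

zeroColsBefore : ∀ {n m} → Matrix n m → ℕ → ℕ
zeroColsBefore M zero    = 0
zeroColsBefore M (suc k) = zeroColsBefore M k + (if colIsZero M k then 1 else 0)

zeroRowsBefore : ∀ {n m} → Matrix n m → ℕ → ℕ
zeroRowsBefore M zero    = 0
zeroRowsBefore M (suc i) = zeroRowsBefore M i + (if rowIsZero M i then 1 else 0)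

-- Local rules: Local ν κ ρ e γ  means  γ = Γ_(i,k)  is produced from
-- ν = Γ_(i-1,k-1), κ = Γ_(i-1,k), ρ = Γ_(i,k-1) and e = M(i,k).
-- Each constructor carries the hypotheses of the corresponding case.

data Local (ν κ ρ : List ℕ) : ℤ → List ℕ → Set where
  rule1  : ∀ {γ} → ν ≋ κ → ν ≋ ρ → HorDomInRow κ γ 0 → Local ν κ ρ (+ 1) γ
  rule2  : ∀ {γ} → ν ≋ κ → ν ≋ ρ → VerDomInCol κ γ 0 → Local ν κ ρ -[1+ 0 ] γ
  rule3a : ∀ {γ} → (ν ≋ κ ⊎ ν ≋ ρ) →
           (γ ≋ ν ⊎ γ ≋ κ ⊎ γ ≋ ρ) → ν ⊆ₚ γ → κ ⊆ₚ γ → ρ ⊆ₚ γ →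
           Local ν κ ρ (+ 0) γ
  rule3b : ∀ {γ} → ν <d κ → ν <d ρ → ¬ (κ ≋ ρ) →
           ¬ (Σ Cell λ x → InSkew κ ν x × InSkew ρ ν x) →
           (∀ x → InPart γ x ⇔ (InPart κ x ⊎ InPart ρ x)) →
           Local ν κ ρ (+ 0) γ
  rule3c : ∀ {γ} p q → ν <d κ → ν <d ρ → ¬ (κ ≋ ρ) →
           InSkew κ ν (p , q) → InSkew ρ ν (p , q) →
           (∀ x → InPart γ x ⇔ (InPart κ x ⊎ InPart ρ x ⊎ x ≡ (suc p , suc q))) →
           Local ν κ ρ (+ 0) γ
  rule3d : ∀ {γ} r → ν <d κ → κ ≋ ρ → HorDomInRow ν κ r →
           HorDomInRow κ γ (suc r) → Local ν κ ρ (+ 0) γ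
  rule3e : ∀ {γ} c → ν <d κ → κ ≋ ρ → VerDomInCol ν κ c →
           VerDomInCol κ γ (suc c) → Local ν κ ρ (+ 0) γ

Input : ℕ → ℕ → Set
Input n m = List ℕ × Tableau × Tableau × Matrix n m

Output : Set
Output = List ℕ × Tableau × Tableau

InDomain : (α β : List ℕ) (n m : ℕ) → Input n m → Set
InDomain α β n m (μ , U , V , M) =
  IsPartition μ × μ ⊆ₚ β × μ ⊆ₚ α × IsPPM M ×
  size β μ ≡ 2 * (m ∸ nonzeros M) × size α μ ≡ 2 * (n ∸ nonzeros M) ×
  IsSDT β μ U × IsSDT α μ V

InCodomain : (α β : List ℕ) (n m : ℕ) → Output → Set
InCodomain α β n m (l , P , Q) =
  IsPartition l × α ⊆ₚ l × β ⊆ₚ l ×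
  size l α ≡ 2 * m × size l β ≡ 2 * n ×
  IsSDT l α P × IsSDT l β Q

-- The graph of Φ: Φ(U,V,M) = (P,Q) (with λ = Γ_(n,m)) iff there is an array
-- Γ_(i,k), 0 ≤ i ≤ n, 0 ≤ k ≤ m, of partitions with the prescribed top row and
-- left column, obeying the local rules, whose bottom row / right column give P / Q.
PhiGraph : (α β : List ℕ) (n m : ℕ) → Input n m → Output → Set
PhiGraph α β n m (μ , U , V , M) (l , P , Q) =
  Σ (ℕ → ℕ → List ℕ) λ Γ →
    (∀ i k → i ≤ n → k ≤ m → IsPartition (Γ i k)) ×
    -- top row: μ together with the dominoes of U labelled 1 … (number of zero
    -- columns among the first k columns of M)
    (∀ k → k ≤ m → ∀ x →
       InPart (Γ 0 k) x ⇔ (InPart μ x ⊎ (InSkew β μ x × ent U μ x ≤ 2 * zeroColsBefore M k))) ×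
    (∀ i → i ≤ n → ∀ x →
       InPart (Γ i 0) x ⇔ (InPart μ x ⊎ (InSkew α μ x × ent V μ x ≤ 2 * zeroRowsBefore M i))) ×
    (∀ (i : Fin n) (k : Fin m) →
       Local (Γ (toℕ i) (toℕ k)) (Γ (toℕ i) (suc (toℕ k))) (Γ (suc (toℕ i)) (toℕ k))
             (M ⟨ i , k ⟩) (Γ (suc (toℕ i)) (suc (toℕ k)))) ×
    (l ≡ Γ n m) ×
    (∀ (k : Fin m) x → InSkew l α x →
       ((ent P α x ≡ suc (2 * toℕ k) ⊎ ent P α x ≡ 2 + 2 * toℕ k) ⇔
        InSkew (Γ n (suc (toℕ k))) (Γ n (toℕ k)) x)) ×
    (∀ (i : Fin n) x → InSkew l β x →
       ((ent Q β x ≡ suc (2 * toℕ i) ⊎ ent Q β x ≡ 2 + 2 * toℕ i) ⇔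
        InSkew (Γ (suc (toℕ i)) m) (Γ (toℕ i) m) x))

{-# OPTIONS --safe #-}

-- Around every square of the array Γ the rules relate partitions ν, κ, ρ, γ in which each of
-- ν → κ, ν → ρ, ρ → γ, κ → γ is trivial or adds a domino. They can be inverted: κ, ρ, γ determine
-- ν and the matrix entry, because a domino of γ/κ = γ/ρ lies in row 0, in column 0, or continues
-- a domino of the previous row or column, and because two dominoes sharing their first cell turn
-- into two dominoes sharing their last cell. Hence Γ is determined by, and can be built from,
-- either its top row, left column and matrix, or its bottom row and right column. A step into a
-- new row (column) of Γ is proper iff the old step was proper or the entry is nonzero, so that the
-- bottom row and right column are saturated exactly when the matrix is a partial permutation matrix
-- whose zero columns and rows mark the proper steps of the top row and left column. Finally
-- (multi)chains of partitions growing by dominoes are the same thing as standard domino tableaux.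
-- Everything about vertical dominoes is obtained from horizontal ones by transposition.
module Submission where

open import Defs
open import Data.Bool using (Bool; true; false; not; _∧_; if_then_else_)
open import Data.Empty using (⊥; ⊥-elim)
open import Data.Fin using (Fin; toℕ; fromℕ<; zero; suc)
open import Data.Fin.Properties using (toℕ-fromℕ<; toℕ<n; toℕ-injective)
open import Data.Integer using (ℤ; +_; -[1+_])
open import Data.List using (List; []; _∷_; length; concat; map; upTo; applyUpTo; drop; _++_)
open import Data.List.Membership.Propositional using (_∈_)
open import Data.List.Membership.Propositional.Properties
  using (∈-++⁺ˡ; ∈-++⁺ʳ; ∈-++⁻; ∈-∃++; ∈-map⁺; ∈-map⁻; ∈-upTo⁺; ∈-upTo⁻)
open import Data.List.Properties
  using (length-applyUpTo; length-upTo; length-map; length-++) renaming (≡-dec to List-≡-dec)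
open import Data.List.Relation.Binary.Permutation.Propositional
  using (_↭_; prep; ↭-refl; ↭-sym; ↭-trans; ↭⇒↭ₛ)
open import Data.List.Relation.Binary.Permutation.Propositional.Properties using (∈-resp-↭; ↭-length; shift)
open import Data.List.Relation.Unary.All as All using (All; []; _∷_)
open import Data.List.Relation.Unary.All.Properties using (++⁻ˡ; ++⁻ʳ)
open import Data.List.Relation.Unary.AllPairs using ([]; _∷_)
open import Data.List.Relation.Unary.Any using (here; there)
open import Data.List.Relation.Unary.Unique.Propositional using (Unique)
open import Data.List.Relation.Unary.Unique.Propositional.Properties using (upTo⁺) renaming (map⁺ to Unique-map⁺)
open import Data.Nat using (ℕ; zero; suc; _+_; _*_; _∸_; _≤_; _<_; z≤n; s≤s; _<?_; _≤?_)
open import Data.Nat.ListAction using (sum)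
open import Data.Nat.Properties renaming (_≟_ to _≟ℕ_)
open import Data.Nat.Tactic.RingSolver using (solve-∀)
open import Data.Product using (Σ; _×_; _,_; proj₁; proj₂; swap)
open import Data.Product.Properties using (≡-dec)
open import Data.Sum as Sum using (_⊎_; inj₁; inj₂; [_,_]′)
open import Data.Vec using (Vec; []; _∷_; lookup; tabulate)
open import Function using (_∘_)
open import Function.Bundles using (_⇔_; mk⇔; module Equivalence)
open import Relation.Binary.Definitions using (tri<; tri≈; tri>)
open import Relation.Binary.PropositionalEquality
  using (_≡_; _≢_; refl; sym; trans; cong; cong₂; subst; subst₂; setoid; module ≡-Reasoning)
open import Relation.Nullary using (¬_; Dec; yes; no)
open import Relation.Nullary.Decidable using (_⊎-dec_; _×-dec_; ¬?; toSum)
open import Data.List.Relation.Binary.Permutation.Setoid.Properties (setoid ℕ) using (Unique-resp-↭)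
open Equivalence using (to; from)

-- Regions of cells

-- Geometry is done on predicates on cells rather than on lists of row lengths: transposition is
-- then composition with `swap`, and unions, intersections and single cells can be handled freely.
-- `realise` leads back from decidable bounded down-closed regions to lists, and positivity of parts
-- makes the list unique, so that equality of diagrams turns into `≡`. Two obstacles shape the rest.
-- The graph of Φ asserts the local rules, but not that neighbouring partitions inside the array
-- differ by at most a domino, while uniqueness of γ is available only for squares whose sides at ν
-- are steps. Steps are therefore propagated from the top row and left column, using existence and
-- uniqueness together. Secondly, the trivial steps of the top row and left column are prescribed by
-- a global condition (a zero row or column of the matrix). An explicit Boolean on each step makes
-- this local: in every square the entry acts on the indicators by `Transfer`, and adding up these
-- changes yields the sizes 2(m - j) and 2(n - j).

Region : Set₁
Region = Cell → Set

_ᵗ : Region → Region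
(S ᵗ) x = S (swap x)

record Down (S : Region) : Set where
  field
    up   : ∀ {i j} → S (suc i , j) → S (i , j)
    left : ∀ {i j} → S (i , suc j) → S (i , j)

open Down

down-ᵗ : ∀ {S} → Down S → Down (S ᵗ)
down-ᵗ d = record { up = left d ; left = up d }

up* : ∀ {S} → Down S → ∀ i {i' j} → i' ≤ i → S (i , j) → S (i' , j)
up* d zero    z≤n s = s
up* d (suc i) le  s with m≤n⇒m<n∨m≡n le
... | inj₁ (s≤s lt) = up* d i lt (up d s)
... | inj₂ refl     = s

left* : ∀ {S} → Down S → ∀ {i j j'} → j' ≤ j → S (i , j) → S (i , j')
left* d le = up* (down-ᵗ d) _ le

down* : ∀ {S} → Down S → ∀ {i i' j j'} → i' ≤ i → j' ≤ j → S (i , j) → S (i' , j')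
down* d le le' s = up* d _ le (left* d le' s)

-- Decidability and the bound allow the ends of rows to be searched for; with down-closure they make
-- the region the diagram of a partition.
record Shape : Set₁ where
  field
    In      : Region
    dec     : ∀ x → Dec (In x)
    down    : Down In
    bound   : ℕ
    bounded : ∀ {i j} → In (i , j) → i < bound × j < bound

open Shape

transposed : Shape → Shape
transposed S = record
  { In = In S ᵗ ; dec = λ x → dec S (swap x) ; down = down-ᵗ (down S)
  ; bound = bound S ; bounded = λ s → swap (bounded S s) }

least-missing : (P : ℕ → Set) → (∀ j → Dec (P j)) → ∀ N → ¬ P N →
  Σ ℕ λ q → ¬ P q × (∀ {j} → j < q → P j)
least-missing P d N nP with d 0
... | no n0 = 0 , n0 , λ ()
... | yes p0 with N
...   | zero   = ⊥-elim (nP p0)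
...   | suc N' with least-missing (P ∘ suc) (d ∘ suc) N' nP
...     | q , nq , lt = suc q , nq , λ { {zero} _ → p0 ; {suc j} (s≤s l) → lt l }

row-end : (S : Shape) → ∀ r → Σ ℕ λ q → ¬ In S (r , q) × (∀ {j} → j < q → In S (r , j))
row-end S r = least-missing (λ j → In S (r , j)) (λ j → dec S (r , j)) (bound S)
  λ s → <-irrefl refl (proj₂ (bounded S s))

-- Partitions as shapes, and back

I : List ℕ → Region
I = InPart

row-beyond : ∀ p i → length p ≤ i → row p i ≡ 0
row-beyond []      i       _         = refl
row-beyond (x ∷ p) (suc i) (s≤s le) = row-beyond p i le

I? : ∀ p x → Dec (I p x)
I? p (i , j) = j <? row p i

partition-down : ∀ {p} → IsPartition p → Down (I p)
partition-down (mono , _) = record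
  { up = λ {i} s → <-≤-trans s (mono i) ; left = λ s → <-trans (n<1+n _) s }

row-≤-head : ∀ {p} → IsPartition p → ∀ i → row p i ≤ row p 0
row-≤-head hp zero    = ≤-refl
row-≤-head hp (suc i) = ≤-trans (proj₁ hp i) (row-≤-head hp i)

shape : ∀ p → IsPartition p → Shape
shape p hp = record
  -- A single number has to bound both coordinates: rows are below `length p`, columns below
  -- `row p 0`.
  { In = I p ; dec = I? p ; down = partition-down hp ; bound = length p + row p 0
  ; bounded = λ {i} {j} s → <-≤-trans (inside i j s) (m≤m+n _ _) ,
                             <-≤-trans s (≤-trans (row-≤-head hp i) (m≤n+m _ (length p))) }
  where
  inside : ∀ i j → j < row p i → i < length p
  inside i j s with i <? length p
  ... | yes lt = lt
  ... | no nlt = ⊥-elim (n≮0 (subst (j <_) (row-beyond p i (≮⇒≥ nlt)) s))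

below-missing : ∀ {S r q j} → Down S → ¬ S (r , q) → S (r , j) → j < q
below-missing {q = q} {j} d nq s with j <? q
... | yes lt = lt
... | no nlt = ⊥-elim (nq (left* d (≮⇒≥ nlt) s))

Realisation : Region → Set
Realisation S = Σ (List ℕ) λ p → IsPartition p × (∀ x → I p x ⇔ S x)

-- The list ends at the first empty row: down-closure empties all rows below it, and no zero part is
-- stored, as `IsPartition` demands.
realise-rows : ∀ N S → (∀ x → Dec (S x)) → Down S → (∀ j → ¬ S (N , j)) →
  (∀ i → Σ ℕ λ q → ¬ S (i , q) × (∀ {j} → j < q → S (i , j))) → Realisation S
realise-rows zero S d dn nS ends =
  [] , ((λ i → z≤n) , []) , λ { (i , j) → mk⇔ (λ ()) (λ s → ⊥-elim (nS j (up* dn i z≤n s))) }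
realise-rows (suc N) S d dn nS ends
  with ends 0 | realise-rows N (λ { (i , j) → S (suc i , j) }) (λ { (i , j) → d (suc i , j) })
                  (record { up = up dn ; left = left dn }) nS (λ i → ends (suc i))
... | zero , nq , _ | _ = [] , ((λ i → z≤n) , []) ,
      λ { (i , j) → mk⇔ (λ ()) (λ s → ⊥-elim (nq (down* dn z≤n z≤n s))) }
... | suc q , nq , lt | p , (mono , pos) , eqv =
      suc q ∷ p , ((λ { zero → ≮⇒≥ (λ l → nq (up dn (to (eqv (0 , suc q)) l))) ; (suc i) → mono i }) ,
                   s≤s z≤n ∷ pos) ,
      λ { (zero , j) → mk⇔ lt (below-missing dn nq) ; (suc i , j) → eqv (i , j) }

realise : (S : Shape) → Realisation (In S)
realise S = realise-rows (bound S) (In S) (dec S) (down S)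
  (λ j s → <-irrefl refl (proj₁ (bounded S s))) (row-end S)

_≐_ : Region → Region → Set
S ≐ T = ∀ x → S x ⇔ T x

≐-refl : ∀ {S} → S ≐ S
≐-refl x = mk⇔ (λ s → s) (λ s → s)

≐-sym : ∀ {S T} → S ≐ T → T ≐ S
≐-sym e x = mk⇔ (from (e x)) (to (e x))

≐-trans : ∀ {S T U} → S ≐ T → T ≐ U → S ≐ U
≐-trans e f x = mk⇔ (to (f x) ∘ to (e x)) (from (e x) ∘ from (f x))

rows-≋ : ∀ {p q} → p ≋ q → ∀ i → row p i ≡ row q i
rows-≋ {p} {q} e i with <-cmp (row p i) (row q i)
... | tri< lt _ _ = ⊥-elim (<-irrefl refl (from (e (i , row p i)) lt))
... | tri≈ _ eq _ = eq
... | tri> _ _ gt = ⊥-elim (<-irrefl refl (to (e (i , row q i)) gt))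

rows-≡ : ∀ {p q} → All (0 <_) p → All (0 <_) q → (∀ i → row p i ≡ row q i) → p ≡ q
rows-≡ []       []       e = refl
rows-≡ []       (y ∷ ys) e = ⊥-elim (<-irrefl (e 0) y)
rows-≡ (x ∷ xs) []       e = ⊥-elim (<-irrefl (sym (e 0)) x)
rows-≡ (x ∷ xs) (y ∷ ys) e = cong₂ _∷_ (e 0) (rows-≡ xs ys (λ i → e (suc i)))

-- Without zero parts a list is recovered from its row lengths. This carries `≋`, in which the local
-- rules are phrased, over to the `≡` of the theorem.
≋⇒≡ : ∀ {p q} → IsPartition p → IsPartition q → p ≋ q → p ≡ q
≋⇒≡ {p} {q} hp hq e = rows-≡ (proj₂ hp) (proj₂ hq) (rows-≋ {p} {q} e)

-- Adding a domino to a region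

-- Adjacency of the two cells is left to the indices, so one set of lemmas serves both orientations
-- and survives transposition. `split` decides whether a cell of `K` is old or new.
record Add (N K : Region) (c c' : Cell) : Set where
  field
    sub   : ∀ {x} → N x → K x
    new₁  : K c
    new₂  : K c'
    old₁  : ¬ N c
    old₂  : ¬ N c'
    split : ∀ {x} → K x → N x ⊎ x ≡ c ⊎ x ≡ c'

open Add

AddH AddV : Region → Region → ℕ → ℕ → Set
AddH N K r q = Add N K (r , q) (r , suc q)
AddV N K p c = Add N K (p , c) (suc p , c)

add-ᵗ : ∀ {N K c c'} → Add N K c c' → Add (N ᵗ) (K ᵗ) (swap c) (swap c')
add-ᵗ a = record
  { sub = sub a ; new₁ = new₁ a ; new₂ = new₂ a ; old₁ = old₁ a ; old₂ = old₂ a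
  ; split = λ s → [ inj₁ , (λ { (inj₁ e) → inj₂ (inj₁ (cong swap e)) ; (inj₂ e) → inj₂ (inj₂ (cong swap e)) }) ]′ (split a s) }

add-≐ : ∀ {N N' K K' c c'} → N ≐ N' → K ≐ K' → Add N K c c' → Add N' K' c c'
add-≐ e f a = record
  { sub = λ s → to (f _) (sub a (from (e _) s)) ; new₁ = to (f _) (new₁ a) ; new₂ = to (f _) (new₂ a)
  ; old₁ = λ s → old₁ a (from (e _) s) ; old₂ = λ s → old₂ a (from (e _) s)
  ; split = λ s → [ (λ t → inj₁ (to (e _) t)) , inj₂ ]′ (split a (from (f _) s)) }

add-det : ∀ {N K K' c c'} → Add N K c c' → Add N K' c c' → K ≐ K'
add-det a b x = mk⇔ (go a b) (go b a)
  where
  go : ∀ {N K K' c c'} → Add N K c c' → Add N K' c c' → ∀ {x} → K x → K' x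
  go a b s with split a s
  ... | inj₁ n           = sub b n
  ... | inj₂ (inj₁ refl) = new₁ b
  ... | inj₂ (inj₂ refl) = new₂ b

del-det : ∀ {N N' K c c'} → Add N K c c' → Add N' K c c' → N ≐ N'
del-det a b x = mk⇔ (go a b) (go b a)
  where
  go : ∀ {N N' K c c'} → Add N K c c' → Add N' K c c' → ∀ {x} → N x → N' x
  go a b s with split b (sub a s)
  ... | inj₁ n           = n
  ... | inj₂ (inj₁ refl) = ⊥-elim (old₁ a s)
  ... | inj₂ (inj₂ refl) = ⊥-elim (old₂ a s)

new : ∀ {N K c c' x} → Add N K c c' → K x → ¬ N x → x ≡ c ⊎ x ≡ c'
new a k n with split a k
... | inj₁ s = ⊥-elim (n s)
... | inj₂ e = e

suc≢ : ∀ {n : ℕ} → suc n ≢ n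
suc≢ ()

addH-row-unique : ∀ {N N' K r r' q q'} → AddH N K r q → AddH N' K r' q' → (N ≐ N') → r ≡ r'
addH-row-unique a b e with new b (new₁ a) (λ n → old₁ a (from (e _) n))
... | inj₁ refl = refl
... | inj₂ refl = refl

-- A new domino starts where its row of `N` ends: if q < q', the cell (r, q) lies left of the domino
-- at q', hence in `K'`, although it is neither in `N` nor in that domino.
addH-col-≮ : ∀ {N K K' r q q'} → AddH N K r q → Down K' → AddH N K' r q' → ¬ q < q'
addH-col-≮ a d b lt with split b (left* d (<⇒≤ lt) (new₁ b))
... | inj₁ n           = old₁ a n
... | inj₂ (inj₁ refl) = <-irrefl refl lt
... | inj₂ (inj₂ refl) = <-asym lt (n<1+n _)

addH-col-unique : ∀ {N K K' r q q'} → Down K → Down K' → AddH N K r q → AddH N K' r q' → q ≡ q'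
addH-col-unique d d' a b = ≤-antisym (≮⇒≥ (addH-col-≮ b d a)) (≮⇒≥ (addH-col-≮ a d' b))

addH-unique : ∀ {N K K' r q q'} → Down K → Down K' → AddH N K r q → AddH N K' r q' → K ≐ K'
addH-unique d d' a b with addH-col-unique d d' a b
... | refl = add-det a b

addV-unique : ∀ {N K K' p p' c} → Down K → Down K' → AddV N K p c → AddV N K' p' c → K ≐ K'
addV-unique d d' a b x = addH-unique (down-ᵗ d) (down-ᵗ d') (add-ᵗ a) (add-ᵗ b) (swap x)

-- A removed domino ends its row of `K`: if q < q', the cell (r, q' + 1) survives in `N`, and
-- left-closure would put (r, q) into `N` too.
delH-col-≮ : ∀ {N N' K r q q'} → Down N → AddH N K r q → AddH N' K r q' → ¬ q < q'
delH-col-≮ d a b lt with split a (new₂ b)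
... | inj₁ n           = old₁ a (left* d (≤-trans (<⇒≤ lt) (n≤1+n _)) n)
... | inj₂ (inj₁ refl) = <-asym lt (n<1+n _)
... | inj₂ (inj₂ refl) = <-irrefl refl lt

delH-unique : ∀ {N N' K r q q'} → Down N → Down N' → AddH N K r q → AddH N' K r q' → N ≐ N'
delH-unique d d' a b
  with ≤-antisym (≮⇒≥ (delH-col-≮ d' b a)) (≮⇒≥ (delH-col-≮ d a b))
... | refl = del-det a b

delV-unique : ∀ {N N' K p p' c} → Down N → Down N' → AddV N K p c → AddV N' K p' c → N ≐ N'
delV-unique d d' a b x = delH-unique (down-ᵗ d) (down-ᵗ d') (add-ᵗ a) (add-ᵗ b) (swap x)

same-row : ∀ {N N' K K' x r r' q q'} → AddH N K r q → AddH N' K' r' q' →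
  K x → ¬ N x → K' x → ¬ N' x → r ≡ r'
same-row a b k n k' n' with new a k n | new b k' n'
... | inj₁ refl | inj₁ refl = refl
... | inj₁ refl | inj₂ refl = refl
... | inj₂ refl | inj₁ refl = refl
... | inj₂ refl | inj₂ refl = refl

¬H≡V : ∀ {N N' K r q p c} → AddH N K r q → AddV N' K p c → ¬ (N ≐ N')
¬H≡V a b e with new b (new₁ a) (λ n → old₁ a (from (e _) n)) | new b (new₂ a) (λ n → old₂ a (from (e _) n))
... | inj₁ refl | inj₁ ()
... | inj₁ refl | inj₂ ()
... | inj₂ refl | inj₁ ()
... | inj₂ refl | inj₂ ()

-- Two dominoes at the same region: common first cell and common last cell

data Dom (N K : Region) : Set where
  hor : ∀ r q → AddH N K r q → Dom N K
  ver : ∀ p c → AddV N K p c → Dom N K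

dom-proper : ∀ {N K} → Dom N K → ¬ (N ≐ K)
dom-proper (hor _ _ a) e = old₁ a (from (e _) (new₁ a))
dom-proper (ver _ _ a) e = old₁ a (from (e _) (new₁ a))

-- The configuration of rule 3c: N plus a horizontal and a vertical domino with common first cell (p , q).
data Corner (N K R : Region) (p q : ℕ) : Set where
  hv : AddH N K p q → AddV N R p q → Corner N K R p q
  vh : AddV N K p q → AddH N R p q → Corner N K R p q

corner-swap : ∀ {N K R p q} → Corner N K R p q → Corner N R K p q
corner-swap (hv a b) = vh b a
corner-swap (vh a b) = hv b a

-- Suppose the shared cell were the second cell of one domino. Down-closure puts its first cell into
-- the other larger region; as that cell is not in `N`, it belongs to the other domino as well. But
-- perpendicular dominoes cannot share two cells.
meet-HV : ∀ {N K R r q p c x} → Down K → Down R → AddH N K r q → AddV N R p c →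
  K x → R x → ¬ N x → x ≡ (r , q) × (r , q) ≡ (p , c)
meet-HV dK dR a b k r n with new a k n | new b r n
... | inj₁ refl | inj₁ refl = refl , refl
... | inj₁ refl | inj₂ refl with new a (up dK k) (old₁ b)
...   | inj₁ ()
...   | inj₂ ()
meet-HV dK dR a b k r n | inj₂ refl | e with new b (left dR r) (old₁ a) | e
...   | inj₁ refl | inj₁ ()
...   | inj₁ refl | inj₂ ()
...   | inj₂ refl | inj₁ ()
...   | inj₂ refl | inj₂ ()

-- Dominoes of equal orientation that share a cell lie in one row or column and then coincide, which
-- `K ≐ R` being false excludes. Only perpendicular ones remain.
meet : ∀ {N K R p q} → Down K → Down R → Dom N K → Dom N R → ¬ (K ≐ R) →
  K (p , q) → R (p , q) → ¬ N (p , q) → Corner N K R p q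
meet dK dR (hor _ _ a) (hor _ _ b) ne k r n with same-row a b k n r n
... | refl = ⊥-elim (ne (addH-unique dK dR a b))
meet dK dR (ver _ _ a) (ver _ _ b) ne k r n with same-row (add-ᵗ a) (add-ᵗ b) k n r n
... | refl = ⊥-elim (ne (addV-unique dK dR a b))
meet dK dR (hor _ _ a) (ver _ _ b) ne k r n with meet-HV dK dR a b k r n
... | refl , refl = hv a b
meet dK dR (ver _ _ a) (hor _ _ b) ne k r n with meet-HV dR dK b a r k n
... | refl , refl = vh a b

corner-new : ∀ {N K R p q} → Corner N K R p q → K (p , q) × R (p , q) × ¬ N (p , q)
corner-new (hv a b) = new₁ a , new₁ b , old₁ a
corner-new (vh a b) = new₁ a , new₁ b , old₁ a

corner-∩ : ∀ {N K R p q x} → Down K → Down R → Corner N K R p q → (K x × R x) ⇔ (N x ⊎ x ≡ (p , q))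
corner-∩ {N} {K} {R} {p} {q} {x} dK dR c =
  mk⇔ (λ { (k , r) → go c k r }) (λ { (inj₁ n) → subs c n ; (inj₂ refl) → proj₁ (corner-new c) , proj₁ (proj₂ (corner-new c)) })
  where
  subs : Corner N K R p q → N x → K x × R x
  subs (hv a b) n = sub a n , sub b n
  subs (vh a b) n = sub a n , sub b n
  go : Corner N K R p q → K x → R x → N x ⊎ x ≡ (p , q)
  go (hv a b) k r with split a k | split b r
  ... | inj₁ n | _ = inj₁ n
  ... | inj₂ (inj₁ e) | _ = inj₂ e
  ... | inj₂ (inj₂ e) | inj₁ n = inj₁ n
  ... | inj₂ (inj₂ e) | inj₂ (inj₁ e') = inj₂ e'
  ... | inj₂ (inj₂ refl) | inj₂ (inj₂ ())
  go (vh a b) k r with split a k | split b r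
  ... | inj₁ n | _ = inj₁ n
  ... | inj₂ (inj₁ e) | _ = inj₂ e
  ... | inj₂ (inj₂ e) | inj₁ n = inj₁ n
  ... | inj₂ (inj₂ e) | inj₂ (inj₁ e') = inj₂ e'
  ... | inj₂ (inj₂ refl) | inj₂ (inj₂ ())

H-misses-below : ∀ {N K p q} → AddH N K p q → ¬ N (suc p , q) → ¬ K (suc p , q)
H-misses-below a n k with new a k n
... | inj₁ ()
... | inj₂ ()

corner-out : ∀ {N K R p q} → Down K → Corner N K R p q → ¬ K (suc p , suc q)
corner-out d (hv a b) k = H-misses-below a (old₂ b) (left d k)
corner-out d (vh a b) k = H-misses-below (add-ᵗ a) (old₂ b) (up d k)

-- The complementary configuration: G minus a horizontal and a vertical domino with common last cell
-- (p + 1 , q + 1).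
data Cocorner (K R G : Region) (p q : ℕ) : Set where
  hv : AddH K G (suc p) q → AddV R G p (suc q) → Cocorner K R G p q
  vh : AddV K G p (suc q) → AddH R G (suc p) q → Cocorner K R G p q

cocorner-swap : ∀ {K R G p q} → Cocorner K R G p q → Cocorner R K G p q
cocorner-swap (hv a b) = vh b a
cocorner-swap (vh a b) = hv b a

-- If the shared cell were the first of one domino, the second cell of that domino would also be
-- missing from the other smaller region, hence belong to the other domino, which is perpendicular.
comeet-HV : ∀ {K R G r q p c x} → Down K → Down R → AddH K G r q → AddV R G p c →
  G x → ¬ K x → ¬ R x → (r , suc q) ≡ (suc p , c)
comeet-HV dK dR a b g k r with new a g k | new b g r
... | inj₂ refl | inj₂ refl = refl
... | inj₂ refl | inj₁ refl with new a (new₂ b) (λ s → k (up dK s))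
...   | inj₁ ()
...   | inj₂ ()
comeet-HV dK dR a b g k r | inj₁ refl | e with new b (new₂ a) (λ s → r (left dR s)) | e
...   | inj₁ refl | inj₁ ()
...   | inj₁ refl | inj₂ ()
...   | inj₂ refl | inj₁ ()
...   | inj₂ refl | inj₂ ()

comeet : ∀ {K R G x} → Down K → Down R → Dom K G → Dom R G → ¬ (K ≐ R) →
  G x → ¬ K x → ¬ R x → Σ ℕ λ p → Σ ℕ λ q → Cocorner K R G p q
comeet dK dR (hor _ _ a) (hor _ _ b) ne g k r with same-row a b g k g r
... | refl = ⊥-elim (ne (delH-unique dK dR a b))
comeet dK dR (ver _ _ a) (ver _ _ b) ne g k r with same-row (add-ᵗ a) (add-ᵗ b) g k g r
... | refl = ⊥-elim (ne (delV-unique dK dR a b))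
comeet dK dR (hor _ _ a) (ver _ _ b) ne g k r with comeet-HV dK dR a b g k r
... | refl = _ , _ , hv a b
comeet dK dR (ver _ _ a) (hor _ _ b) ne g k r with comeet-HV dR dK b a g r k
... | refl = _ , _ , vh a b

_∪_∪⟨_⟩ : Region → Region → Cell → Region
(K ∪ R ∪⟨ c ⟩) x = K x ⊎ R x ⊎ x ≡ c

∪-swap : ∀ {K R G c} → G ≐ (K ∪ R ∪⟨ c ⟩) → G ≐ (R ∪ K ∪⟨ c ⟩)
∪-swap e x = mk⇔ (λ g → flip (to (e x) g)) (λ s → from (e x) (flip s))
  where
  flip : ∀ {A B C : Set} → A ⊎ B ⊎ C → B ⊎ A ⊎ C
  flip (inj₁ a)        = inj₂ (inj₁ a)
  flip (inj₂ (inj₁ b)) = inj₁ b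
  flip (inj₂ (inj₂ c)) = inj₂ (inj₂ c)

∪-ᵗ : ∀ {K R G c} → G ≐ (K ∪ R ∪⟨ c ⟩) → (G ᵗ) ≐ ((K ᵗ) ∪ (R ᵗ) ∪⟨ swap c ⟩)
∪-ᵗ e x = mk⇔ (λ g → [ inj₁ , (λ { (inj₁ r) → inj₂ (inj₁ r) ; (inj₂ refl) → inj₂ (inj₂ refl) }) ]′ (to (e (swap x)) g))
  λ { (inj₁ k) → from (e (swap x)) (inj₁ k) ; (inj₂ (inj₁ r)) → from (e (swap x)) (inj₂ (inj₁ r))
    ; (inj₂ (inj₂ refl)) → from (e (swap x)) (inj₂ (inj₂ refl)) }

-- The horizontal domino moves down one row: the upper cell (p, q) of the vertical domino is already
-- in `K`, so `R` contributes only (p + 1, q), and the inserted diagonal cell completes it.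
corner-addH : ∀ {N K R G p q} → Down K → AddH N K p q → AddV N R p q →
  G ≐ (K ∪ R ∪⟨ suc p , suc q ⟩) → AddH K G (suc p) q
corner-addH {K = K} {R} {G} {p} {q} dK a b e = record
  { sub  = λ k → from (e _) (inj₁ k)
  ; new₁ = from (e _) (inj₂ (inj₁ (new₂ b)))
  ; new₂ = from (e _) (inj₂ (inj₂ refl))
  ; old₁ = H-misses-below a (old₂ b)
  ; old₂ = corner-out dK (hv a b)
  ; split = λ g → go (to (e _) g) }
  where
  go : ∀ {x} → (K ∪ R ∪⟨ suc p , suc q ⟩) x → K x ⊎ x ≡ (suc p , q) ⊎ x ≡ (suc p , suc q)
  go (inj₁ k)         = inj₁ k
  go (inj₂ (inj₂ e')) = inj₂ (inj₂ e')
  go (inj₂ (inj₁ r)) with split b r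
  ... | inj₁ n           = inj₁ (sub a n)
  ... | inj₂ (inj₁ refl) = inj₁ (new₁ a)
  ... | inj₂ (inj₂ e')   = inj₂ (inj₁ e')

corner⇒cocorner : ∀ {N K R G p q} → Down K → Down R → Corner N K R p q →
  G ≐ (K ∪ R ∪⟨ suc p , suc q ⟩) → Cocorner K R G p q
corner⇒cocorner dK dR (hv a b) e = hv (corner-addH dK a b e)
  (add-ᵗ (corner-addH (down-ᵗ dR) (add-ᵗ b) (add-ᵗ a) (∪-ᵗ (∪-swap e))))
corner⇒cocorner dK dR (vh a b) e =
  cocorner-swap (corner⇒cocorner dR dK (hv b a) (∪-swap e))

_∩_∖⟨_⟩ : Region → Region → Cell → Region
(K ∩ R ∖⟨ c ⟩) x = (K x × R x) × x ≢ c

∩-swap : ∀ {K R N c} → N ≐ (K ∩ R ∖⟨ c ⟩) → N ≐ (R ∩ K ∖⟨ c ⟩)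
∩-swap e x = mk⇔ (λ n → let (kr , ne) = to (e x) n in swap kr , ne) (λ { (rk , ne) → from (e x) (swap rk , ne) })

∩-ᵗ : ∀ {K R N c} → N ≐ (K ∩ R ∖⟨ c ⟩) → (N ᵗ) ≐ ((K ᵗ) ∩ (R ᵗ) ∖⟨ swap c ⟩)
∩-ᵗ e x = mk⇔ (λ n → let (kr , ne) = to (e (swap x)) n in kr , λ { refl → ne refl })
  (λ { (kr , ne) → from (e (swap x)) (kr , λ { refl → ne refl }) })

_≟_ : (x y : Cell) → Dec (x ≡ y)
_≟_ = ≡-dec _≟ℕ_ _≟ℕ_

cocorner-∈ : ∀ {K R G p q} → Down K → AddH K G (suc p) q → AddV R G p (suc q) → K (p , q)
cocorner-∈ dK a b with split a (new₁ b)
... | inj₁ k         = left dK k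
... | inj₂ (inj₁ ())
... | inj₂ (inj₂ ())

-- Passing from `K` to `N` loses exactly two cells: (p, q + 1), which `R` lacks as the upper cell of
-- its vertical domino, and (p, q), which is removed explicitly.
cocorner-addH : ∀ {N K R G p q} → Down K → Down R → AddH K G (suc p) q → AddV R G p (suc q) →
  N ≐ (K ∩ R ∖⟨ p , q ⟩) → AddH N K p q
cocorner-addH {N} {K} {R} {p = p} {q} dK dR a b e = record
  { sub  = λ n → proj₁ (proj₁ (to (e _) n))
  ; new₁ = cocorner-∈ dK a b
  ; new₂ = new₂'
  ; old₁ = λ n → proj₂ (to (e _) n) refl
  ; old₂ = λ n → old₁ b (proj₂ (proj₁ (to (e _) n)))
  ; split = go }
  where
  new₂' : K (p , suc q)
  new₂' with split a (new₁ b)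
  ... | inj₁ k = k
  ... | inj₂ (inj₁ ())
  ... | inj₂ (inj₂ ())
  go : ∀ {x} → K x → N x ⊎ x ≡ (p , q) ⊎ x ≡ (p , suc q)
  go {x} k with split b (sub a k)
  ... | inj₂ (inj₁ e')   = inj₂ (inj₂ e')
  ... | inj₂ (inj₂ refl) = ⊥-elim (old₂ a k)
  ... | inj₁ r with x ≟ (p , q)
  ...   | yes e' = inj₂ (inj₁ e')
  ...   | no ne  = inj₁ (from (e _) ((k , r) , ne))

cocorner⇒corner : ∀ {N K R G p q} → Down K → Down R → Cocorner K R G p q →
  N ≐ (K ∩ R ∖⟨ p , q ⟩) → Corner N K R p q
cocorner⇒corner dK dR (hv a b) e = hv (cocorner-addH dK dR a b e)
  (add-ᵗ (cocorner-addH (down-ᵗ dR) (down-ᵗ dK) (add-ᵗ b) (add-ᵗ a) (∩-ᵗ (∩-swap e))))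
cocorner⇒corner dK dR (vh a b) e = corner-swap (cocorner⇒corner dR dK (hv b a) (∩-swap e))

-- Among the cells outside `K`, the first, (p + 1, q), is in `R`, which misses only cells of column
-- q + 1. So `K` and `R` together miss just the common last cell.
cocorner-∪-HV : ∀ {K R G p q} → AddH K G (suc p) q → AddV R G p (suc q) → G ≐ (K ∪ R ∪⟨ suc p , suc q ⟩)
cocorner-∪-HV {K} {R} {G} {p} {q} a b x =
  mk⇔ go λ { (inj₁ k) → sub a k ; (inj₂ (inj₁ r)) → sub b r ; (inj₂ (inj₂ refl)) → new₂ a }
  where
  go : G x → (K ∪ R ∪⟨ suc p , suc q ⟩) x
  go g with split a g | split b g
  ... | inj₁ k | _ = inj₁ k
  ... | inj₂ (inj₂ e) | _ = inj₂ (inj₂ e)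
  ... | inj₂ (inj₁ e) | inj₁ r = inj₂ (inj₁ r)
  ... | inj₂ (inj₁ refl) | inj₂ (inj₁ ())
  ... | inj₂ (inj₁ refl) | inj₂ (inj₂ ())

cocorner-∪ : ∀ {K R G p q} → Cocorner K R G p q → G ≐ (K ∪ R ∪⟨ suc p , suc q ⟩)
cocorner-∪ (hv a b) = cocorner-∪-HV a b
cocorner-∪ (vh a b) = ∪-swap (cocorner-∪-HV b a)

-- Constructing shapes

insert : (S : Shape) (c : Cell) → (∀ {i j} → c ≡ (suc i , j) → In S (i , j)) →
  (∀ {i j} → c ≡ (i , suc j) → In S (i , j)) → Shape
insert S c above before = record
  { In = λ x → In S x ⊎ x ≡ c
  ; dec = λ x → dec S x ⊎-dec (x ≟ c)
  ; down = record
    { up   = λ { (inj₁ s) → inj₁ (up (down S) s) ; (inj₂ e) → inj₁ (above (sym e)) }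
    ; left = λ { (inj₁ s) → inj₁ (left (down S) s) ; (inj₂ e) → inj₁ (before (sym e)) } }
  ; bound = bound S + suc (proj₁ c + proj₂ c)
  ; bounded = λ
    { (inj₁ s) → <-≤-trans (proj₁ (bounded S s)) (m≤m+n _ _) , <-≤-trans (proj₂ (bounded S s)) (m≤m+n _ _)
    ; (inj₂ refl) → ≤-trans (s≤s (m≤m+n _ _)) (m≤n+m _ (bound S)) , ≤-trans (s≤s (m≤n+m _ _)) (m≤n+m _ (bound S)) } }

remove : (S : Shape) (c : Cell) → ¬ In S (suc (proj₁ c) , proj₂ c) → ¬ In S (proj₁ c , suc (proj₂ c)) → Shape
remove S c below after = record
  { In = λ x → In S x × x ≢ c
  ; dec = λ x → dec S x ×-dec ¬? (x ≟ c)
  ; down = record { up   = λ (s , _) → up (down S) s , λ { refl → below s }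
                  ; left = λ (s , _) → left (down S) s , λ { refl → after s } }
  ; bound = bound S
  ; bounded = λ (s , _) → bounded S s }

_⊔_ _⊓_ : Shape → Shape → Shape
S ⊔ T = record
  { In = λ x → In S x ⊎ In T x
  ; dec = λ x → dec S x ⊎-dec dec T x
  ; down = record { up   = λ { (inj₁ s) → inj₁ (up (down S) s) ; (inj₂ t) → inj₂ (up (down T) t) }
                  ; left = λ { (inj₁ s) → inj₁ (left (down S) s) ; (inj₂ t) → inj₂ (left (down T) t) } }
  ; bound = bound S + bound T
  ; bounded = λ
    { (inj₁ s) → <-≤-trans (proj₁ (bounded S s)) (m≤m+n _ _) , <-≤-trans (proj₂ (bounded S s)) (m≤m+n _ _)
    ; (inj₂ t) → <-≤-trans (proj₁ (bounded T t)) (m≤n+m _ (bound S)) , <-≤-trans (proj₂ (bounded T t)) (m≤n+m _ (bound S)) } }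
S ⊓ T = record
  { In = λ x → In S x × In T x
  ; dec = λ x → dec S x ×-dec dec T x
  ; down = record { up   = λ (s , t) → up (down S) s , up (down T) t
                  ; left = λ (s , t) → left (down S) s , left (down T) t }
  ; bound = bound S
  ; bounded = λ (s , _) → bounded S s }


extendH : (S : Shape) → ∀ r q → ¬ In S (r , q) → (∀ {j} → j < q → In S (r , j)) →
  (∀ {i} → r ≡ suc i → In S (i , suc q)) → Σ Shape λ T → AddH (In S) (In T) r q
extendH S r q nq lt above = T , record
  { sub = λ s → inj₁ (inj₁ s) ; new₁ = inj₁ (inj₂ refl) ; new₂ = inj₂ refl
  ; old₁ = nq ; old₂ = λ s → nq (left (down S) s)
  ; split = λ { (inj₁ (inj₁ s)) → inj₁ s ; (inj₁ (inj₂ e)) → inj₂ (inj₁ e) ; (inj₂ e) → inj₂ (inj₂ e) } }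
  where
  -- `above` concerns column q + 1; left-closure supplies the cell above (r, q).
  S' = insert S (r , q) (λ { refl → left (down S) (above refl) }) (λ { refl → lt ≤-refl })
  T  = insert S' (r , suc q) (λ { refl → inj₁ (above refl) }) (λ { refl → inj₂ refl })

first-row : (S : Shape) → Σ Shape λ T → Σ ℕ λ q → AddH (In S) (In T) 0 q
first-row S = let (q , nq , lt) = row-end S 0
                  (T , a) = extendH S 0 q nq lt (λ ())
              in T , q , a

-- There is room below the domino: (r + 1, q) is not in `S`, since it would have to lie in `N`,
-- whereas (r, q) does not. So row r + 1 ends at some q' ≤ q, and row r, which reaches q + 1, covers
-- a domino appended there.
next-row : ∀ {N r q} (S : Shape) → Down N → AddH N (In S) r q →
  Σ Shape λ T → Σ ℕ λ q' → AddH (In S) (In T) (suc r) q'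
next-row {N} {r} {q} S dN a =
  let (q' , nq , lt) = row-end S (suc r)
      (T , b) = extendH S (suc r) q' nq lt (λ { refl → left* (down S) (s≤s (q'≤q lt)) (new₂ a) })
  in T , q' , b
  where
  q'≤q : ∀ {q'} → (∀ {j} → j < q' → In S (suc r , j)) → q' ≤ q
  q'≤q lt = ≮⇒≥ λ l → H-misses-below a (λ n → old₁ a (up dN n)) (lt l)

-- Row r of `S` has at least q + 2 cells, because it supports the domino of `G` in row r + 1. Its
-- last two cells start at a column at least q, and below them `S` is empty since (r + 1, q) is not
-- in `S`; hence they can be removed.
previous-row : ∀ {G r q} (S : Shape) → Down G → AddH (In S) G (suc r) q →
  Σ Shape λ T → Σ ℕ λ q' → AddH (In T) (In S) r q'
previous-row {G} {r} {q} S dG a with row-end S r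
... | e , ne , lt with e ≤? suc q
...   | yes le with split a (up dG (new₂ a))
...     | inj₁ s = ⊥-elim (ne (left* (down S) le s))
...     | inj₂ (inj₁ ())
...     | inj₂ (inj₂ ())
previous-row {G} {r} {q} S dG a | zero        , ne , lt | no nle = ⊥-elim (nle z≤n)
previous-row {G} {r} {q} S dG a | suc zero    , ne , lt | no nle = ⊥-elim (nle (s≤s z≤n))
previous-row {G} {r} {q} S dG a | suc (suc e) , ne , lt | no nle = T , e , record
  { sub = λ s → proj₁ (proj₁ s) ; new₁ = lt (n≤1+n _) ; new₂ = lt ≤-refl
  ; old₁ = λ s → proj₂ s refl ; old₂ = λ s → proj₂ (proj₁ s) refl
  ; split = go }
  where
  q≤e : q ≤ e
  q≤e = ≤-pred (≤-pred (≰⇒> nle))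
  S' = remove S (r , suc e)
    (λ s → old₁ a (left* (down S) (≤-trans q≤e (n≤1+n _)) s)) ne
  T  = remove S' (r , e) (λ s → old₁ a (left* (down S) q≤e (proj₁ s))) (λ s → proj₂ s refl)
  go : ∀ {x} → In S x → In T x ⊎ x ≡ (r , e) ⊎ x ≡ (r , suc e)
  go {x} s with x ≟ (r , e) | x ≟ (r , suc e)
  ... | yes p | _     = inj₂ (inj₁ p)
  ... | no _  | yes p = inj₂ (inj₂ p)
  ... | no n  | no n' = inj₁ ((s , n') , n)

-- Dominoes between partitions

add⇒skew : ∀ ν κ {c c'} → Add (I ν) (I κ) c c' → ∀ x → InSkew κ ν x ⇔ (x ≡ c ⊎ x ≡ c')
add⇒skew ν κ a x = mk⇔ (λ (k , n) → new a k n)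
  λ { (inj₁ refl) → new₁ a , old₁ a ; (inj₂ refl) → new₂ a , old₂ a }

skew⇒add : ∀ ν κ {c c'} → ν ⊆ₚ κ → (∀ x → InSkew κ ν x ⇔ (x ≡ c ⊎ x ≡ c')) → Add (I ν) (I κ) c c'
skew⇒add ν κ {c} {c'} s e = record
  { sub  = λ {x} → s x
  ; new₁ = proj₁ (from (e _) (inj₁ refl)) ; new₂ = proj₁ (from (e _) (inj₂ refl))
  ; old₁ = proj₂ (from (e _) (inj₁ refl)) ; old₂ = proj₂ (from (e _) (inj₂ refl))
  ; split = go }
  where
  go : ∀ {x} → I κ x → I ν x ⊎ x ≡ c ⊎ x ≡ c'
  go {x} k with I? ν x
  ... | yes n = inj₁ n
  ... | no nn = inj₂ (to (e x) (k , nn))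

hor⇒add : ∀ ν κ {r} → HorDomInRow ν κ r → Σ ℕ λ q → AddH (I ν) (I κ) r q
hor⇒add ν κ (s , q , e) = q , skew⇒add ν κ s e

ver⇒add : ∀ ν κ {c} → VerDomInCol ν κ c → Σ ℕ λ p → AddV (I ν) (I κ) p c
ver⇒add ν κ (s , p , e) = p , skew⇒add ν κ s e

add⇒hor : ∀ ν κ {r q} → AddH (I ν) (I κ) r q → HorDomInRow ν κ r
add⇒hor ν κ a = (λ _ → sub a) , _ , add⇒skew ν κ a

add⇒ver : ∀ ν κ {p c} → AddV (I ν) (I κ) p c → VerDomInCol ν κ c
add⇒ver ν κ a = (λ _ → sub a) , _ , add⇒skew ν κ a

<d⇒dom : ∀ ν κ → ν <d κ → Dom (I ν) (I κ)
<d⇒dom ν κ (s , _ , _ , hor i j , e) = hor i j (skew⇒add ν κ s e)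
<d⇒dom ν κ (s , _ , _ , ver i j , e) = ver i j (skew⇒add ν κ s e)

dom⇒<d : ∀ ν κ → Dom (I ν) (I κ) → ν <d κ
dom⇒<d ν κ (hor r q a) = (λ _ → sub a) , _ , _ , hor r q , add⇒skew ν κ a
dom⇒<d ν κ (ver p c a) = (λ _ → sub a) , _ , _ , ver p c , add⇒skew ν κ a

-- The relation `≤d` with its properness as an index, so that proper steps can be counted. `stay`
-- holds an equality of lists to make matching identify the two partitions.
data Step (ν κ : List ℕ) : Bool → Set where
  stay : ν ≡ κ → Step ν κ false
  grow : ν <d κ → Step ν κ true

step-⊆ : ∀ {ν κ b} → Step ν κ b → ν ⊆ₚ κ
step-⊆ (stay refl) x s = s
step-⊆ (grow d)    = proj₁ d

-- a, b, a', b' say whether the steps ν → κ, ν → ρ, ρ → γ, κ → γ around a square with entry e are proper.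
data Transfer : ℤ → (a b a' b' : Bool) → Set where
  zero  : ∀ {a b} → Transfer (+ 0) a b a b
  plus  : Transfer (+ 1) false false true true
  minus : Transfer -[1+ 0 ] false false true true

-- Uniqueness of the local rules and of their inverses

-- The ways a domino of `G` over `K` arises when κ = ρ: pushed on from the preceding row or column
-- (subscript +), or created in row or column 0 by a nonzero entry (subscript 0). The entry is fixed
-- by an equation, so that squares with different entries can be compared.
data Diagonal (N K : Region) (e : ℤ) (G : Region) : Set where
  hor₊ : ∀ r {q q'} → e ≡ + 0 → AddH N K r q → AddH K G (suc r) q' → Diagonal N K e G
  ver₊ : ∀ c {p p'} → e ≡ + 0 → AddV N K p c → AddV K G p' (suc c) → Diagonal N K e G
  hor₀ : ∀ {q} → e ≡ + 1 → N ≐ K → AddH K G 0 q → Diagonal N K e G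
  ver₀ : ∀ {p} → e ≡ -[1+ 0 ] → N ≐ K → AddV K G p 0 → Diagonal N K e G

diagonal-grows : ∀ {N K e G} → Diagonal N K e G → Dom K G
diagonal-grows (hor₊ _ _ _ b) = hor _ _ b
diagonal-grows (ver₊ _ _ _ b) = ver _ _ b
diagonal-grows (hor₀ _ _ b)   = hor _ _ b
diagonal-grows (ver₀ _ _ b)   = ver _ _ b

-- Rules 3a and 3b are merged into `union`; rules 3d, 3e and 1, 2 into `diagonal`.
data View (N K R : Region) (e : ℤ) (G : Region) : Set where
  union    : e ≡ + 0 → (∀ x → N x ⇔ (K x × R x)) → (∀ x → G x ⇔ (K x ⊎ R x)) → View N K R e G
  corner   : ∀ p q → e ≡ + 0 → ¬ (K ≐ R) → Corner N K R p q →
             G ≐ (K ∪ R ∪⟨ suc p , suc q ⟩) → View N K R e G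
  diagonal : K ≐ R → Diagonal N K e G → View N K R e G

diagonal-fwd-unique : ∀ {N K G G' e} → Down G → Down G' →
  Diagonal N K e G → Diagonal N K e G' → G ≐ G'
diagonal-fwd-unique d d' (hor₊ r _ a b) (hor₊ r' _ a' b') with addH-row-unique a a' ≐-refl
... | refl = addH-unique d d' b b'
diagonal-fwd-unique d d' (ver₊ c _ a b) (ver₊ c' _ a' b') with addH-row-unique (add-ᵗ a) (add-ᵗ a') ≐-refl
... | refl = addV-unique d d' b b'
diagonal-fwd-unique d d' (hor₊ _ _ a _) (ver₊ _ _ a' _) = ⊥-elim (¬H≡V a a' ≐-refl)
diagonal-fwd-unique d d' (ver₊ _ _ a _) (hor₊ _ _ a' _) = ⊥-elim (¬H≡V a' a ≐-refl)
diagonal-fwd-unique d d' (hor₀ _ _ b) (hor₀ _ _ b')   = addH-unique d d' b b'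
diagonal-fwd-unique d d' (ver₀ _ _ b) (ver₀ _ _ b')   = addV-unique d d' b b'
diagonal-fwd-unique d d' (hor₊ _ refl _ _) (hor₀ () _ _)
diagonal-fwd-unique d d' (hor₊ _ refl _ _) (ver₀ () _ _)
diagonal-fwd-unique d d' (ver₊ _ refl _ _) (hor₀ () _ _)
diagonal-fwd-unique d d' (ver₊ _ refl _ _) (ver₀ () _ _)
diagonal-fwd-unique d d' (hor₀ refl _ _) (hor₊ _ () _ _)
diagonal-fwd-unique d d' (hor₀ refl _ _) (ver₊ _ () _ _)
diagonal-fwd-unique d d' (hor₀ refl _ _) (ver₀ () _ _)
diagonal-fwd-unique d d' (ver₀ refl _ _) (hor₊ _ () _ _)
diagonal-fwd-unique d d' (ver₀ refl _ _) (ver₊ _ () _ _)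
diagonal-fwd-unique d d' (ver₀ refl _ _) (hor₀ () _ _)

union≢corner : ∀ {N K R p q} → (∀ x → N x ⇔ (K x × R x)) → ¬ Corner N K R p q
union≢corner n c = let (k , r , nn) = corner-new c in nn (from (n _) (k , r))

union≢diagonal : ∀ {N K R e G} → e ≡ + 0 → (∀ x → N x ⇔ (K x × R x)) → K ≐ R → ¬ Diagonal N K e G
union≢diagonal {N} {K} e0 n kr = go
  where
  K⇒N : ∀ {x} → K x → N x
  K⇒N k = from (n _) (k , to (kr _) k)
  go : ¬ Diagonal _ _ _ _
  go (hor₊ _ _ a _) = old₁ a (K⇒N (new₁ a))
  go (ver₊ _ _ a _) = old₁ a (K⇒N (new₁ a))
  go (hor₀ e1 _ _) with trans (sym e0) e1
  ... | ()
  go (ver₀ e1 _ _) with trans (sym e0) e1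
  ... | ()

-- When the entry is 0, `N` is the intersection of `K` and `R` for `union` and for no other view;
-- `corner` and `diagonal` are told apart by `K ≐ R`. In a corner, (p, q) is the only cell of the
-- intersection outside `N`, so `p` and `q` are determined.
fwd-unique : ∀ {N K R G G' e} → Down K → Down R → Down G → Down G' →
  View N K R e G → View N K R e G' → G ≐ G'
fwd-unique dK dR d d' (union _ _ g) (union _ _ g') = ≐-trans g (≐-sym g')
fwd-unique dK dR d d' (union _ n _) (corner _ _ _ _ c _) = ⊥-elim (union≢corner n c)
fwd-unique dK dR d d' (corner _ _ _ _ c _) (union _ n _) = ⊥-elim (union≢corner n c)
fwd-unique dK dR d d' (union e n _) (diagonal kr v) = ⊥-elim (union≢diagonal e n kr v)
fwd-unique dK dR d d' (diagonal kr v) (union e n _) = ⊥-elim (union≢diagonal e n kr v)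
fwd-unique dK dR d d' (corner _ _ _ ne _ _) (diagonal kr _) = ⊥-elim (ne kr)
fwd-unique dK dR d d' (diagonal kr _) (corner _ _ _ ne _ _) = ⊥-elim (ne kr)
fwd-unique dK dR d d' (diagonal _ v) (diagonal _ v') = diagonal-fwd-unique d d' v v'
fwd-unique dK dR d d' (corner _ _ _ _ c g) (corner _ _ _ _ c' g')
  with to (corner-∩ dK dR c') (from (corner-∩ dK dR c) (inj₂ refl))
... | inj₁ n    = ⊥-elim (proj₂ (proj₂ (corner-new c)) n)
... | inj₂ refl = ≐-trans g (≐-sym g')

diagonal-bwd-unique : ∀ {N N' K G e e'} → Down N → Down N' →
  Diagonal N K e G → Diagonal N' K e' G → (N ≐ N') × e ≡ e'
diagonal-bwd-unique d d' (hor₊ r refl a b) (hor₊ r' refl a' b') with addH-row-unique b b' ≐-refl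
... | refl = delH-unique d d' a a' , refl
diagonal-bwd-unique d d' (ver₊ c refl a b) (ver₊ c' refl a' b') with addH-row-unique (add-ᵗ b) (add-ᵗ b') ≐-refl
... | refl = delV-unique d d' a a' , refl
diagonal-bwd-unique d d' (hor₀ refl n _) (hor₀ refl n' _) = ≐-trans n (≐-sym n') , refl
diagonal-bwd-unique d d' (ver₀ refl n _) (ver₀ refl n' _) = ≐-trans n (≐-sym n') , refl
diagonal-bwd-unique d d' (hor₊ _ _ _ b) (hor₀ _ _ b') with addH-row-unique b b' ≐-refl
... | ()
diagonal-bwd-unique d d' (hor₀ _ _ b) (hor₊ _ _ _ b') with addH-row-unique b b' ≐-refl
... | ()
diagonal-bwd-unique d d' (ver₊ _ _ _ b) (ver₀ _ _ b') with addH-row-unique (add-ᵗ b) (add-ᵗ b') ≐-refl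
... | ()
diagonal-bwd-unique d d' (ver₀ _ _ b) (ver₊ _ _ _ b') with addH-row-unique (add-ᵗ b) (add-ᵗ b') ≐-refl
... | ()
diagonal-bwd-unique d d' (hor₊ _ _ _ b) (ver₊ _ _ _ b') = ⊥-elim (¬H≡V b b' ≐-refl)
diagonal-bwd-unique d d' (hor₊ _ _ _ b) (ver₀ _ _ b')   = ⊥-elim (¬H≡V b b' ≐-refl)
diagonal-bwd-unique d d' (hor₀ _ _ b)   (ver₊ _ _ _ b') = ⊥-elim (¬H≡V b b' ≐-refl)
diagonal-bwd-unique d d' (hor₀ _ _ b)   (ver₀ _ _ b')   = ⊥-elim (¬H≡V b b' ≐-refl)
diagonal-bwd-unique d d' (ver₊ _ _ _ b) (hor₊ _ _ _ b') = ⊥-elim (¬H≡V b' b ≐-refl)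
diagonal-bwd-unique d d' (ver₊ _ _ _ b) (hor₀ _ _ b')   = ⊥-elim (¬H≡V b' b ≐-refl)
diagonal-bwd-unique d d' (ver₀ _ _ b)   (hor₊ _ _ _ b') = ⊥-elim (¬H≡V b' b ≐-refl)
diagonal-bwd-unique d d' (ver₀ _ _ b)   (hor₀ _ _ b')   = ⊥-elim (¬H≡V b' b ≐-refl)

corner-outside : ∀ {N K R p q} → Down K → Down R → Corner N K R p q →
  ¬ (K (suc p , suc q) ⊎ R (suc p , suc q))
corner-outside dK dR c = [ corner-out dK c , corner-out dR (corner-swap c) ]′

union-covered : ∀ {K R G : Region} → K ≐ R → (∀ x → G x ⇔ (K x ⊎ R x)) → K ≐ G
union-covered kr g x = mk⇔ (λ k → from (g x) (inj₁ k)) (λ s → [ (λ k → k) , from (kr x) ]′ (to (g x) s))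

-- Here `G` tells the views apart: it is the union of `K` and `R` for `union` only, and `K ≐ R`
-- separates the other two. In a corner the one cell of `G` outside the union gives `p` and `q`, and
-- then `N` is the intersection without (p, q).
bwd-unique : ∀ {N N' K R G e e'} → Down N → Down N' → Down K → Down R →
  View N K R e G → View N' K R e' G → (N ≐ N') × e ≡ e'
bwd-unique d d' dK dR (union refl n _) (union refl n' _) = ≐-trans n (≐-sym n') , refl
bwd-unique d d' dK dR (union _ _ g) (corner _ _ _ _ c g') =
  ⊥-elim (corner-outside dK dR c (to (g _) (from (g' _) (inj₂ (inj₂ refl)))))
bwd-unique d d' dK dR (corner _ _ _ _ c g') (union _ _ g) =
  ⊥-elim (corner-outside dK dR c (to (g _) (from (g' _) (inj₂ (inj₂ refl)))))
bwd-unique d d' dK dR (union _ _ g) (diagonal kr v) = ⊥-elim (dom-proper (diagonal-grows v) (union-covered kr g))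
bwd-unique d d' dK dR (diagonal kr v) (union _ _ g) = ⊥-elim (dom-proper (diagonal-grows v) (union-covered kr g))
bwd-unique d d' dK dR (corner _ _ _ ne _ _) (diagonal kr _) = ⊥-elim (ne kr)
bwd-unique d d' dK dR (diagonal kr _) (corner _ _ _ ne _ _) = ⊥-elim (ne kr)
bwd-unique d d' dK dR (diagonal _ v) (diagonal _ v') = diagonal-bwd-unique d d' v v'
bwd-unique {N} {N'} d d' dK dR (corner _ _ refl _ c g) (corner _ _ refl _ c' g')
  with to (g' _) (from (g _) (inj₂ (inj₂ refl)))
... | inj₁ k        = ⊥-elim (corner-out dK c k)
... | inj₂ (inj₁ r) = ⊥-elim (corner-out dR (corner-swap c) r)
... | inj₂ (inj₂ refl) = (λ x → mk⇔ (go c c') (go c' c)) , refl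
  where
  go : ∀ {N N' x} → Corner N _ _ _ _ → Corner N' _ _ _ _ → N x → N' x
  go c c' n with to (corner-∩ dK dR c') (from (corner-∩ dK dR c) (inj₁ n))
  ... | inj₁ n'   = n'
  ... | inj₂ refl = ⊥-elim (proj₂ (proj₂ (corner-new c)) n)

-- In rule 3a the steps provide the inclusions of ν in κ and in ρ; as one of these is an equality, ν
-- is their intersection. In rule 3b disjointness of the dominoes says the same.
local⇒view : ∀ {ν κ ρ γ e a b} → IsPartition κ → IsPartition ρ → Step ν κ a → Step ν ρ b →
  Local ν κ ρ e γ → View (I ν) (I κ) (I ρ) e (I γ)
local⇒view {ν} {κ} {ρ} {γ} hκ hρ s t (rule1 νκ νρ h) =
  diagonal (≐-trans {I κ} {I ν} {I ρ} (≐-sym {I ν} {I κ} νκ) νρ) (hor₀ refl νκ (proj₂ (hor⇒add κ γ h)))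
local⇒view {ν} {κ} {ρ} {γ} hκ hρ s t (rule2 νκ νρ h) =
  diagonal (≐-trans {I κ} {I ν} {I ρ} (≐-sym {I ν} {I κ} νκ) νρ) (ver₀ refl νκ (proj₂ (ver⇒add κ γ h)))
local⇒view {ν} {κ} {ρ} {γ} hκ hρ s t (rule3a eq largest ν⊆γ κ⊆γ ρ⊆γ) = union refl
  (λ x → mk⇔ (λ n → step-⊆ s x n , step-⊆ t x n)
             (λ (k , r) → [ (λ e → from (e x) k) , (λ e → from (e x) r) ]′ eq))
  (λ x → mk⇔ (λ g → [ (λ e → inj₁ (step-⊆ s x (to (e x) g))) ,
                      [ (λ e → inj₁ (to (e x) g)) , (λ e → inj₂ (to (e x) g)) ]′ ]′ largest)
             [ κ⊆γ x , ρ⊆γ x ]′)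
local⇒view {ν} {κ} {ρ} hκ hρ s t (rule3b νκ νρ _ disjoint g) =
  union refl (λ x → mk⇔ (λ n → proj₁ νκ x n , proj₁ νρ x n) (meets x)) g
  where
  meets : ∀ x → I κ x × I ρ x → I ν x
  meets x (k , r) with I? ν x
  ... | yes n = n
  ... | no nn = ⊥-elim (disjoint (x , (k , nn) , (r , nn)))
local⇒view {ν} {κ} {ρ} hκ hρ s t (rule3c p q νκ νρ ne (k , n) (r , _) g) = corner p q refl ne
  (meet (partition-down hκ) (partition-down hρ) (<d⇒dom ν κ νκ) (<d⇒dom ν ρ νρ) ne k r n) g
local⇒view {ν} {κ} {ρ} {γ} hκ hρ s t (rule3d r _ κρ h h') =
  diagonal κρ (hor₊ r refl (proj₂ (hor⇒add ν κ h)) (proj₂ (hor⇒add κ γ h')))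
local⇒view {ν} {κ} {ρ} {γ} hκ hρ s t (rule3e c _ κρ h h') =
  diagonal κρ (ver₊ c refl (proj₂ (ver⇒add ν κ h)) (proj₂ (ver⇒add κ γ h')))

-- Existence for the local rules and their inverses

new? : ∀ {N K c c'} {P : Region} → Add N K c c' → (∀ x → Dec (P x)) →
  Dec (Σ Cell λ x → (K x × ¬ N x) × P x)
new? {c = c} {c'} {P} a P? with P? c | P? c'
... | yes p | _     = yes (c , (new₁ a , old₁ a) , p)
... | no _  | yes p = yes (c' , (new₂ a , old₂ a) , p)
... | no n  | no n' = no λ (x , (k , nn) , p) →
      [ (λ { refl → n p }) , (λ { refl → n' p }) ]′ (new a k nn)

new-dom? : ∀ {N K} {P : Region} → Dom N K → (∀ x → Dec (P x)) →
  Dec (Σ Cell λ x → (K x × ¬ N x) × P x)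
new-dom? (hor _ _ a) = new? a
new-dom? (ver _ _ a) = new? a

map-dom : ∀ {N K N' K'} → (∀ {c c'} → Add N K c c' → Add N' K' c c') → Dom N K → Dom N' K'
map-dom f (hor r q a) = hor r q (f a)
map-dom f (ver p c a) = ver p c (f a)

-- When `N` contains the intersection, the cells of `G` outside `K` are the cells of `R` outside
-- `N`, so the same domino is added.
∪-add : ∀ {N K R G c c'} → (∀ {x} → N x → K x) → (∀ x → K x → R x → N x) →
  (∀ x → G x ⇔ (K x ⊎ R x)) → Add N R c c' → Add K G c c'
∪-add s disjoint g a = record
  { sub  = λ k → from (g _) (inj₁ k)
  ; new₁ = from (g _) (inj₂ (new₁ a)) ; new₂ = from (g _) (inj₂ (new₂ a))
  ; old₁ = λ k → old₁ a (disjoint _ k (new₁ a)) ; old₂ = λ k → old₂ a (disjoint _ k (new₂ a))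
  ; split = λ t → [ inj₁ , (λ r → [ (λ n → inj₁ (s n)) , inj₂ ]′ (split a r)) ]′ (to (g _) t) }

-- The dual of `∪-add`: when `K` and `R` cover `G`, the cells of `K` outside the intersection are
-- the cells of `G` outside `R`.
∩-add : ∀ {N K R G c c'} → (∀ x → N x ⇔ (K x × R x)) → (∀ {x} → K x → G x) →
  (∀ x → G x → K x ⊎ R x) → Add R G c c' → Add N K c c'
∩-add {K = K} {R} {G} n s cover a = record
  { sub  = λ m → proj₁ (to (n _) m)
  ; new₁ = only (new₁ a) (old₁ a) ; new₂ = only (new₂ a) (old₂ a)
  ; old₁ = λ m → old₁ a (proj₂ (to (n _) m)) ; old₂ = λ m → old₂ a (proj₂ (to (n _) m))
  ; split = λ k → [ (λ r → inj₁ (from (n _) (k , r))) , inj₂ ]′ (split a (s k)) }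
  where
  only : ∀ {x} → G x → ¬ R x → K x
  only g nr = [ (λ k → k) , (λ r → ⊥-elim (nr r)) ]′ (cover _ g)

corner-doms : ∀ {N K R p q} → Corner N K R p q → Dom N K × Dom N R
corner-doms (hv a b) = hor _ _ a , ver _ _ b
corner-doms (vh a b) = ver _ _ a , hor _ _ b

cocorner-doms : ∀ {K R G p q} → Cocorner K R G p q → Dom K G × Dom R G
cocorner-doms (hv a b) = hor _ _ a , ver _ _ b
cocorner-doms (vh a b) = ver _ _ a , hor _ _ b

realise-above : ∀ {κ c c'} (T : Shape) → Add (I κ) (In T) c c' →
  Σ (List ℕ) λ γ → IsPartition γ × Add (I κ) (I γ) c c'
realise-above {κ} T a = let (γ , hγ , e) = realise T
                        in γ , hγ , add-≐ (≐-refl {I κ}) (≐-sym {I γ} e) a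

realise-below : ∀ {κ c c'} (T : Shape) → Add (In T) (I κ) c c' →
  Σ (List ℕ) λ ν → IsPartition ν × Add (I ν) (I κ) c c'
realise-below {κ} T a = let (ν , hν , e) = realise T
                        in ν , hν , add-≐ (≐-sym {I ν} e) (≐-refl {I κ}) a

growH : ∀ ν κ {r q} → AddH (I ν) (I κ) r q → Step ν κ true
growH ν κ a = grow (dom⇒<d ν κ (hor _ _ a))

growV : ∀ ν κ {p c} → AddV (I ν) (I κ) p c → Step ν κ true
growV ν κ a = grow (dom⇒<d ν κ (ver _ _ a))

FwdSquare : (ν κ ρ : List ℕ) (e : ℤ) (a' b' : Bool) → Set
FwdSquare ν κ ρ e a' b' = Σ (List ℕ) λ γ →
  IsPartition γ × Step ρ γ a' × Step κ γ b' × Local ν κ ρ e γ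

fwd-diagonal : ∀ ν κ → IsPartition ν → IsPartition κ → ν <d κ → Dom (I ν) (I κ) →
  FwdSquare ν κ κ (+ 0) true true
fwd-diagonal ν κ hν hκ d (hor r q a) =
  let (T , _ , b)   = next-row (shape κ hκ) (partition-down hν) a
      (γ , hγ , b') = realise-above {κ} T b
      st            = growH κ γ b'
  in γ , hγ , st , st , rule3d r d (≐-refl {I κ}) (add⇒hor ν κ a) (add⇒hor κ γ b')
fwd-diagonal ν κ hν hκ d (ver p c a) =
  let (T , _ , b)   = next-row (transposed (shape κ hκ)) (down-ᵗ (partition-down hν)) (add-ᵗ a)
      (γ , hγ , b') = realise-above {κ} (transposed T) (add-ᵗ b)
      st            = growV κ γ b'
  in γ , hγ , st , st , rule3e c d (≐-refl {I κ}) (add⇒ver ν κ a) (add⇒ver κ γ b')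

fwd-corner : ∀ ν κ ρ {p q} → IsPartition κ → IsPartition ρ → ν <d κ → ν <d ρ → ¬ (κ ≋ ρ) →
  Corner (I ν) (I κ) (I ρ) p q → FwdSquare ν κ ρ (+ 0) true true
fwd-corner ν κ ρ {p} {q} hκ hρ d d' ne c =
  let (γ , hγ , e) = realise T
      g            = ≐-trans {I γ} e assoc
      (dκ , dρ)    = cocorner-doms (corner⇒cocorner (partition-down hκ) (partition-down hρ) c g)
      (k , r , n)  = corner-new c
  in γ , hγ , grow (dom⇒<d ρ γ dρ) , grow (dom⇒<d κ γ dκ) , rule3c p q d d' ne (k , n) (r , n) g
  where
  above : Corner (I ν) (I κ) (I ρ) p q → I κ (p , suc q) ⊎ I ρ (p , suc q)
  above (hv a b) = inj₁ (new₂ a)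
  above (vh a b) = inj₂ (new₂ b)
  before : Corner (I ν) (I κ) (I ρ) p q → I κ (suc p , q) ⊎ I ρ (suc p , q)
  before (hv a b) = inj₂ (new₂ b)
  before (vh a b) = inj₁ (new₂ a)
  -- The cells above and to the left of (p + 1, q + 1) are the second cells of the horizontal and of
  -- the vertical domino.
  T = insert (shape κ hκ ⊔ shape ρ hρ) (suc p , suc q) (λ { refl → above c }) (λ { refl → before c })
  assoc : In T ≐ (I κ ∪ I ρ ∪⟨ suc p , suc q ⟩)
  assoc x = mk⇔ (λ { (inj₁ (inj₁ k)) → inj₁ k ; (inj₁ (inj₂ r)) → inj₂ (inj₁ r) ; (inj₂ e) → inj₂ (inj₂ e) })
                (λ { (inj₁ k) → inj₁ (inj₁ k) ; (inj₂ (inj₁ r)) → inj₁ (inj₂ r) ; (inj₂ (inj₂ e)) → inj₂ e })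

fwd-disjoint : ∀ ν κ ρ → IsPartition κ → IsPartition ρ → ν <d κ → ν <d ρ → ¬ (κ ≋ ρ) →
  ¬ (Σ Cell λ x → InSkew κ ν x × I ρ x) → FwdSquare ν κ ρ (+ 0) true true
fwd-disjoint ν κ ρ hκ hρ d d' ne disjoint =
  let (γ , hγ , g) = realise (shape κ hκ ⊔ shape ρ hρ)
  in γ , hγ
   , grow (dom⇒<d ρ γ (map-dom (∪-add (λ {x} → proj₁ d' x) (λ x r k → meets x k r) (λ x → ⊎-flip (g x))) (<d⇒dom ν κ d)))
   , grow (dom⇒<d κ γ (map-dom (∪-add (λ {x} → proj₁ d x) meets g) (<d⇒dom ν ρ d')))
   , rule3b d d' ne (λ (x , s , (r , _)) → disjoint (x , s , r)) g
  where
  ⊎-flip : ∀ {A B C : Set} → A ⇔ (B ⊎ C) → A ⇔ (C ⊎ B)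
  ⊎-flip e = mk⇔ (Sum.swap ∘ to e) (from e ∘ Sum.swap)
  meets : ∀ x → I κ x → I ρ x → I ν x
  meets x k r with I? ν x
  ... | yes n = n
  ... | no nn = ⊥-elim (disjoint (x , (k , nn) , r))

fwd-square : ∀ {ν κ ρ e a b a' b'} → IsPartition ν → IsPartition κ → IsPartition ρ →
  Step ν κ a → Step ν ρ b → Transfer e a b a' b' → FwdSquare ν κ ρ e a' b'
fwd-square {ν} {_} {ρ} hν hκ hρ (stay refl) t zero =
  ρ , hρ , stay refl , t , rule3a (inj₁ (≐-refl {I ν})) (inj₂ (inj₂ (≐-refl {I ρ}))) (step-⊆ t) (step-⊆ t) (λ _ r → r)
fwd-square {ν} {κ} hν hκ hρ s@(grow _) (stay refl) zero =
  κ , hκ , s , stay refl , rule3a (inj₂ (≐-refl {I ν})) (inj₂ (inj₁ (≐-refl {I κ}))) (step-⊆ s) (λ _ k → k) (step-⊆ s)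
fwd-square {ν} {κ} {ρ} hν hκ hρ (grow d) (grow d') zero with List-≡-dec _≟ℕ_ κ ρ
... | yes refl = fwd-diagonal ν κ hν hκ d (<d⇒dom ν κ d)
... | no κ≢ρ with new-dom? (<d⇒dom ν κ d) (I? ρ)
...   | no disjoint = fwd-disjoint ν κ ρ hκ hρ d d' (λ e → κ≢ρ (≋⇒≡ hκ hρ e)) disjoint
...   | yes (_ , (k , n) , r) = fwd-corner ν κ ρ hκ hρ d d' ne
          (meet (partition-down hκ) (partition-down hρ) (<d⇒dom ν κ d) (<d⇒dom ν ρ d') ne k r n)
  where ne = λ e → κ≢ρ (≋⇒≡ hκ hρ e)
fwd-square {κ = κ} hν hκ hρ (stay refl) (stay refl) plus =
  let (T , _ , b)   = first-row (shape κ hκ)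
      (γ , hγ , b') = realise-above {κ} T b
      st            = growH κ γ b'
  in γ , hγ , st , st , rule1 (≐-refl {I κ}) (≐-refl {I κ}) (add⇒hor κ γ b')
fwd-square {κ = κ} hν hκ hρ (stay refl) (stay refl) minus =
  let (T , _ , b)   = first-row (transposed (shape κ hκ))
      (γ , hγ , b') = realise-above {κ} (transposed T) (add-ᵗ b)
      st            = growV κ γ b'
  in γ , hγ , st , st , rule2 (≐-refl {I κ}) (≐-refl {I κ}) (add⇒ver κ γ b')

record BwdSquare (κ ρ γ : List ℕ) (a' b' : Bool) : Set where
  constructor bwd
  field
    {ν}      : List ℕ
    {e}      : ℤ
    {a b}    : Bool
    hν       : IsPartition ν
    top      : Step ν κ a
    side     : Step ν ρ b
    transfer : Transfer e a b a' b'
    local    : Local ν κ ρ e γ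

bwd-diagonal : ∀ κ γ → IsPartition κ → IsPartition γ → Dom (I κ) (I γ) → BwdSquare κ κ γ true true
bwd-diagonal κ γ hκ hγ (hor zero q a) =
  bwd hκ (stay refl) (stay refl) plus (rule1 (≐-refl {I κ}) (≐-refl {I κ}) (add⇒hor κ γ a))
bwd-diagonal κ γ hκ hγ (hor (suc r) q a) =
  let (T , _ , b)   = previous-row (shape κ hκ) (partition-down hγ) a
      (ν , hν , b') = realise-below {κ} T b
      d             = dom⇒<d ν κ (hor _ _ b')
  in bwd hν (grow d) (grow d) zero (rule3d r d (≐-refl {I κ}) (add⇒hor ν κ b') (add⇒hor κ γ a))
bwd-diagonal κ γ hκ hγ (ver p zero a) =
  bwd hκ (stay refl) (stay refl) minus (rule2 (≐-refl {I κ}) (≐-refl {I κ}) (add⇒ver κ γ a))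
bwd-diagonal κ γ hκ hγ (ver p (suc c) a) =
  let (T , _ , b)   = previous-row (transposed (shape κ hκ)) (down-ᵗ (partition-down hγ)) (add-ᵗ a)
      (ν , hν , b') = realise-below {κ} (transposed T) (add-ᵗ b)
      d             = dom⇒<d ν κ (ver _ _ b')
  in bwd hν (grow d) (grow d) zero (rule3e c d (≐-refl {I κ}) (add⇒ver ν κ b') (add⇒ver κ γ a))

bwd-corner : ∀ κ ρ γ {p q} → IsPartition κ → IsPartition ρ → ¬ (κ ≋ ρ) →
  Cocorner (I κ) (I ρ) (I γ) p q → BwdSquare κ ρ γ true true
bwd-corner κ ρ γ {p} {q} hκ hρ ne c =
  let (ν , hν , e) = realise T
      c'           = cocorner⇒corner (partition-down hκ) (partition-down hρ) c e
      (dκ , dρ)    = corner-doms c'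
      (k , r , n)  = corner-new c'
  in bwd hν (grow (dom⇒<d ν κ dκ)) (grow (dom⇒<d ν ρ dρ)) zero
       (rule3c p q (dom⇒<d ν κ dκ) (dom⇒<d ν ρ dρ) ne (k , n) (r , n) (cocorner-∪ c))
  where
  below : Cocorner (I κ) (I ρ) (I γ) p q → ¬ (I κ (suc p , q) × I ρ (suc p , q))
  below (hv a b) (k , r) = old₁ a k
  below (vh a b) (k , r) = old₁ b r
  after : Cocorner (I κ) (I ρ) (I γ) p q → ¬ (I κ (p , suc q) × I ρ (p , suc q))
  after (hv a b) (k , r) = old₁ b r
  after (vh a b) (k , r) = old₁ a k
  T = remove (shape κ hκ ⊓ shape ρ hρ) (p , q) (below c) (after c)

-- The hypothesis on γ/κ says that κ and ρ cover γ. Hence γ = κ ∪ ρ, and ν can only be κ ∩ ρ.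
bwd-disjoint : ∀ κ ρ γ → IsPartition κ → IsPartition ρ → κ <d γ → ρ <d γ → ¬ (κ ≋ ρ) →
  ¬ (Σ Cell λ x → InSkew γ κ x × ¬ I ρ x) → BwdSquare κ ρ γ true true
bwd-disjoint κ ρ γ hκ hρ d d' ne disjoint =
  let (ν , hν , n) = realise (shape κ hκ ⊓ shape ρ hρ)
      dκ = dom⇒<d ν κ (map-dom (∩-add n (λ {x} → proj₁ d x) cover) (<d⇒dom ρ γ d'))
      dρ = dom⇒<d ν ρ (map-dom (∩-add (λ x → mk⇔ (swap ∘ to (n x)) (from (n x) ∘ swap)) (λ {x} → proj₁ d' x)
                                       (λ x g → Sum.swap (cover x g))) (<d⇒dom κ γ d))
  in bwd hν (grow dκ) (grow dρ) zero
       (rule3b dκ dρ ne (λ (x , (k , nn) , (r , _)) → nn (from (n x) (k , r)))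
          (λ x → mk⇔ (cover x) [ proj₁ d x , proj₁ d' x ]′))
  where
  cover : ∀ x → I γ x → I κ x ⊎ I ρ x
  cover x g with I? κ x | I? ρ x
  ... | yes k | _     = inj₁ k
  ... | no _  | yes r = inj₂ r
  ... | no nk | no nr = ⊥-elim (disjoint (x , (g , nk) , nr))

bwd-square : ∀ {κ ρ γ a' b'} → IsPartition κ → IsPartition ρ → IsPartition γ →
  Step ρ γ a' → Step κ γ b' → BwdSquare κ ρ γ a' b'
bwd-square {κ} {ρ} hκ hρ hγ s (stay refl) = bwd hρ s (stay refl) zero
  (rule3a (inj₂ (≐-refl {I ρ})) (inj₂ (inj₁ (≐-refl {I κ}))) (step-⊆ s) (λ _ k → k) (step-⊆ s))
bwd-square {κ} {ρ} hκ hρ hγ (stay refl) t@(grow _) = bwd hκ (stay refl) t zero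
  (rule3a (inj₁ (≐-refl {I κ})) (inj₂ (inj₂ (≐-refl {I ρ}))) (step-⊆ t) (step-⊆ t) (λ _ r → r))
bwd-square {κ} {ρ} {γ} hκ hρ hγ (grow d') (grow d) with List-≡-dec _≟ℕ_ κ ρ
... | yes refl = bwd-diagonal κ γ hκ hγ (<d⇒dom κ γ d)
... | no κ≢ρ with new-dom? (<d⇒dom κ γ d) (λ x → ¬? (I? ρ x))
...   | no disjoint = bwd-disjoint κ ρ γ hκ hρ d d' (λ e → κ≢ρ (≋⇒≡ hκ hρ e)) disjoint
...   | yes (_ , (g , nk) , nr) =
        let (_ , _ , c) = comeet (partition-down hκ) (partition-down hρ) (<d⇒dom κ γ d) (<d⇒dom ρ γ d') ne g nk nr
        in bwd-corner κ ρ γ hκ hρ ne c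
  where ne = λ e → κ≢ρ (≋⇒≡ hκ hρ e)

-- Squares of partitions: uniqueness and propagation of steps

fwd-square-unique : ∀ {ν κ ρ γ γ' e a b} → IsPartition κ → IsPartition ρ → IsPartition γ → IsPartition γ' →
  Step ν κ a → Step ν ρ b → Local ν κ ρ e γ → Local ν κ ρ e γ' → γ ≡ γ'
fwd-square-unique hκ hρ hγ hγ' s t l l' = ≋⇒≡ hγ hγ'
  (fwd-unique (partition-down hκ) (partition-down hρ) (partition-down hγ) (partition-down hγ')
     (local⇒view hκ hρ s t l) (local⇒view hκ hρ s t l'))

bwd-square-unique : ∀ {ν ν' κ ρ γ e e' a b a₁ b₁} →
  IsPartition ν → IsPartition ν' → IsPartition κ → IsPartition ρ →
  Step ν κ a → Step ν ρ b → Step ν' κ a₁ → Step ν' ρ b₁ →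
  Local ν κ ρ e γ → Local ν' κ ρ e' γ → ν ≡ ν' × e ≡ e'
bwd-square-unique hν hν' hκ hρ s t s' t' l l' =
  let (n , e) = bwd-unique (partition-down hν) (partition-down hν') (partition-down hκ) (partition-down hρ)
                  (local⇒view hκ hρ s t l) (local⇒view hκ hρ s' t' l')
  in ≋⇒≡ hν hν' n , e

-- `Local` by itself does not yield steps into γ. The square built by `fwd-square` has them, and
-- uniqueness identifies its last partition with the given γ.
square-steps : ∀ {ν κ ρ γ e a b a' b'} → IsPartition ν → IsPartition κ → IsPartition ρ → IsPartition γ →
  Step ν κ a → Step ν ρ b → Transfer e a b a' b' → Local ν κ ρ e γ → Step ρ γ a' × Step κ γ b'
square-steps hν hκ hρ hγ s t tr l with fwd-square hν hκ hρ s t tr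
... | γ' , hγ' , s' , t' , l' with fwd-square-unique hκ hρ hγ hγ' s t l l'
...   | refl = s' , t'

-- Growth arrays

record Line (m : ℕ) (t : ℕ → List ℕ) (a : ℕ → Bool) : Set where
  field
    partition : ∀ {k} → k ≤ m → IsPartition (t k)
    step      : ∀ {k} → k < m → Step (t k) (t (suc k)) (a k)

open Line

record Band (m : ℕ) (t t' : ℕ → List ℕ) (e : ℕ → ℤ) (a b a' : ℕ → Bool) : Set where
  field
    rung     : ∀ {k} → k ≤ m → Step (t k) (t' k) (b k)
    transfer : ∀ {k} → k < m → Transfer (e k) (a k) (b k) (a' k) (b (suc k))
    local    : ∀ {k} → k < m → Local (t k) (t (suc k)) (t' k) (e k) (t' (suc k))

open Band

-- `A i k` and `B i k` tell whether the steps from position (i, k) to the right and downwards are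
-- proper.
record GrowthArray (n m : ℕ) (Γ : ℕ → ℕ → List ℕ) (E : ℕ → ℕ → ℤ) (A B : ℕ → ℕ → Bool) : Set where
  field
    line : ∀ {i} → i ≤ n → Line m (Γ i) (A i)
    band : ∀ {i} → i < n → Band m (Γ i) (Γ (suc i)) (E i) (A i) (B i) (A (suc i))

open GrowthArray

line-tail : ∀ {m t a} → Line (suc m) t a → Line m (t ∘ suc) (a ∘ suc)
line-tail l = record { partition = λ le → partition l (s≤s le) ; step = λ lt → step l (s≤s lt) }

band-tail : ∀ {m t t' e a b a'} → Band (suc m) t t' e a b a' →
  Band m (t ∘ suc) (t' ∘ suc) (e ∘ suc) (a ∘ suc) (b ∘ suc) (a' ∘ suc)
band-tail bd = record { rung = λ le → rung bd (s≤s le) ; transfer = λ lt → transfer bd (s≤s lt)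
                      ; local = λ lt → local bd (s≤s lt) }

array-tail : ∀ {n m Γ E A B} → GrowthArray (suc n) m Γ E A B →
  GrowthArray n m (Γ ∘ suc) (E ∘ suc) (A ∘ suc) (B ∘ suc)
array-tail g = record { line = λ le → line g (s≤s le) ; band = λ lt → band g (s≤s lt) }

_◂_ : ∀ {X : Set} → X → (ℕ → X) → ℕ → X
(x ◂ f) zero    = x
(x ◂ f) (suc k) = f k

line-cons : ∀ {m x t s a} → IsPartition x → Step x (t 0) s → Line m t a → Line (suc m) (x ◂ t) (s ◂ a)
line-cons hx st l = record
  { partition = λ { {zero} _ → hx ; {suc k} (s≤s le) → partition l le }
  ; step      = λ { {zero} _ → st ; {suc k} (s≤s lt) → step l lt } }

array-cons : ∀ {n m t Γ e E a A b B} → Line m t a → Band m t (Γ 0) e a b (A 0) →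
  GrowthArray n m Γ E A B → GrowthArray (suc n) m (t ◂ Γ) (e ◂ E) (a ◂ A) (b ◂ B)
array-cons l bd g = record
  { line = λ { {zero} _ → l ; {suc i} (s≤s le) → line g le }
  ; band = λ { {zero} _ → bd ; {suc i} (s≤s lt) → band g lt } }

-- Building arrays from two adjacent sides

fwd-line : ∀ m {t e a b a' x} → Line m t a → IsPartition x → Step (t 0) x (b 0) →
  (∀ {k} → k < m → Transfer (e k) (a k) (b k) (a' k) (b (suc k))) →
  Σ (ℕ → List ℕ) λ t' → t' 0 ≡ x × Line m t' a' × Band m t t' e a b a'
fwd-line zero {x = x} l hx st tr = (λ _ → x) , refl ,
  record { partition = λ _ → hx ; step = λ () } ,
  record { rung = λ { {zero} z≤n → st } ; transfer = λ () ; local = λ () }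
fwd-line (suc m) {x = x} l hx st tr
  with fwd-square (partition l z≤n) (partition l (s≤s z≤n)) hx (step l (s≤s z≤n)) st (tr (s≤s z≤n))
... | y , hy , s' , st' , lo with fwd-line m (line-tail l) hy st' (λ lt → tr (s≤s lt))
...   | t' , refl , l' , bd = (x ◂ t') , refl ,
  record { partition = λ { {zero} _ → hx ; {suc k} (s≤s le) → partition l' le }
         ; step      = λ { {zero} _ → s' ; {suc k} (s≤s lt) → step l' lt } } ,
  record { rung     = λ { {zero} _ → st ; {suc k} (s≤s le) → rung bd le }
         ; transfer = tr
         ; local    = λ { {zero} _ → lo ; {suc k} (s≤s lt) → local bd lt } }

-- The indicators are given before the partitions, since in the application they are read off the
-- matrix; the transfer conditions say that they fit the squares still to be built. Backwards,
-- entries and indicators are results instead.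
fwd-array : ∀ n m {t l E A B} → Line m t (A 0) → Line n l (λ i → B i 0) → l 0 ≡ t 0 →
  (∀ {i k} → i < n → k < m → Transfer (E i k) (A i k) (B i k) (A (suc i) k) (B i (suc k))) →
  Σ (ℕ → ℕ → List ℕ) λ Γ → Γ 0 ≡ t × (∀ {i} → i ≤ n → Γ i 0 ≡ l i) × GrowthArray n m Γ E A B
fwd-array zero m {t} lt ll eq tr = (λ _ → t) , refl , (λ { {zero} z≤n → sym eq }) ,
  record { line = λ { {zero} z≤n → lt } ; band = λ () }
fwd-array (suc n) m {t} {l} {B = B} lt ll eq tr
  with fwd-line m lt (partition ll (s≤s z≤n)) (subst (λ x → Step x (l 1) (B 0 0)) eq (step ll (s≤s z≤n)))
         (tr (s≤s z≤n))
... | t' , eq' , lt' , bd with fwd-array n m lt' (line-tail ll) (sym eq') (λ li → tr (s≤s li))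
...   | Γ , refl , left-eq , g = (t ◂ Γ) , refl ,
  (λ { {zero} _ → sym eq ; {suc i} (s≤s le) → left-eq le }) ,
  record { line = λ { {zero} _ → lt ; {suc i} (s≤s le) → line g le }
         ; band = λ { {zero} _ → bd ; {suc i} (s≤s li) → band g li } }

-- A square is inverted from its lower and right sides, so the line is filled from right to left:
-- the tail comes first and supplies the rung that serves as right side of the leftmost square.
bwd-line : ∀ m {t' a' x s} → Line m t' a' → IsPartition x → Step x (t' m) s →
  Σ (ℕ → List ℕ) λ t → Σ (ℕ → ℤ) λ e → Σ (ℕ → Bool) λ a → Σ (ℕ → Bool) λ b →
    t m ≡ x × b m ≡ s × Line m t a × Band m t t' e a b a'
bwd-line zero {x = x} {s} l hx st =
  -- There is no square, so entries and horizontal indicators are arbitrary; only the rung at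
  -- position 0 matters.
  (λ _ → x) , (λ _ → + 0) , (λ _ → true) , (λ _ → s) , refl , refl ,
  record { partition = λ _ → hx ; step = λ () } ,
  record { rung = λ { {zero} z≤n → st } ; transfer = λ () ; local = λ () }
bwd-line (suc m) {t'} l hx st with bwd-line m (line-tail l) hx st
... | t , e , a , b , eq , eq' , lt , bd
  with bwd-square (partition lt z≤n) (partition l z≤n) (partition l (s≤s z≤n)) (step l (s≤s z≤n)) (rung bd z≤n)
...   | bwd {ν} {z} {s} {u} hν top side tr lo =
  (ν ◂ t) , (z ◂ e) , (s ◂ a) , (u ◂ b) , eq , eq' , line-cons hν top lt ,
  record { rung     = λ { {zero} _ → side ; {suc k} (s≤s le) → rung bd le }
         ; transfer = λ { {zero} _ → tr ; {suc k} (s≤s lt) → transfer bd lt }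
         ; local    = λ { {zero} _ → lo ; {suc k} (s≤s lt) → local bd lt } }

bwd-array : ∀ n m {t r a b} → Line m t a → Line n r b → r n ≡ t m →
  Σ (ℕ → ℕ → List ℕ) λ Γ → Σ (ℕ → ℕ → ℤ) λ E → Σ (ℕ → ℕ → Bool) λ A → Σ (ℕ → ℕ → Bool) λ B →
    Γ n ≡ t × A n ≡ a × (∀ {i} → i ≤ n → Γ i m ≡ r i) × (∀ {i} → i < n → B i m ≡ b i) ×
    GrowthArray n m Γ E A B
bwd-array zero m {t} {a = a} lt lr eq =
  -- With no band, entries and vertical indicators are arbitrary defaults.
  (λ _ → t) , (λ _ _ → + 0) , (λ _ → a) , (λ _ _ → true) , refl , refl ,
  (λ { {zero} z≤n → sym eq }) , (λ ()) , record { line = λ _ → lt ; band = λ () }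
bwd-array (suc n) m {r = r} {b = b} lt lr eq with bwd-array n m lt (line-tail lr) eq
... | Γ , E , A , B , eqΓ , eqA , right-eq , eqB , g
  with bwd-line m (line g z≤n) (partition lr z≤n)
         (subst (λ x → Step (r 0) x (b 0)) (sym (right-eq z≤n)) (step lr (s≤s z≤n)))
...   | t' , e , a' , b' , eqt , eqb , lt' , bd =
  (t' ◂ Γ) , (e ◂ E) , (a' ◂ A) , (b' ◂ B) , eqΓ , eqA ,
  (λ { {zero} _ → eqt ; {suc i} (s≤s le) → right-eq le }) ,
  (λ { {zero} _ → eqb ; {suc i} (s≤s li) → eqB li }) ,
  array-cons lt' bd g

line-steps : ∀ {m t t' e a b a'} → Line m t a → (∀ {k} → k ≤ m → IsPartition (t' k)) →
  Step (t 0) (t' 0) (b 0) →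
  (∀ {k} → k < m → Transfer (e k) (a k) (b k) (a' k) (b (suc k))) →
  (∀ {k} → k < m → Local (t k) (t (suc k)) (t' k) (e k) (t' (suc k))) →
  Line m t' a' × Band m t t' e a b a'
line-steps {m} {t} {t'} {a = a} {b} {a'} l hp st tr lo =
  record { partition = hp ; step = λ lt → proj₁ (square lt (rungs _ (<⇒≤ lt))) } ,
  record { rung = λ {k} → rungs k ; transfer = tr ; local = lo }
  where
  square : ∀ {k} → k < m → Step (t k) (t' k) (b k) →
    Step (t' k) (t' (suc k)) (a' k) × Step (t (suc k)) (t' (suc k)) (b (suc k))
  square lt s = square-steps (partition l (<⇒≤ lt)) (partition l lt) (hp (<⇒≤ lt)) (hp lt) (step l lt) s (tr lt) (lo lt)
  rungs : ∀ k → k ≤ m → Step (t k) (t' k) (b k)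
  rungs zero    _  = st
  rungs (suc k) le = proj₂ (square le (rungs k (<⇒≤ le)))

-- Turns an array known only to satisfy the local rules into a `GrowthArray`: steps on the top row
-- and left column spread through all squares by `square-steps`.
array-steps : ∀ n {m Γ E A B} → (∀ {i k} → i ≤ n → k ≤ m → IsPartition (Γ i k)) →
  Line m (Γ 0) (A 0) → (∀ {i} → i < n → Step (Γ i 0) (Γ (suc i) 0) (B i 0)) →
  (∀ {i k} → i < n → k < m → Transfer (E i k) (A i k) (B i k) (A (suc i) k) (B i (suc k))) →
  (∀ {i k} → i < n → k < m → Local (Γ i k) (Γ i (suc k)) (Γ (suc i) k) (E i k) (Γ (suc i) (suc k))) →
  GrowthArray n m Γ E A B
array-steps zero hp l st tr lo = record { line = λ { {zero} z≤n → l } ; band = λ () }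
array-steps (suc n) {B = B} hp l st tr lo =
  let (l' , bd) = line-steps {b = B 0} l (hp (s≤s z≤n)) (st (s≤s z≤n)) (tr (s≤s z≤n)) (lo (s≤s z≤n))
      g = array-steps n (λ le → hp (s≤s le)) l' (λ lt → st (s≤s lt)) (λ lt → tr (s≤s lt)) (λ lt → lo (s≤s lt))
  in record { line = λ { {zero} _ → l ; {suc i} (s≤s le) → line g le }
            ; band = λ { {zero} _ → bd ; {suc i} (s≤s lt) → band g lt } }

-- Arrays are determined by two adjacent sides

fwd-line-unique : ∀ {m t u t' u' e a b a' a₁ b₁ a₁'} → Line m t a → Line m t' a' → Line m u' a₁' →
  Band m t t' e a b a' → Band m u u' e a₁ b₁ a₁' →
  (∀ {k} → k ≤ m → t k ≡ u k) → t' 0 ≡ u' 0 → ∀ k → k ≤ m → t' k ≡ u' k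
fwd-line-unique l l' r' p q eq eq₀ zero    _  = eq₀
fwd-line-unique {t = t} {u} {t'} {u'} {e} l l' r' p q eq eq₀ (suc k) le =
  fwd-square-unique (partition l le) (partition l' (<⇒≤ le)) (partition l' le) (partition r' le)
    (step l le) (rung p (<⇒≤ le)) (local p le)
    (transport (sym (eq (<⇒≤ le))) (sym (eq le)) (sym (fwd-line-unique l l' r' p q eq eq₀ k (<⇒≤ le))) (local q le))
  where
  transport : ∀ {ν κ ρ ν' κ' ρ' z γ} → ν ≡ ν' → κ ≡ κ' → ρ ≡ ρ' → Local ν κ ρ z γ → Local ν' κ' ρ' z γ
  transport refl refl refl lo = lo

fwd-array-unique : ∀ {n m Γ Δ E A B A₁ B₁} → GrowthArray n m Γ E A B → GrowthArray n m Δ E A₁ B₁ →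
  (∀ {k} → k ≤ m → Γ 0 k ≡ Δ 0 k) → (∀ {i} → i ≤ n → Γ i 0 ≡ Δ i 0) →
  ∀ i {k} → i ≤ n → k ≤ m → Γ i k ≡ Δ i k
fwd-array-unique g h top side zero    _  lk = top lk
fwd-array-unique g h top side (suc i) li lk =
  fwd-line-unique (line g (<⇒≤ li)) (line g li) (line h li) (band g li) (band h li)
    (fwd-array-unique g h top side i (<⇒≤ li)) (side li) _ lk

-- The matrix entries are not assumed to agree; each is recovered together with the partition at the
-- upper left of its square, starting from the right end.
bwd-line-unique : ∀ m {t u t' u' e f a b a' a₁ b₁ a₁'} → Line m t a → Line m u a₁ → Line m t' a' →
  Band m t t' e a b a' → Band m u u' f a₁ b₁ a₁' →
  (∀ {k} → k ≤ m → t' k ≡ u' k) → t m ≡ u m →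
  (∀ {k} → k ≤ m → t k ≡ u k) × (∀ {k} → k < m → e k ≡ f k)
bwd-line-unique zero l r l' p q eq eq₀ = (λ { {zero} z≤n → eq₀ }) , λ ()
bwd-line-unique (suc m) l r l' p q eq eq₀
  with bwd-line-unique m (line-tail l) (line-tail r) (line-tail l') (band-tail p) (band-tail q) (λ le → eq (s≤s le)) eq₀
... | eqs , es = (λ { {zero} _ → proj₁ head ; {suc k} (s≤s le) → eqs le }) ,
                 (λ { {zero} _ → proj₂ head ; {suc k} (s≤s lt) → es lt })
  where
  1≤ = s≤s z≤n
  transport : ∀ {ν κ ρ κ' ρ' γ γ' z s u} → κ ≡ κ' → ρ ≡ ρ' → γ ≡ γ' →
    Local ν κ ρ z γ → Step ν κ s → Step ν ρ u → Local ν κ' ρ' z γ' × Step ν κ' s × Step ν ρ' u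
  transport refl refl refl lo s t = lo , s , t
  head = let (lo , s , t) = transport (sym (eqs z≤n)) (sym (eq z≤n)) (sym (eq 1≤))
                              (local q 1≤) (step r 1≤) (rung q z≤n)
         in bwd-square-unique (partition l z≤n) (partition r z≤n) (partition l 1≤) (partition l' z≤n)
              (step l 1≤) (rung p z≤n) s t (local p 1≤) lo

bwd-array-unique : ∀ n {m Γ Δ E F A B A₁ B₁} → GrowthArray n m Γ E A B → GrowthArray n m Δ F A₁ B₁ →
  (∀ {k} → k ≤ m → Γ n k ≡ Δ n k) → (∀ {i} → i ≤ n → Γ i m ≡ Δ i m) →
  (∀ {i k} → i ≤ n → k ≤ m → Γ i k ≡ Δ i k) × (∀ {i k} → i < n → k < m → E i k ≡ F i k)
bwd-array-unique zero g h bottom side = (λ { {zero} z≤n → bottom }) , λ ()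
bwd-array-unique (suc n) g h bottom side
  with bwd-array-unique n (array-tail g) (array-tail h) bottom (λ le → side (s≤s le))
... | eqs , es
  with bwd-line-unique _ (line g z≤n) (line h z≤n) (line g (s≤s z≤n)) (band g (s≤s z≤n)) (band h (s≤s z≤n))
         (eqs z≤n) (side z≤n)
...   | eqs₀ , es₀ = (λ { {zero} _ → eqs₀ ; {suc i} (s≤s le) → eqs le }) ,
                     (λ { {zero} _ → es₀ ; {suc i} (s≤s lt) → es lt })

-- Sizes

interchange : ∀ a b c d → (a + b) + (c + d) ≡ (a + c) + (b + d)
interchange = solve-∀

domino-≢ : ∀ {c c'} → Domino c c' → c ≢ c'
domino-≢ (hor i j) ()
domino-≢ (ver i j) ()

sum-unfold : ∀ p → sum p ≡ row p 0 + sum (drop 1 p)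
sum-unfold []      = refl
sum-unfold (x ∷ p) = refl

row-drop : ∀ p i → row (drop 1 p) i ≡ row p (suc i)
row-drop []      i = refl
row-drop (x ∷ p) i = refl

sum-rows : ∀ p q → (∀ i → row p i ≡ row q i) → sum p ≡ sum q
sum-rows []      []      e = refl
sum-rows []      (y ∷ q) e = cong₂ _+_ (e 0) (sum-rows [] q (λ i → e (suc i)))
sum-rows (x ∷ p) q       e = trans
  (cong₂ _+_ (e 0) (sum-rows p (drop 1 q) (λ i → trans (e (suc i)) (sym (row-drop q i)))))
  (sym (sum-unfold q))

sum-bump : ∀ p q r → (∀ i → i ≢ r → row p i ≡ row q i) → row q r ≡ suc (row p r) → sum q ≡ suc (sum p)
sum-bump p q zero e b = trans (sum-unfold q) (trans
  (cong₂ _+_ b (sym (sum-rows (drop 1 p) (drop 1 q)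
    (λ i → trans (row-drop p i) (trans (e (suc i) (λ ())) (sym (row-drop q i)))))))
  (cong suc (sym (sum-unfold p))))
sum-bump p q (suc r) e b = trans (sum-unfold q) (trans
  (cong₂ _+_ (sym (e 0 (λ ()))) (sum-bump (drop 1 p) (drop 1 q) r
    (λ i ne → trans (row-drop p i) (trans (e (suc i) (ne ∘ suc-injective)) (sym (row-drop q i))))
    (trans (row-drop q r) (trans b (cong suc (sym (row-drop p r)))))))
  (trans (+-suc (row p 0) _) (cong suc (sym (sum-unfold p)))))

-- The extra cell must sit at the end of its row: the position just past row r of `p` lies in `q` by
-- down-counting from (r, c), so it is the new cell itself. All other rows keep their length.
sum-cell : ∀ p q {r c} → (∀ x → I q x ⇔ (I p x ⊎ x ≡ (r , c))) → ¬ I p (r , c) → sum q ≡ suc (sum p)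
sum-cell p q {r} {c} e nc = sum-bump p q r other this
  where
  other : ∀ i → i ≢ r → row p i ≡ row q i
  other i ne with <-cmp (row p i) (row q i)
  ... | tri≈ _ eq _ = eq
  ... | tri> _ _ gt = ⊥-elim (<-irrefl refl (from (e (i , row q i)) (inj₁ gt)))
  ... | tri< lt _ _ with to (e (i , row p i)) lt
  ...   | inj₁ l    = ⊥-elim (<-irrefl refl l)
  ...   | inj₂ refl = ⊥-elim (ne refl)
  new-end : c ≡ row p r
  new-end with to (e (r , row p r)) (≤-<-trans (≮⇒≥ nc) (from (e (r , c)) (inj₂ refl)))
  ... | inj₁ l    = ⊥-elim (<-irrefl refl l)
  ... | inj₂ refl = refl
  this : row q r ≡ suc (row p r)
  this with row q r ≤? suc c
  ... | yes le = trans (≤-antisym le (from (e (r , c)) (inj₂ refl))) (cong suc new-end)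
  ... | no nle with to (e (r , suc c)) (≰⇒> nle)
  ...   | inj₁ l  = ⊥-elim (nc (<-trans (n<1+n c) l))
  ...   | inj₂ ()

-- The first cell of the domino is added on its own.
sum-add : ∀ {ν κ c c'} → IsPartition ν → IsPartition κ → Domino c c' →
  Add (I ν) (I κ) c c' → sum κ ≡ 2 + sum ν
sum-add {ν} {κ} {c} {c'} hν hκ D a =
  let (p , _ , e) = realise T
  in trans (sum-cell p κ (λ x → mk⇔ (into p e x) [ sub-p p e x , (λ { refl → new₂ a }) ]′)
              (λ s → [ old₂ a , (λ eq → domino-≢ D (sym eq)) ]′ (to (e c') s)))
           (cong suc (sum-cell ν p e (old₁ a)))
  where
  above : Domino c c' → ∀ {i j} → c ≡ (suc i , j) → I ν (i , j)
  above (hor _ _) refl with split a (up (partition-down hκ) (new₁ a))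
  ... | inj₁ n = n
  ... | inj₂ (inj₁ ())
  ... | inj₂ (inj₂ ())
  above (ver _ _) refl with split a (up (partition-down hκ) (new₁ a))
  ... | inj₁ n = n
  ... | inj₂ (inj₁ ())
  ... | inj₂ (inj₂ ())
  before : Domino c c' → ∀ {i j} → c ≡ (i , suc j) → I ν (i , j)
  before (hor _ _) refl with split a (left (partition-down hκ) (new₁ a))
  ... | inj₁ n = n
  ... | inj₂ (inj₁ ())
  ... | inj₂ (inj₂ ())
  before (ver _ _) refl with split a (left (partition-down hκ) (new₁ a))
  ... | inj₁ n = n
  ... | inj₂ (inj₁ ())
  ... | inj₂ (inj₂ ())
  T = insert (shape ν hν) c (above D) (before D)
  into : ∀ p → I p ≐ In T → ∀ x → I κ x → I p x ⊎ x ≡ c'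
  into p e x k with split a k
  ... | inj₁ n        = inj₁ (from (e x) (inj₁ n))
  ... | inj₂ (inj₁ q) = inj₁ (from (e x) (inj₂ q))
  ... | inj₂ (inj₂ q) = inj₂ q
  sub-p : ∀ p → I p ≐ In T → ∀ x → I p x → I κ x
  sub-p p e x s = [ sub a , (λ { refl → new₁ a }) ]′ (to (e x) s)

sum-<d : ∀ {ν κ} → IsPartition ν → IsPartition κ → ν <d κ → sum κ ≡ 2 + sum ν
sum-<d {ν} {κ} hν hκ (s , _ , _ , D , e) = sum-add hν hκ D (skew⇒add ν κ s e)

applyUpTo-cong : ∀ {X : Set} {f g : ℕ → X} → (∀ i → f i ≡ g i) → ∀ n → applyUpTo f n ≡ applyUpTo g n
applyUpTo-cong e zero    = refl
applyUpTo-cong e (suc n) = cong₂ _∷_ (e 0) (applyUpTo-cong (λ i → e (suc i)) n)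

-- Links `size`, a difference of sums, with the row widths of the skew shape; needed to count the
-- entries of a tableau stored row by row.
sum-difference : ∀ l μ → (∀ i → row μ i ≤ row l i) →
  sum l ≡ sum μ + sum (applyUpTo (λ i → row l i ∸ row μ i) (length l))
sum-difference []      μ le = sym (trans (+-identityʳ (sum μ)) (sum-rows μ [] (λ i → n≤0⇒n≡0 (le i))))
sum-difference (y ∷ l) μ le = begin
  y + sum l                                        ≡⟨ cong₂ _+_ (sym (m+[n∸m]≡n (le 0))) (trans (sum-difference l (drop 1 μ) le') (cong (λ w → sum (drop 1 μ) + sum w) (widths (length l)))) ⟩
  (row μ 0 + (y ∸ row μ 0)) + (sum (drop 1 μ) + W) ≡⟨ interchange (row μ 0) _ _ W ⟩
  (row μ 0 + sum (drop 1 μ)) + (y ∸ row μ 0 + W)   ≡⟨ cong (_+ (y ∸ row μ 0 + W)) (sym (sum-unfold μ)) ⟩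
  sum μ + (y ∸ row μ 0 + W)                        ∎
  where
  open ≡-Reasoning
  W = sum (applyUpTo (λ i → row l i ∸ row μ (suc i)) (length l))
  le' : ∀ i → row (drop 1 μ) i ≤ row l i
  le' i = subst (_≤ row l i) (sym (row-drop μ i)) (le (suc i))
  widths : ∀ n → applyUpTo (λ i → row l i ∸ row (drop 1 μ) i) n ≡ applyUpTo (λ i → row l i ∸ row μ (suc i)) n
  widths = applyUpTo-cong (λ i → cong (row l i ∸_) (row-drop μ i))

⊆-rows : ∀ {p q} → p ⊆ₚ q → ∀ i → row p i ≤ row q i
⊆-rows s i = ≮⇒≥ λ lt → <-irrefl refl (s (i , _) lt)

-- Tableaux and their entry functions

-- Standard domino tableaux seen as functions on cells. The permutation condition becomes a
-- bijection from the skew shape onto the values 1 to 2z, which is why `surj` hits `suc v` for v <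
-- 2z.
record Filling (l μ : List ℕ) (z : ℕ) (e : Cell → ℕ) : Set where
  field
    positive : ∀ {x} → InSkew l μ x → 1 ≤ e x
    at-most  : ∀ {x} → InSkew l μ x → e x ≤ 2 * z
    inj      : ∀ {x y} → InSkew l μ x → InSkew l μ y → e x ≡ e y → x ≡ y
    surj     : ∀ {v} → v < 2 * z → Σ Cell λ x → InSkew l μ x × e x ≡ suc v
    mono     : ∀ {x y} → InSkew l μ x → InSkew l μ y → proj₁ x ≤ proj₁ y → proj₂ x ≤ proj₂ y → e x ≤ e y
    pairs    : ∀ k {x y} → InSkew l μ x → InSkew l μ y → e x ≡ suc (2 * k) → e y ≡ 2 + 2 * k →
               Domino x y ⊎ Domino y x

open Filling

lookupD-∈ : ∀ xs {d} → d < length xs → lookupD xs d ∈ xs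
lookupD-∈ (x ∷ xs) {zero}  _        = here refl
lookupD-∈ (x ∷ xs) {suc d} (s≤s lt) = there (lookupD-∈ xs lt)

∈-lookupD : ∀ {xs v} → v ∈ xs → Σ ℕ λ d → d < length xs × lookupD xs d ≡ v
∈-lookupD (here refl) = 0 , s≤s z≤n , refl
∈-lookupD (there v∈) = let (d , lt , eq) = ∈-lookupD v∈ in suc d , s≤s lt , eq

entry-∈ : ∀ T i {d} → d < length (rowT T i) → lookupD (rowT T i) d ∈ concat T
entry-∈ (r ∷ T) zero    lt = ∈-++⁺ˡ (lookupD-∈ r lt)
entry-∈ (r ∷ T) (suc i) lt = ∈-++⁺ʳ r (entry-∈ T i lt)

∈-entry : ∀ T {v} → v ∈ concat T → Σ ℕ λ i → Σ ℕ λ d → d < length (rowT T i) × lookupD (rowT T i) d ≡ v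
∈-entry (r ∷ T) v∈ with ∈-++⁻ r v∈
... | inj₁ v∈r = 0 , ∈-lookupD v∈r
... | inj₂ v∈T = let (i , rest) = ∈-entry T v∈T in suc i , rest

lookupD-injective : ∀ {xs d d'} → Unique xs → d < length xs → d' < length xs →
  lookupD xs d ≡ lookupD xs d' → d ≡ d'
lookupD-injective {x ∷ xs} {zero}  {zero}   _       _        _         _  = refl
lookupD-injective {x ∷ xs} {zero}  {suc d'} (n ∷ _) _        (s≤s lt') eq = ⊥-elim (All.lookup n (lookupD-∈ xs lt') eq)
lookupD-injective {x ∷ xs} {suc d} {zero}   (n ∷ _) (s≤s lt) _         eq = ⊥-elim (All.lookup n (lookupD-∈ xs lt) (sym eq))
lookupD-injective {x ∷ xs} {suc d} {suc d'} (_ ∷ u) (s≤s lt) (s≤s lt') eq = cong suc (lookupD-injective u lt lt' eq)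

unique-++ : ∀ xs {ys : List ℕ} → Unique (xs ++ ys) → Unique xs × Unique ys × (∀ {v} → v ∈ xs → ¬ v ∈ ys)
unique-++ []       u       = [] , u , λ ()
unique-++ (x ∷ xs) (n ∷ u) =
  let (ux , uy , dis) = unique-++ xs u
  in (++⁻ˡ xs n ∷ ux) , uy , λ { (here refl) v∈ → All.lookup (++⁻ʳ xs n) v∈ refl ; (there w) → dis w }

entry-injective : ∀ T {i i' d d'} → Unique (concat T) → d < length (rowT T i) → d' < length (rowT T i') →
  lookupD (rowT T i) d ≡ lookupD (rowT T i') d' → i ≡ i' × d ≡ d'
entry-injective (r ∷ T) {zero}  {zero}   u lt lt' eq = refl , lookupD-injective (proj₁ (unique-++ r u)) lt lt' eq
entry-injective (r ∷ T) {zero}  {suc i'} u lt lt' eq =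
  ⊥-elim (proj₂ (proj₂ (unique-++ r u)) (lookupD-∈ r lt) (subst (_∈ concat T) (sym eq) (entry-∈ T i' lt')))
entry-injective (r ∷ T) {suc i} {zero}   u lt lt' eq =
  ⊥-elim (proj₂ (proj₂ (unique-++ r u)) (lookupD-∈ r lt') (subst (_∈ concat T) eq (entry-∈ T i lt)))
entry-injective (r ∷ T) {suc i} {suc i'} u lt lt' eq =
  let (ei , ed) = entry-injective T (proj₁ (proj₂ (unique-++ r u))) lt lt' eq in cong suc ei , ed

-- Pigeonhole: every element of `ys` is struck out at one place of `xs`, and equal lengths leave
-- nothing over. Thus surjectivity of a filling and the number of cells give the permutation
-- condition.
covering⇒↭ : ∀ {xs ys : List ℕ} → Unique ys → (∀ {v} → v ∈ ys → v ∈ xs) → length xs ≡ length ys → xs ↭ ys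
covering⇒↭ {[]}     {[]}     _       _   _  = ↭-refl
covering⇒↭ {xs}     {y ∷ ys} (n ∷ u) sup le with ∈-∃++ (sup (here refl))
... | as , bs , refl = ↭-trans (shift y as bs) (prep y (covering⇒↭ u sup' (suc-injective (trans (sym (↭-length (shift y as bs))) le))))
  where
  sup' : ∀ {v} → v ∈ ys → v ∈ as ++ bs
  sup' v∈ with ∈-++⁻ as (sup (there v∈))
  ... | inj₁ w         = ∈-++⁺ˡ w
  ... | inj₂ (there w) = ∈-++⁺ʳ as w
  ... | inj₂ (here refl) = ⊥-elim (All.lookup n v∈ refl)

<-∸⇒+-< : ∀ n {o d} → d < o ∸ n → n + d < o
<-∸⇒+-< zero            lt = lt
<-∸⇒+-< (suc n) {suc o} lt = s≤s (<-∸⇒+-< n lt)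

skew-offset : ∀ {l μ i j} → InSkew l μ (i , j) → j ∸ row μ i < row l i ∸ row μ i
skew-offset (s , n) = ∸-monoˡ-< s (≮⇒≥ n)

offset-skew : ∀ {l μ i d} → d < row l i ∸ row μ i → InSkew l μ (i , row μ i + d)
offset-skew {l} {μ} {i} {d} lt = <-∸⇒+-< (row μ i) lt , m+n≮m (row μ i) d

skew-≥ : ∀ {l μ i j} → InSkew l μ (i , j) → row μ i + (j ∸ row μ i) ≡ j
skew-≥ (_ , n) = m+[n∸m]≡n (≮⇒≥ n)

SDT⇒filling : ∀ {l μ T z} → size l μ ≡ 2 * z → IsSDT l μ T → Filling l μ z (ent T μ)
SDT⇒filling {l} {μ} {T} {z} sz (_ , widths , perm , monotone , dominoes) = record
  { positive = λ s → let (v , _ , eq) = in-range s in subst (1 ≤_) (sym eq) (s≤s z≤n)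
  ; at-most  = λ s → let (v , lt , eq) = in-range s in subst (_≤ 2 * z) (sym eq) lt
  ; inj      = injective
  ; surj     = surjective
  ; mono     = λ {x} {y} → monotone x y
  ; pairs    = λ k {x} {y} → dominoes k x y }
  where
  offset : ∀ {i j} → InSkew l μ (i , j) → j ∸ row μ i < length (rowT T i)
  offset {i} s = subst (_ <_) (sym (widths i)) (skew-offset {l} {μ} s)
  in-range : ∀ {x} → InSkew l μ x → Σ ℕ λ v → v < 2 * z × ent T μ x ≡ suc v
  in-range {i , j} s with ∈-map⁻ suc (∈-resp-↭ perm (entry-∈ T i (offset s)))
  ... | v , v∈ , eq = v , subst (v <_) sz (∈-upTo⁻ v∈) , eq
  distinct : Unique (concat T)
  distinct = Unique-resp-↭ (↭⇒↭ₛ (↭-sym perm)) (Unique-map⁺ suc-injective (upTo⁺ (size l μ)))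
  injective : ∀ {x y} → InSkew l μ x → InSkew l μ y → ent T μ x ≡ ent T μ y → x ≡ y
  injective {i , j} {i' , j'} s s' eq with entry-injective T distinct (offset s) (offset s') eq
  ... | refl , ed = cong (i ,_) (trans (sym (skew-≥ {l} {μ} s)) (trans (cong (λ d → row μ i + d) ed) (skew-≥ {l} {μ} s')))
  surjective : ∀ {v} → v < 2 * z → Σ Cell λ x → InSkew l μ x × ent T μ x ≡ suc v
  surjective {v} lt with ∈-entry T (∈-resp-↭ (↭-sym perm) (∈-map⁺ suc (∈-upTo⁺ (subst (v <_) (sym sz) lt))))
  ... | i , d , lt' , eq = (i , row μ i + d) , offset-skew {l} {μ} (subst (d <_) (widths i) lt') ,
                           trans (cong (lookupD (rowT T i)) (m+n∸m≡n (row μ i) d)) eq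

lookupD-applyUpTo : ∀ (f : ℕ → ℕ) {n d} → d < n → lookupD (applyUpTo f n) d ≡ f d
lookupD-applyUpTo f {suc n} {zero}  _        = refl
lookupD-applyUpTo f {suc n} {suc d} (s≤s lt) = lookupD-applyUpTo (f ∘ suc) lt

rowT-applyUpTo : ∀ (f : ℕ → List ℕ) {n i} → i < n → rowT (applyUpTo f n) i ≡ f i
rowT-applyUpTo f {suc n} {zero}  _        = refl
rowT-applyUpTo f {suc n} {suc i} (s≤s lt) = rowT-applyUpTo (f ∘ suc) lt

rowT-beyond : ∀ T {i} → length T ≤ i → rowT T i ≡ []
rowT-beyond []      _          = refl
rowT-beyond (r ∷ T) (s≤s le) = rowT-beyond T le

length-concat-applyUpTo : ∀ (f : ℕ → List ℕ) (w : ℕ → ℕ) n → (∀ i → length (f i) ≡ w i) →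
  length (concat (applyUpTo f n)) ≡ sum (applyUpTo w n)
length-concat-applyUpTo f w zero    e = refl
length-concat-applyUpTo f w (suc n) e =
  trans (length-++ (f 0)) (cong₂ _+_ (e 0) (length-concat-applyUpTo (f ∘ suc) (w ∘ suc) n (λ i → e (suc i))))

module _ (l μ : List ℕ) (e : Cell → ℕ) where

  fill-row : ℕ → List ℕ
  fill-row i = applyUpTo (λ d → e (i , row μ i + d)) (row l i ∸ row μ i)

  tableau : Tableau
  tableau = applyUpTo fill-row (length l)

  rowT-tableau : ∀ i → rowT tableau i ≡ fill-row i
  rowT-tableau i with i <? length l
  ... | yes lt = rowT-applyUpTo fill-row lt
  -- Below the last row of `l` the width `0 ∸ row μ i` vanishes, so the absent row of the tableau
  -- agrees with the empty `fill-row`.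
  ... | no nlt rewrite row-beyond l i (≮⇒≥ nlt) | 0∸n≡0 (row μ i) =
    rowT-beyond tableau (subst (_≤ i) (sym (length-applyUpTo fill-row (length l))) (≮⇒≥ nlt))

  ent-tableau : ∀ {x} → InSkew l μ x → ent tableau μ x ≡ e x
  ent-tableau {i , j} s = trans (cong (λ r → lookupD r (j ∸ row μ i)) (rowT-tableau i))
    (trans (lookupD-applyUpTo _ (skew-offset {l} {μ} s)) (cong (λ j → e (i , j)) (skew-≥ {l} {μ} s)))

  filling⇒SDT : ∀ {z} → μ ⊆ₚ l → size l μ ≡ 2 * z → Filling l μ z e → IsSDT l μ tableau
  filling⇒SDT {z} μ⊆l sz F =
    length-applyUpTo fill-row (length l) ,
    widths ,
    covering⇒↭ (Unique-map⁺ suc-injective (upTo⁺ (size l μ))) covers total ,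
    (λ x y s s' le le' → subst₂ _≤_ (sym (ent-tableau s)) (sym (ent-tableau s')) (mono F s s' le le')) ,
    (λ k x y s s' ex ey → pairs F k s s' (trans (sym (ent-tableau s)) ex) (trans (sym (ent-tableau s')) ey))
    where
    widths : ∀ i → length (rowT tableau i) ≡ row l i ∸ row μ i
    widths i = trans (cong length (rowT-tableau i)) (length-applyUpTo _ _)
    total : length (concat tableau) ≡ length (map suc (upTo (size l μ)))
    total = begin
      length (concat tableau)            ≡⟨ length-concat-applyUpTo fill-row w (length l) (λ i → length-applyUpTo _ _) ⟩
      sum (applyUpTo w (length l))       ≡⟨ sym (m+n∸m≡n (sum μ) _) ⟩
      sum μ + _ ∸ sum μ                  ≡⟨ cong (_∸ sum μ) (sym (sum-difference l μ (⊆-rows {μ} {l} μ⊆l))) ⟩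
      size l μ                           ≡⟨ sym (length-upTo (size l μ)) ⟩
      length (upTo (size l μ))           ≡⟨ sym (length-map suc (upTo (size l μ))) ⟩
      length (map suc (upTo (size l μ))) ∎
      where
      open ≡-Reasoning
      w = λ i → row l i ∸ row μ i
    covers : ∀ {v} → v ∈ map suc (upTo (size l μ)) → v ∈ concat tableau
    covers v∈ with ∈-map⁻ suc v∈
    ... | v , v∈' , refl with surj F (subst (v <_) sz (∈-upTo⁻ v∈'))
    ...   | (i , j) , s , eq = subst (_∈ concat tableau) (trans (ent-tableau s) eq)
      (entry-∈ tableau i (subst (_ <_) (sym (widths i)) (skew-offset {l} {μ} s)))

lookupD-ext : ∀ xs ys → length xs ≡ length ys → (∀ d → d < length xs → lookupD xs d ≡ lookupD ys d) → xs ≡ ys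
lookupD-ext []       []       _  _ = refl
lookupD-ext (x ∷ xs) (y ∷ ys) le e =
  cong₂ _∷_ (e 0 (s≤s z≤n)) (lookupD-ext xs ys (suc-injective le) (λ d lt → e (suc d) (s≤s lt)))

rowT-ext : ∀ T T' → length T ≡ length T' → (∀ i → rowT T i ≡ rowT T' i) → T ≡ T'
rowT-ext []      []        _  _ = refl
rowT-ext (r ∷ T) (r' ∷ T') le e = cong₂ _∷_ (e 0) (rowT-ext T T' (suc-injective le) (λ i → e (suc i)))

SDT-ext : ∀ {l μ T T'} → IsSDT l μ T → IsSDT l μ T' → (∀ x → InSkew l μ x → ent T μ x ≡ ent T' μ x) → T ≡ T'
SDT-ext {l} {μ} {T} {T'} (len , widths , _) (len' , widths' , _) e =
  rowT-ext T T' (trans len (sym len')) λ i →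
    lookupD-ext _ _ (trans (widths i) (sym (widths' i))) λ d lt →
      subst (λ d → lookupD (rowT T i) d ≡ lookupD (rowT T' i) d) (m+n∸m≡n (row μ i) d)
        (e (i , row μ i + d) (offset-skew {l} {μ} (subst (d <_) (widths i) lt)))

-- Multichains and fillings

count : (ℕ → Bool) → ℕ → ℕ
count a zero    = 0
count a (suc k) = count a k + (if a k then 1 else 0)

count-≤ : ∀ a {j k} → j ≤ k → count a j ≤ count a k
count-≤ a {j} {k} le with m≤n⇒m<n∨m≡n le
... | inj₂ refl = ≤-refl
count-≤ a {j} {suc k} le | inj₁ (s≤s lt) = ≤-trans (count-≤ a lt) (m≤m+n _ _)

count-true : ∀ k → count (λ _ → true) k ≡ k
count-true zero    = refl
count-true (suc k) = trans (cong (_+ 1) (count-true k)) (+-comm k 1)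

count-cong : ∀ {a b} k → (∀ {j} → j < k → a j ≡ b j) → count a k ≡ count b k
count-cong zero    e = refl
count-cong (suc k) e = cong₂ (λ x y → x + (if y then 1 else 0))
  (count-cong k (λ lt → e (≤-trans lt (n≤1+n k)))) (e ≤-refl)

-- Discrete intermediate values: `count` starts at 0 and rises by at most one at each step.
count-hits : ∀ a m {j} → j ≤ count a m → Σ ℕ λ k → k ≤ m × count a k ≡ j
count-hits a zero    z≤n = 0 , z≤n , refl
count-hits a (suc m) {j} le with j ≤? count a m
... | yes le' = let (k , k≤m , eq) = count-hits a m le' in k , ≤-trans k≤m (n≤1+n m) , eq
... | no nle  = suc m , ≤-refl , ≤-antisym (≤-trans (at-most-one (a m)) (≰⇒> nle)) le
  where
  at-most-one : ∀ b → count a m + (if b then 1 else 0) ≤ suc (count a m)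
  at-most-one true  = ≤-reflexive (+-comm _ 1)
  at-most-one false = ≤-trans (≤-reflexive (+-identityʳ _)) (n≤1+n _)

line-⊆ : ∀ {m t a} → Line m t a → ∀ {j k} → j ≤ k → k ≤ m → t j ⊆ₚ t k
line-⊆ l {j} {k} le km x s with m≤n⇒m<n∨m≡n le
... | inj₂ refl = s
line-⊆ l {j} {suc k} le km x s | inj₁ (s≤s lt) = step-⊆ (step l km) x (line-⊆ l lt (<⇒≤ km) x s)

line-sum : ∀ {m t a} → Line m t a → ∀ k → k ≤ m → sum (t k) ≡ sum (t 0) + 2 * count a k
line-sum l zero    _  = sym (+-identityʳ _)
line-sum {t = t} {a} l (suc k) le =
  trans (go (partition l (<⇒≤ le)) (partition l le) (step l le) (line-sum l k (<⇒≤ le)))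
        (arith (sum (t 0)) (count a k) (if a k then 1 else 0))
  where
  arith : ∀ s c d → 2 * d + (s + 2 * c) ≡ s + 2 * (c + d)
  arith = solve-∀
  go : ∀ {ν κ b s} → IsPartition ν → IsPartition κ → Step ν κ b → sum ν ≡ s → sum κ ≡ 2 * (if b then 1 else 0) + s
  go hν hκ (stay refl) eq = eq
  go hν hκ (grow d)    eq = trans (sum-<d hν hκ d) (cong (λ s → 2 + s) eq)

-- The common form of the boundary conditions on Γ: `z k` is the number of dominoes already placed
-- at position k.
Levels : (μ l : List ℕ) (e : Cell → ℕ) (t : ℕ → List ℕ) (z : ℕ → ℕ) (m : ℕ) → Set
Levels μ l e t z m = ∀ k → k ≤ m → ∀ x →
  I (t k) x ⇔ (I μ x ⊎ (InSkew l μ x × e x ≤ 2 * z k))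

levels-z : ∀ {μ l e t z z' m} → (∀ k → k ≤ m → z k ≡ z' k) → Levels μ l e t z m → Levels μ l e t z' m
levels-z {μ} {l} {e} {t} eq L k le x =
  subst (λ z → I (t k) x ⇔ (I μ x ⊎ (InSkew l μ x × e x ≤ 2 * z))) (eq k le) (L k le x)

module _ {μ l : List ℕ} (hμ : IsPartition μ) (hl : IsPartition l) {z : ℕ} {e : Cell → ℕ}
         (F : Filling l μ z e) where

  level : ℕ → Region
  level j x = I μ x ⊎ (InSkew l μ x × e x ≤ 2 * j)

  -- Down-closure is the monotonicity of the entries: a cell of the skew shape weakly north-west of
  -- another carries no larger entry.
  level-shape : ℕ → Shape
  level-shape j = record
    { In = level j
    ; dec = λ x → I? μ x ⊎-dec ((I? l x ×-dec ¬? (I? μ x)) ×-dec (e x ≤? 2 * j))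
    ; down = record
      { up   = λ {i} → lower (n≤1+n i) ≤-refl (up (partition-down hμ)) (up (partition-down hl))
      ; left = λ {i} {k} → lower ≤-refl (n≤1+n k) (left (partition-down hμ)) (left (partition-down hl)) }
    ; bound = bound M + bound L
    ; bounded = λ
      { (inj₁ s) → <-≤-trans (proj₁ (bounded M s)) (m≤m+n _ _) , <-≤-trans (proj₂ (bounded M s)) (m≤m+n _ _)
      ; (inj₂ ((s , _) , _)) → <-≤-trans (proj₁ (bounded L s)) (m≤n+m _ (bound M)) ,
                               <-≤-trans (proj₂ (bounded L s)) (m≤n+m _ (bound M)) } }
    where
    M = shape μ hμ
    L = shape l hl
    lower : ∀ {i i' j' k} → i' ≤ i → k ≤ j' → (I μ (i , j') → I μ (i' , k)) → (I l (i , j') → I l (i' , k)) →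
      level j (i , j') → level j (i' , k)
    lower le le' f g (inj₁ s) = inj₁ (f s)
    lower {i' = i'} {k = k} le le' f g (inj₂ ((s , n) , b)) with I? μ (i' , k)
    ... | yes m = inj₁ m
    ... | no nm = inj₂ ((g s , nm) , ≤-trans (mono F (g s , nm) (s , n) le le') b)

  level-0 : level 0 ≐ I μ
  level-0 x = mk⇔ (λ { (inj₁ s) → s ; (inj₂ (s , le)) → ⊥-elim (<-irrefl refl (≤-trans (positive F s) le)) }) inj₁

  level-z : μ ⊆ₚ l → level z ≐ I l
  level-z μ⊆l x = mk⇔ [ μ⊆l x , (λ (s , _) → proj₁ s) ]′ total
    where
    total : I l x → level z x
    total s with I? μ x
    ... | yes m = inj₁ m
    ... | no nm = inj₂ ((s , nm) , at-most F (s , nm))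

  -- By injectivity the only cells with entries above 2j and at most 2j + 2 are the two of the
  -- domino labelled j + 1.
  level-add : ∀ {j x y} → InSkew l μ x → InSkew l μ y → e x ≡ suc (2 * j) → e y ≡ 2 + 2 * j →
    Add (level j) (level (suc j)) x y
  level-add {j} {x} {y} s s' ex ey = record
    { sub  = [ inj₁ , (λ (t , le) → inj₂ (t , ≤-trans le (*-monoʳ-≤ 2 (n≤1+n j)))) ]′
    ; new₁ = inj₂ (s , subst₂ _≤_ (sym ex) (sym (*-suc 2 j)) (n≤1+n _))
    ; new₂ = inj₂ (s' , ≤-reflexive (trans ey (sym (*-suc 2 j))))
    ; old₁ = [ proj₂ s , (λ (_ , le) → <-irrefl refl (subst (_≤ 2 * j) ex le)) ]′
    ; old₂ = [ proj₂ s' , (λ (_ , le) → <-irrefl refl (<-trans (n<1+n _) (subst (_≤ 2 * j) ey le))) ]′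
    ; split = λ {w} → λ { (inj₁ m) → inj₁ (inj₁ m) ; (inj₂ (t , le)) → go t (subst (e w ≤_) (*-suc 2 j) le) } }
    where
    go : ∀ {w} → InSkew l μ w → e w ≤ 2 + 2 * j → level j w ⊎ w ≡ x ⊎ w ≡ y
    go t le with m≤n⇒m<n∨m≡n le
    ... | inj₂ eq = inj₂ (inj₂ (inj F t s' (trans eq (sym ey))))
    ... | inj₁ (s≤s lt) with m≤n⇒m<n∨m≡n lt
    ...   | inj₂ eq = inj₂ (inj₁ (inj F t s (trans eq (sym ex))))
    ...   | inj₁ (s≤s lt') = inj₁ (inj₂ (t , lt'))

  level-pair : ∀ {j} → j < z → Σ Cell λ x → Σ Cell λ y → InSkew l μ x × InSkew l μ y ×
    e x ≡ suc (2 * j) × e y ≡ 2 + 2 * j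
  level-pair {j} lt =
    let bnd = ≤-trans (≤-reflexive (sym (*-suc 2 j))) (*-monoʳ-≤ 2 lt)
        (x , s , ex) = surj F (<-trans (n<1+n _) bnd)
        (y , s' , ey) = surj F bnd
    in x , y , s , s' , ex , ey

  add-flip : ∀ {N K c c'} → Add N K c c' → Add N K c' c
  add-flip a = record { sub = sub a ; new₁ = new₂ a ; new₂ = new₁ a ; old₁ = old₂ a ; old₂ = old₁ a
                      ; split = λ k → [ inj₁ , inj₂ ∘ Sum.swap ]′ (split a k) }

  level-dom : ∀ {j} → j < z → Dom (level j) (level (suc j))
  level-dom {j} lt with level-pair lt
  ... | x , y , s , s' , ex , ey with pairs F j s s' ex ey
  ...   | inj₁ (hor i k) = hor i k (level-add s s' ex ey)
  ...   | inj₁ (ver i k) = ver i k (level-add s s' ex ey)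
  -- `pairs` also allows the larger entry to be in the first cell; the two new cells of an `Add` may
  -- be exchanged.
  ...   | inj₂ (hor i k) = hor i k (add-flip (level-add s s' ex ey))
  ...   | inj₂ (ver i k) = ver i k (add-flip (level-add s s' ex ey))

  level-step : ∀ {p q j} b → IsPartition p → IsPartition q → I p ≐ level j →
    I q ≐ level (j + (if b then 1 else 0)) → j + (if b then 1 else 0) ≤ z → Step p q b
  level-step {p} {q} {j} false hp hq ep eq le = stay (≋⇒≡ hp hq
    (≐-trans {I p} {level j} {I q} ep (≐-sym {I q} (subst (λ j → I q ≐ level j) (+-identityʳ j) eq))))
  level-step {p} {q} {j} true  hp hq ep eq le = grow (dom⇒<d p q (map-dom
    (add-≐ (≐-sym {I p} ep) (≐-sym {I q} (subst (λ j → I q ≐ level j) (+-comm j 1) eq)))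
    (level-dom (subst (_≤ z) (+-comm j 1) le))))

  levels⇒line : ∀ {m a t} → count a m ≡ z → (∀ k → k ≤ m → IsPartition (t k)) →
    Levels μ l e t (count a) m → Line m t a
  levels⇒line {m} {a} cz hp L = record
    { partition = λ {k} → hp k
    ; step = λ {k} lt → level-step (a k) (hp k (<⇒≤ lt)) (hp (suc k) lt) (L k (<⇒≤ lt)) (L (suc k) lt)
                          (subst (count a (suc k) ≤_) cz (count-≤ a lt)) }

  levels-start : ∀ {m z' t} → z' 0 ≡ 0 → IsPartition (t 0) → Levels μ l e t z' m → t 0 ≡ μ
  levels-start {t = t} z0 hp L = ≋⇒≡ hp hμ (≐-trans {I (t 0)} (subst (λ j → I (t 0) ≐ level j) z0 (L 0 z≤n)) level-0)

  levels-end : ∀ {m z' t} → μ ⊆ₚ l → z' m ≡ z → IsPartition (t m) → Levels μ l e t z' m → t m ≡ l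
  levels-end {m} {t = t} μ⊆l zm hp L =
    ≋⇒≡ hp hl (≐-trans {I (t m)} (subst (λ j → I (t m) ≐ level j) zm (L m ≤-refl)) (level-z μ⊆l))

  levels-exist : ∀ z' m → Σ (ℕ → List ℕ) λ t → (∀ k → IsPartition (t k)) × Levels μ l e t z' m
  levels-exist z' m = (λ k → proj₁ (realise (level-shape (z' k)))) ,
    (λ k → proj₁ (proj₂ (realise (level-shape (z' k))))) ,
    λ k _ → proj₂ (proj₂ (realise (level-shape (z' k))))

levels-unique : ∀ {μ l e t u z m} → (∀ k → k ≤ m → IsPartition (t k)) → (∀ k → k ≤ m → IsPartition (u k)) →
  Levels μ l e t z m → Levels μ l e u z m → ∀ {k} → k ≤ m → t k ≡ u k
levels-unique {t = t} {u} ht hu L L' {k} le =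
  ≋⇒≡ (ht k le) (hu k le) (≐-trans {I (t k)} (L k le) (≐-sym {I (u k)} (L' k le)))

-- The filling of a multichain

odd≢even : ∀ j k → suc (2 * j) ≢ 2 * k
odd≢even zero    (suc k) eq = 0≢1+n (suc-injective (trans eq (*-suc 2 k)))
odd≢even (suc j) (suc k) eq = odd≢even j k (suc-injective (suc-injective
  (trans (cong suc (sym (*-suc 2 j))) (trans eq (*-suc 2 k)))))

module _ {μ l l' : List ℕ} (hl : IsPartition l) {z : ℕ} {e : Cell → ℕ} (μ⊆l : μ ⊆ₚ l)
         (F : Filling l μ z e) {c c' : Cell} (D : Domino c c') (a : Add (I l) (I l') c c') where

  extend : Cell → ℕ
  extend x with x ≟ c | x ≟ c'
  ... | yes _ | _     = suc (2 * z)
  ... | no _  | yes _ = 2 + 2 * z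
  ... | no _  | no _  = e x

  data Extended (x : Cell) : Set where
    old    : InSkew l μ x → extend x ≡ e x → Extended x
    first  : x ≡ c → extend x ≡ suc (2 * z) → Extended x
    second : x ≡ c' → extend x ≡ 2 + 2 * z → Extended x

  extend-old : ∀ {x} → I l x → extend x ≡ e x
  extend-old {x} s with x ≟ c | x ≟ c'
  ... | yes refl | _        = ⊥-elim (old₁ a s)
  ... | no _     | yes refl = ⊥-elim (old₂ a s)
  ... | no _     | no _     = refl

  extend-first : extend c ≡ suc (2 * z)
  extend-first with c ≟ c | c ≟ c'
  ... | yes _ | _ = refl
  ... | no ne | _ = ⊥-elim (ne refl)

  extend-second : extend c' ≡ 2 + 2 * z
  extend-second with c' ≟ c | c' ≟ c'
  ... | yes eq | _     = ⊥-elim (domino-≢ D (sym eq))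
  ... | no _   | yes _ = refl
  ... | no _   | no ne = ⊥-elim (ne refl)

  extended : ∀ {x} → InSkew l' μ x → Extended x
  extended (s , n) with split a s
  ... | inj₁ o           = old (o , n) (extend-old o)
  ... | inj₂ (inj₁ refl) = first refl extend-first
  ... | inj₂ (inj₂ refl) = second refl extend-second

  old-< : ∀ {x} → InSkew l μ x → extend x ≡ e x → extend x < suc (2 * z)
  old-< s eq = s≤s (subst (_≤ 2 * z) (sym eq) (at-most F s))

  extend-new : ∀ {x} → InSkew l' μ x → ¬ I l x → 2 * z < extend x
  extend-new s n with extended s
  ... | old o _     = ⊥-elim (n (proj₁ o))
  ... | first _ eq  = subst (2 * z <_) (sym eq) ≤-refl
  ... | second _ eq = subst (2 * z <_) (sym eq) (n≤1+n _)

  skew-into : ∀ {x} → InSkew l μ x → InSkew l' μ x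
  skew-into (s , n) = sub a s , n

  c∈ : InSkew l' μ c
  c∈ = new₁ a , λ m → old₁ a (μ⊆l c m)

  c'∈ : InSkew l' μ c'
  c'∈ = new₂ a , λ m → old₂ a (μ⊆l c' m)

  filling-extend : Filling l' μ (suc z) extend
  filling-extend = record
    { positive = positive' ; at-most = λ {x} s → subst (extend x ≤_) (sym (*-suc 2 z)) (at-most' s)
    ; inj = inj' ; surj = λ {v} lt → surj' (subst (v <_) (*-suc 2 z) lt) ; mono = mono' ; pairs = pairs' }
    where
    positive' : ∀ {x} → InSkew l' μ x → 1 ≤ extend x
    positive' s with extended s
    ... | old o eq    = subst (1 ≤_) (sym eq) (positive F o)
    ... | first _ eq  = subst (1 ≤_) (sym eq) (s≤s z≤n)
    ... | second _ eq = subst (1 ≤_) (sym eq) (s≤s z≤n)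
    at-most' : ∀ {x} → InSkew l' μ x → extend x ≤ 2 + 2 * z
    at-most' s with extended s
    ... | old o eq    = ≤-trans (<⇒≤ (old-< o eq)) (n≤1+n _)
    ... | first _ eq  = subst (_≤ 2 + 2 * z) (sym eq) (n≤1+n _)
    ... | second _ eq = ≤-reflexive eq
    inj' : ∀ {x y} → InSkew l' μ x → InSkew l' μ y → extend x ≡ extend y → x ≡ y
    inj' s s' eq with extended s | extended s'
    ... | old o ex      | old o' ey     = inj F o o' (trans (sym ex) (trans eq ey))
    ... | first refl _  | first refl _  = refl
    ... | second refl _ | second refl _ = refl
    ... | old o ex      | first _ ey    = ⊥-elim (<-irrefl (trans eq ey) (old-< o ex))
    ... | old o ex      | second _ ey   = ⊥-elim (<-irrefl (trans eq ey) (<-trans (old-< o ex) (n<1+n _)))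
    ... | first _ ex    | old o ey      = ⊥-elim (<-irrefl (trans (sym eq) ex) (old-< o ey))
    ... | second _ ex   | old o ey      = ⊥-elim (<-irrefl (trans (sym eq) ex) (<-trans (old-< o ey) (n<1+n _)))
    ... | first _ ex    | second _ ey   = ⊥-elim (<-irrefl (trans (sym ex) (trans eq ey)) (n<1+n _))
    ... | second _ ex   | first _ ey    = ⊥-elim (<-irrefl (trans (sym ey) (trans (sym eq) ex)) (n<1+n _))
    surj' : ∀ {v} → v < 2 + 2 * z → Σ Cell λ x → InSkew l' μ x × extend x ≡ suc v
    surj' (s≤s lt) with m≤n⇒m<n∨m≡n lt
    ... | inj₂ refl = c' , c'∈ , extend-second
    ... | inj₁ (s≤s lt') with m≤n⇒m<n∨m≡n lt'
    ...   | inj₂ refl = c , c∈ , extend-first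
    ...   | inj₁ lt'' = let (x , s , eq) = surj F lt'' in x , skew-into s , trans (extend-old (proj₁ s)) eq
    mono' : ∀ {x y} → InSkew l' μ x → InSkew l' μ y → proj₁ x ≤ proj₁ y → proj₂ x ≤ proj₂ y → extend x ≤ extend y
    mono' {x} {y} s s' le le' with extended s | extended s'
    ... | old o ex      | old o' ey     = subst₂ _≤_ (sym ex) (sym ey) (mono F o o' le le')
    ... | old o ex      | first _ ey    = subst (extend x ≤_) (sym ey) (<⇒≤ (old-< o ex))
    ... | old o ex      | second _ ey   = subst (extend x ≤_) (sym ey) (<⇒≤ (<-trans (old-< o ex) (n<1+n _)))
    -- An old cell weakly south-east of a new one would force the new one into the down-closed `l`.
    ... | first refl _  | old o _       = ⊥-elim (old₁ a (down* (partition-down hl) le le' (proj₁ o)))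
    ... | second refl _ | old o _       = ⊥-elim (old₂ a (down* (partition-down hl) le le' (proj₁ o)))
    ... | first _ ex    | first _ ey    = ≤-reflexive (trans ex (sym ey))
    ... | first _ ex    | second _ ey   = subst₂ _≤_ (sym ex) (sym ey) (n≤1+n _)
    ... | second _ ex   | second _ ey   = ≤-reflexive (trans ex (sym ey))
    ... | second refl _ | first refl _  = ⊥-elim (backwards D le le')
      where
      backwards : ∀ {c c'} → Domino c c' → proj₁ c' ≤ proj₁ c → proj₂ c' ≤ proj₂ c → ⊥
      backwards (hor i j) _ le = <-irrefl refl le
      backwards (ver i j) le _ = <-irrefl refl le
    pairs' : ∀ k {x y} → InSkew l' μ x → InSkew l' μ y → extend x ≡ suc (2 * k) → extend y ≡ 2 + 2 * k →
             Domino x y ⊎ Domino y x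
    pairs' k s s' eq eq' with extended s | extended s'
    ... | old o ex      | old o' ey     = pairs F k o o' (trans (sym ex) eq) (trans (sym ey) eq')
    ... | first refl _  | second refl _ = inj₁ D
    ... | old o ex      | second _ ey   = ⊥-elim (<-irrefl (trans eq (suc-injective (trans (sym eq') ey))) (old-< o ex))
    ... | first _ ex    | old o ey      = ⊥-elim (<-irrefl (trans eq' (cong suc (trans (sym eq) ex))) (<-trans (old-< o ey) (n<1+n _)))
    ... | second _ ex   | old o ey      = ⊥-elim (<-irrefl (trans eq' (cong suc (trans (sym eq) ex))) (<-trans (<-trans (old-< o ey) (n<1+n _)) (n<1+n _)))
    ... | first refl _  | first refl _  = ⊥-elim (suc≢ (trans (sym eq') eq))
    ... | second refl _ | second refl _ = ⊥-elim (suc≢ (trans (sym eq') eq))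
    -- Parity: here the even value 2k + 2 would equal 2z + 1.
    ... | old o ex      | first _ ey    = ⊥-elim (odd≢even k z (suc-injective (trans (sym eq') ey)))
    ... | second _ ex   | first _ ey    = ⊥-elim (odd≢even k z (suc-injective (trans (sym eq') ey)))

empty-filling : ∀ l → Filling l l 0 (λ _ → 0)
empty-filling l = record
  { positive = none ; at-most = none ; inj = λ s → none s ; surj = λ () ; mono = λ s → none s ; pairs = λ _ s → none s }
  where
  none : ∀ {X : Set} {x} → InSkew l l x → X
  none (s , n) = ⊥-elim (n s)

line-init : ∀ {m t a} → Line (suc m) t a → Line m t a
line-init l = record { partition = λ le → partition l (≤-trans le (n≤1+n _)) ; step = λ lt → step l (≤-trans lt (n≤1+n _)) }

-- Old entries unchanged and new entries above 2z: exactly what keeps the descriptions of earlier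
-- partitions in the chain valid.
Grown : (μ l l' : List ℕ) (z z' : ℕ) (e : Cell → ℕ) → Set
Grown μ l l' z z' e = Σ (Cell → ℕ) λ e' → Filling l' μ z' e' ×
  (∀ {x} → InSkew l μ x → e' x ≡ e x) × (∀ {x} → InSkew l' μ x → ¬ I l x → 2 * z < e' x)

step-filling : ∀ {μ l l' z e b} → IsPartition l → μ ⊆ₚ l → Filling l μ z e → Step l l' b →
  Grown μ l l' z (z + (if b then 1 else 0)) e
step-filling {μ} {l} {z = z} {e} hl s F (stay refl) =
  e , subst (λ z → Filling l μ z e) (sym (+-identityʳ z)) F , (λ _ → refl) , λ (o , _) n → ⊥-elim (n o)
step-filling {μ} {l} {l'} {z} hl s F (grow (l⊆l' , c , c' , D , eq)) =
  e' , subst (λ z → Filling l' μ z e') (+-comm 1 z) (filling-extend {l' = l'} hl s F D a) ,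
  (λ o → extend-old {l' = l'} hl s F D a (proj₁ o)) , extend-new {l' = l'} hl s F D a
  where
  a  = skew⇒add l l' l⊆l' eq
  e' = extend {l' = l'} hl s F D a

-- Induction on the last step, so that all earlier partitions and their entries are already in
-- place; a proper step assigns the next two values to its domino.
line⇒filling : ∀ m {t a} → Line m t a →
  Σ (Cell → ℕ) λ e → Filling (t m) (t 0) (count a m) e × Levels (t 0) (t m) e t (count a) m
line⇒filling zero {t} L = (λ _ → 0) , empty-filling (t 0) , λ { zero z≤n x → mk⇔ inj₁ [ (λ s → s) , (λ (s , _) → proj₁ s) ]′ }
line⇒filling (suc m) {t} {a} L with line⇒filling m (line-init L)
... | e , F , lev with step-filling (partition L (n≤1+n m)) (line-⊆ L z≤n (n≤1+n m)) F (step L ≤-refl)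
...   | e' , F' , same , new' = e' , F' , lev'
  where
  lev' : Levels (t 0) (t (suc m)) e' t (count a) (suc m)
  lev' k le x with m≤n⇒m<n∨m≡n le
  ... | inj₂ refl = mk⇔ total [ line-⊆ L z≤n ≤-refl x , (λ (s , _) → proj₁ s) ]′
    where
    total : I (t (suc m)) x → I (t 0) x ⊎ (InSkew (t (suc m)) (t 0) x × e' x ≤ 2 * count a (suc m))
    total s = [ inj₁ , (λ no → inj₂ ((s , no) , at-most F' (s , no))) ]′ (toSum (I? (t 0) x))
  ... | inj₁ (s≤s lt) = mk⇔
    (λ s → [ inj₁ , (λ ((o , n) , b) → inj₂ ((step-⊆ (step L ≤-refl) x o , n) , subst (_≤ 2 * count a k) (sym (same (o , n))) b)) ]′
             (to (lev k lt x) s))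
    [ (λ o → from (lev k lt x) (inj₁ o)) , back ]′
    where
    back : InSkew (t (suc m)) (t 0) x × e' x ≤ 2 * count a k → I (t k) x
    back ((s , n) , b) =
      [ (λ o → from (lev k lt x) (inj₂ ((o , n) , subst (_≤ 2 * count a k) (same (o , n)) b)))
      , (λ no → ⊥-elim (<-irrefl refl (<-≤-trans (new' (s , n) no) (≤-trans b (*-monoʳ-≤ 2 (count-≤ a lt))))))
      ]′ (toSum (I? (t m) x))

-- A filling is determined by its levels

halve : ∀ z {v} → v < 2 * z → Σ ℕ λ j → j < z × (v ≡ 2 * j ⊎ v ≡ suc (2 * j))
halve (suc z) {v} lt with v <? 2 * z
... | yes lt' = let (j , j<z , eq) = halve z lt' in j , <-trans j<z (n<1+n z) , eq
... | no nlt with m≤n⇒m<n∨m≡n (≮⇒≥ nlt)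
...   | inj₂ eq  = z , ≤-refl , inj₁ (sym eq)
...   | inj₁ lt' = z , ≤-refl , inj₂ (≤-antisym (≤-pred (subst (v <_) (*-suc 2 z) lt)) lt')

module _ {l μ : List ℕ} {z : ℕ} {e e' : Cell → ℕ} (F : Filling l μ z e) (F' : Filling l μ z e')
         (same : ∀ {j x} → j ≤ z → InSkew l μ x → e x ≤ 2 * j → e' x ≤ 2 * j)
         (same' : ∀ {j x} → j ≤ z → InSkew l μ x → e' x ≤ 2 * j → e x ≤ 2 * j) where

  slot : ∀ {j x} → j < z → InSkew l μ x → 2 * j < e x → e x ≤ 2 + 2 * j → e' x ≡ suc (2 * j) ⊎ e' x ≡ 2 + 2 * j
  slot {j} {x} lt s lo hi with m≤n⇒m<n∨m≡n (subst (e' x ≤_) (*-suc 2 j) (same lt s (subst (e x ≤_) (sym (*-suc 2 j)) hi)))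
  ... | inj₂ eq = inj₂ eq
  ... | inj₁ (s≤s le) with m≤n⇒m<n∨m≡n le
  ...   | inj₂ eq = inj₁ eq
  ...   | inj₁ (s≤s le') = ⊥-elim (<⇒≱ lo (same' (<⇒≤ lt) s le'))

  domino-≤ : ∀ {x y} → Domino x y → proj₁ x ≤ proj₁ y × proj₂ x ≤ proj₂ y
  domino-≤ (hor i j) = ≤-refl , n≤1+n j
  domino-≤ (ver i j) = n≤1+n i , ≤-refl

  -- Equal levels only show that both fillings put the same two values on a domino. Their order is
  -- forced by monotonicity along the domino, which neither filling can reverse.
  slots : ∀ {j x y} → j < z → InSkew l μ x → InSkew l μ y → e x ≡ suc (2 * j) → e y ≡ 2 + 2 * j →
    e' x ≡ suc (2 * j) × e' y ≡ 2 + 2 * j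
  slots {j} {x} {y} lt s s' ex ey
    with slot lt s (subst (2 * j <_) (sym ex) ≤-refl) (subst (_≤ 2 + 2 * j) (sym ex) (n≤1+n _))
       | slot lt s' (subst (2 * j <_) (sym ey) (n≤1+n _)) (≤-reflexive ey)
  ... | inj₁ p | inj₂ q = p , q
  ... | inj₁ p | inj₁ q = ⊥-elim (suc≢ (trans (sym ey) (trans (cong e (inj F' s' s (trans q (sym p)))) ex)))
  ... | inj₂ p | inj₂ q = ⊥-elim (suc≢ (trans (sym ey) (trans (cong e (inj F' s' s (trans q (sym p)))) ex)))
  ... | inj₂ p | inj₁ q with pairs F j s s' ex ey
  ...   | inj₁ D = ⊥-elim (<-irrefl refl (subst₂ _≤_ p q (mono F' s s' (proj₁ (domino-≤ D)) (proj₂ (domino-≤ D)))))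
  ...   | inj₂ D = ⊥-elim (<-irrefl refl (subst₂ _≤_ ey ex (mono F s' s (proj₁ (domino-≤ D)) (proj₂ (domino-≤ D)))))

  filling-unique : ∀ x → InSkew l μ x → e x ≡ e' x
  filling-unique x s = go (e x) refl
    where
    go : ∀ v → e x ≡ v → e x ≡ e' x
    go zero    ex = ⊥-elim (<-irrefl (sym ex) (positive F s))
    go (suc v) ex with halve z (subst (_≤ 2 * z) ex (at-most F s))
    ... | j , lt , eq with surj F (≤-trans (n≤1+n _) (≤-trans (≤-reflexive (sym (*-suc 2 j))) (*-monoʳ-≤ 2 lt)))
                         | surj F (≤-trans (≤-reflexive (sym (*-suc 2 j))) (*-monoʳ-≤ 2 lt))
    go (suc v) ex | j , lt , inj₁ eq | _ | y , s' , ey =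
      let ex' = trans ex (cong suc eq) in trans ex' (sym (proj₁ (slots lt s s' ex' ey)))
    go (suc v) ex | j , lt , inj₂ eq | y , s' , ey | _ =
      let ex' = trans ex (cong suc eq) in trans ex' (sym (proj₂ (slots lt s' s ey ex')))

-- A chain may repeat partitions, but by `count-hits` every number of dominoes up to the total
-- occurs at some position, so all levels can be compared.
levels-filling-unique : ∀ {μ l m a t e e'} → Filling l μ (count a m) e → Filling l μ (count a m) e' →
  Levels μ l e t (count a) m → Levels μ l e' t (count a) m → ∀ x → InSkew l μ x → e x ≡ e' x
levels-filling-unique {μ} {l} {m} {a} {t} F F' L L' =
  filling-unique F F' (λ {j} → transfer' L L' j) (λ {j} → transfer' L' L j)
  where
  transfer' : ∀ {e e'} → Levels μ l e t (count a) m → Levels μ l e' t (count a) m →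
    ∀ j {x} → j ≤ count a m → InSkew l μ x → e x ≤ 2 * j → e' x ≤ 2 * j
  transfer' L L' j le s b with count-hits a m le
  ... | k , k≤m , refl with to (L' k k≤m _) (from (L k k≤m _) (inj₂ (s , b)))
  ...   | inj₁ o       = ⊥-elim (proj₂ s o)
  ...   | inj₂ (_ , r) = r

-- Reading the dominoes of a tableau off a saturated chain

Labels : (μ l : List ℕ) (e : Cell → ℕ) (t : ℕ → List ℕ) (m : ℕ) → Set
Labels μ l e t m = ∀ {k} → k < m → ∀ x → InSkew l μ x →
  (e x ≡ suc (2 * k) ⊎ e x ≡ 2 + 2 * k) ⇔ InSkew (t (suc k)) (t k) x

levels⇒labels : ∀ {μ l e t m} → Levels μ l e t (λ k → k) m → Labels μ l e t m
levels⇒labels {μ} {l} {e} {t} L {k} lt x s = mk⇔ forth back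
  where
  member : ∀ {j} → j < suc k → e x ≤ 2 * suc j → I (t (suc j)) x
  member lt' b = from (L _ (≤-trans lt' lt) x) (inj₂ (s , b))
  2k : 2 * suc k ≡ 2 + 2 * k
  2k = *-suc 2 k
  outside : 2 * k < e x → ¬ I (t k) x
  outside lo i with to (L k (<⇒≤ lt) x) i
  ... | inj₁ o       = proj₂ s o
  ... | inj₂ (_ , b) = <⇒≱ lo b
  forth : e x ≡ suc (2 * k) ⊎ e x ≡ 2 + 2 * k → InSkew (t (suc k)) (t k) x
  forth (inj₁ eq) = member ≤-refl (subst₂ _≤_ (sym eq) (sym 2k) (n≤1+n _)) , outside (≤-reflexive (sym eq))
  forth (inj₂ eq) = member ≤-refl (≤-reflexive (trans eq (sym 2k))) , outside (subst (2 * k <_) (sym eq) (n≤1+n _))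
  back : InSkew (t (suc k)) (t k) x → e x ≡ suc (2 * k) ⊎ e x ≡ 2 + 2 * k
  back (i , n) with to (L (suc k) lt x) i
  ... | inj₁ o = ⊥-elim (proj₂ s o)
  ... | inj₂ (_ , b) with m≤n⇒m<n∨m≡n (subst (e x ≤_) 2k b)
  ...   | inj₂ eq = inj₂ eq
  ...   | inj₁ (s≤s le) with m≤n⇒m<n∨m≡n le
  ...     | inj₂ eq = inj₁ eq
  ...     | inj₁ (s≤s le') = ⊥-elim (n (from (L k (<⇒≤ lt) x) (inj₂ (s , le'))))

-- The graph of Φ describes `U` and `V` by levels but `P` and `Q` by labels. Induction on k joins
-- the two: the cells labelled 2k + 1 and 2k + 2 are those gained between positions k and k + 1.
labels⇒levels : ∀ {μ l z e t m a} → Filling l μ z e → Line m t a → t 0 ≡ μ → t m ≡ l →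
  Labels μ l e t m → Levels μ l e t (λ k → k) m
labels⇒levels F L refl refl lab zero le x = mk⇔ inj₁
  [ (λ s → s) , (λ (s , b) → ⊥-elim (<⇒≱ (positive F s) b)) ]′
labels⇒levels {e = e} {t} {m} F L refl refl lab (suc k) le x = mk⇔ forth back
  where
  IH = labels⇒levels F L refl refl lab k (<⇒≤ le) x
  2k : 2 * suc k ≡ 2 + 2 * k
  2k = *-suc 2 k
  bound' : InSkew (t m) (t 0) x → InSkew (t (suc k)) (t k) x → e x ≤ 2 * suc k
  bound' s i with from (lab le x s) i
  ... | inj₁ eq = subst₂ _≤_ (sym eq) (sym 2k) (n≤1+n _)
  ... | inj₂ eq = ≤-reflexive (trans eq (sym 2k))
  forth : I (t (suc k)) x → I (t 0) x ⊎ (InSkew (t m) (t 0) x × e x ≤ 2 * suc k)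
  forth i with I? (t k) x
  ... | no n = let s = line-⊆ L le ≤-refl x i , λ o → n (line-⊆ L z≤n (<⇒≤ le) x o) in inj₂ (s , bound' s (i , n))
  ... | yes i' with to IH i'
  ...   | inj₁ o       = inj₁ o
  ...   | inj₂ (s , b) = inj₂ (s , ≤-trans b (*-monoʳ-≤ 2 (n≤1+n k)))
  back : I (t 0) x ⊎ (InSkew (t m) (t 0) x × e x ≤ 2 * suc k) → I (t (suc k)) x
  back (inj₁ o) = line-⊆ L z≤n le x o
  back (inj₂ (s , b)) with m≤n⇒m<n∨m≡n (subst (e x ≤_) 2k b)
  ... | inj₂ eq = proj₁ (to (lab le x s) (inj₂ eq))
  ... | inj₁ (s≤s le') with m≤n⇒m<n∨m≡n le'
  ...   | inj₂ eq = proj₁ (to (lab le x s) (inj₁ eq))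
  ...   | inj₁ (s≤s le'') = step-⊆ (step L le) x (from IH (inj₂ (s , le'')))

-- Partial permutation matrices

bit : Bool → ℕ
bit b = if b then 1 else 0

nonZero : ℤ → Bool
nonZero z = not (isZero z)

true≢false : true ≢ false
true≢false ()

isZero⇒≡ : ∀ {z} → isZero z ≡ true → z ≡ + 0
isZero⇒≡ {+ zero} _ = refl

≢⇒isZero : ∀ {z} → z ≢ + 0 → isZero z ≡ false
≢⇒isZero {+ zero}    ne = ⊥-elim (ne refl)
≢⇒isZero {+ suc n}   ne = refl
≢⇒isZero { -[1+ n ]} ne = refl

-- Indexed by natural numbers like Γ. The value 0 outside the matrix makes vanishing from a position
-- onwards meaningful without range conditions.
entry : ∀ {n m} → Matrix n m → ℕ → ℕ → ℤ
entry []      i       k = + 0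
entry (r ∷ M) zero    k = lookupZ r k
entry (r ∷ M) (suc i) k = entry M i k

lookupZ-toℕ : ∀ {m} (v : Vec ℤ m) k → lookupZ v (toℕ k) ≡ lookup v k
lookupZ-toℕ (z ∷ v) zero    = refl
lookupZ-toℕ (z ∷ v) (suc k) = lookupZ-toℕ v k

entry-toℕ : ∀ {n m} (M : Matrix n m) i k → entry M (toℕ i) (toℕ k) ≡ M ⟨ i , k ⟩
entry-toℕ (r ∷ M) zero    k = lookupZ-toℕ r k
entry-toℕ (r ∷ M) (suc i) k = entry-toℕ M i k

lookupZ-inside : ∀ {m} (v : Vec ℤ m) k → lookupZ v k ≢ + 0 → k < m
lookupZ-inside []      k       ne = ⊥-elim (ne refl)
lookupZ-inside (z ∷ v) zero    ne = s≤s z≤n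
lookupZ-inside (z ∷ v) (suc k) ne = s≤s (lookupZ-inside v k ne)

entry-inside : ∀ {n m} (M : Matrix n m) i k → entry M i k ≢ + 0 → i < n × k < m
entry-inside []      i       k ne = ⊥-elim (ne refl)
entry-inside (r ∷ M) zero    k ne = s≤s z≤n , lookupZ-inside r k ne
entry-inside (r ∷ M) (suc i) k ne = let (li , lk) = entry-inside M i k ne in s≤s li , lk

lookupZ-ext : ∀ {m} (v w : Vec ℤ m) → (∀ k → k < m → lookupZ v k ≡ lookupZ w k) → v ≡ w
lookupZ-ext []      []       e = refl
lookupZ-ext (z ∷ v) (z' ∷ w) e = cong₂ _∷_ (e 0 (s≤s z≤n)) (lookupZ-ext v w (λ k lt → e (suc k) (s≤s lt)))

entry-ext : ∀ {n m} (M M' : Matrix n m) → (∀ {i k} → i < n → k < m → entry M i k ≡ entry M' i k) → M ≡ M'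
entry-ext []      []        e = refl
entry-ext (r ∷ M) (r' ∷ M') e = cong₂ _∷_
  (lookupZ-ext r r' (λ k lt → e (s≤s z≤n) lt)) (entry-ext M M' (λ lt lk → e (s≤s lt) lk))

fromFunction : ∀ n m → (ℕ → ℕ → ℤ) → Matrix n m
fromFunction n m E = tabulate (λ i → tabulate (λ k → E (toℕ i) (toℕ k)))

lookupZ-tabulate : ∀ {m} (f : ℕ → ℤ) {k} → k < m → lookupZ (tabulate {n = m} (f ∘ toℕ)) k ≡ f k
lookupZ-tabulate {suc m} f {zero}  _        = refl
lookupZ-tabulate {suc m} f {suc k} (s≤s lt) = lookupZ-tabulate (f ∘ suc) lt

entry-fromFunction : ∀ n m E {i k} → i < n → k < m → entry (fromFunction n m E) i k ≡ E i k
entry-fromFunction (suc n) m E {zero}  _         lk = lookupZ-tabulate (E 0) lk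
entry-fromFunction (suc n) m E {suc i} (s≤s li) lk = entry-fromFunction n m (E ∘ suc) li lk

-- Vanishing on the interval from i up to, but excluding, n. At i = 0 this is the zero test for a
-- whole row or column; at i = n it is `true`, in accordance with the saturated bottom row and right
-- column.
zerosFrom : (ℕ → ℤ) → (n i : ℕ) → Bool
zerosFrom f zero    i       = true
zerosFrom f (suc n) zero    = isZero (f 0) ∧ zerosFrom (f ∘ suc) n 0
zerosFrom f (suc n) (suc i) = zerosFrom (f ∘ suc) n i

zerosFrom-step : ∀ f {n i} → i < n → zerosFrom f n i ≡ isZero (f i) ∧ zerosFrom f n (suc i)
zerosFrom-step f {suc n} {zero}  _        = refl
zerosFrom-step f {suc n} {suc i} (s≤s lt) = zerosFrom-step (f ∘ suc) lt

zerosFrom-true : ∀ f n i → (∀ j → i ≤ j → f j ≡ + 0) → zerosFrom f n i ≡ true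
zerosFrom-true f zero    i       e = refl
zerosFrom-true f (suc n) zero    e rewrite e 0 z≤n = zerosFrom-true (f ∘ suc) n 0 (λ j _ → e (suc j) z≤n)
zerosFrom-true f (suc n) (suc i) e = zerosFrom-true (f ∘ suc) n i (λ j le → e (suc j) (s≤s le))

zerosFrom-end : ∀ f n → zerosFrom f n n ≡ true
zerosFrom-end f zero    = refl
zerosFrom-end f (suc n) = zerosFrom-end (f ∘ suc) n

colIsZero-zerosFrom : ∀ {n m} (M : Matrix n m) k → colIsZero M k ≡ zerosFrom (λ i → entry M i k) n 0
colIsZero-zerosFrom []      k = refl
colIsZero-zerosFrom (r ∷ M) k = cong (isZero (lookupZ r k) ∧_) (colIsZero-zerosFrom M k)

-- rowIsZero (r ∷ M) 0 does not depend on M, nor on how r continues the suffix being scanned.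
headIsZero-zerosFrom : ∀ {n m} (r : Vec ℤ m) (M : Matrix n m) → rowIsZero (r ∷ M) 0 ≡ zerosFrom (lookupZ r) m 0
headIsZero-zerosFrom []      M = refl
headIsZero-zerosFrom (z ∷ r) M = cong (isZero z ∧_) (headIsZero-zerosFrom r [])

rowIsZero-zerosFrom : ∀ {n m} (M : Matrix n m) i → rowIsZero M i ≡ zerosFrom (entry M i) m 0
rowIsZero-zerosFrom {m = m} [] i    = sym (zerosFrom-true (λ _ → + 0) m 0 (λ _ _ → refl))
rowIsZero-zerosFrom (r ∷ M) zero    = headIsZero-zerosFrom r M
rowIsZero-zerosFrom (r ∷ M) (suc i) = rowIsZero-zerosFrom M i

zeroCols-count : ∀ {n m} (M : Matrix n m) k → zeroColsBefore M k ≡ count (colIsZero M) k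
zeroCols-count M zero    = refl
zeroCols-count M (suc k) = cong (_+ bit (colIsZero M k)) (zeroCols-count M k)

zeroRows-count : ∀ {n m} (M : Matrix n m) i → zeroRowsBefore M i ≡ count (rowIsZero M) i
zeroRows-count M zero    = refl
zeroRows-count M (suc i) = cong (_+ bit (rowIsZero M i)) (zeroRows-count M i)

-- Step indicators and matrices: along each column (row) of the array the indicator at a cell
-- says whether the matrix vanishes from that cell on.

Transfers : (n m : ℕ) (E : ℕ → ℕ → ℤ) (A B : ℕ → ℕ → Bool) → Set
Transfers n m E A B = ∀ {i k} → i < n → k < m →
  Transfer (E i k) (A i k) (B i k) (A (suc i) k) (B i (suc k))

colSteps rowSteps : ∀ {n m} → Matrix n m → ℕ → ℕ → Bool
colSteps {n} M i k = zerosFrom (λ j → entry M j k) n i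
rowSteps {m = m} M i k = zerosFrom (entry M i) m k

-- After a nonzero entry its row and column vanish, so both outgoing indicators are `true`, while
-- the entry itself makes both incoming ones `false`. At a zero entry the indicators simply pass
-- through.
PPM⇒transfers : ∀ {n m} (M : Matrix n m) → IsPPM M → Transfers n m (entry M) (colSteps M) (rowSteps M)
PPM⇒transfers {n} {m} M (values , row-unique , col-unique) {i} {k} li lk =
  subst₂ (λ a b → Transfer (entry M i k) a b (colSteps M (suc i) k) (rowSteps M i (suc k)))
    (sym (zerosFrom-step (λ j → entry M j k) li)) (sym (zerosFrom-step (entry M i) lk))
    (make (subst (λ e → e ≡ + 1 ⊎ e ≡ -[1+ 0 ] ⊎ e ≡ + 0) (sym at) (values fi fk))
      (λ ne → zerosFrom-true _ n (suc i) (below ne)) (λ ne → zerosFrom-true _ m (suc k) (after ne)))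
  where
  make : ∀ {e a' b'} → (e ≡ + 1 ⊎ e ≡ -[1+ 0 ] ⊎ e ≡ + 0) → (e ≢ + 0 → a' ≡ true) → (e ≢ + 0 → b' ≡ true) →
    Transfer e (isZero e ∧ a') (isZero e ∧ b') a' b'
  make (inj₁ refl) f g with f (λ ()) | g (λ ())
  ... | refl | refl = plus
  make (inj₂ (inj₁ refl)) f g with f (λ ()) | g (λ ())
  ... | refl | refl = minus
  make (inj₂ (inj₂ refl)) f g = zero
  fi = fromℕ< li
  fk = fromℕ< lk
  M-at : ∀ {j j'} (lj : j < n) (lj' : j' < m) → entry M j j' ≡ M ⟨ fromℕ< lj , fromℕ< lj' ⟩
  M-at lj lj' = trans (cong₂ (entry M) (sym (toℕ-fromℕ< lj)) (sym (toℕ-fromℕ< lj'))) (entry-toℕ M _ _)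
  at = M-at li lk
  below : entry M i k ≢ + 0 → ∀ j → suc i ≤ j → entry M j k ≡ + 0
  below ne j lt with isZero (entry M j k) in eq
  ... | true  = isZero⇒≡ eq
  -- A nonzero value certifies that j is a genuine row index, to which the uniqueness condition on
  -- columns applies.
  ... | false with entry-inside M j k (λ z → true≢false (trans (sym (cong isZero z)) eq))
  ...   | lj , _ = ⊥-elim (<-irrefl (trans (sym (toℕ-fromℕ< li)) (trans (cong toℕ (col-unique fi (fromℕ< lj) fk
            (λ z → ne (trans at z))
            (λ z → true≢false (trans (sym (cong isZero (trans (M-at lj lk) z))) eq)))) (toℕ-fromℕ< lj))) lt)
  after : entry M i k ≢ + 0 → ∀ j → suc k ≤ j → entry M i j ≡ + 0
  after ne j lt with isZero (entry M i j) in eq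
  ... | true  = isZero⇒≡ eq
  ... | false with entry-inside M i j (λ z → true≢false (trans (sym (cong isZero z)) eq))
  ...   | _ , lj = ⊥-elim (<-irrefl (trans (sym (toℕ-fromℕ< lk)) (trans (cong toℕ (row-unique fi fk (fromℕ< lj)
            (λ z → ne (trans at z))
            (λ z → true≢false (trans (sym (cong isZero (trans (M-at li lj) z))) eq)))) (toℕ-fromℕ< lj))) lt)

-- What the transfers say along one column or one row: the indicator obeys the recursion of the zero
-- test, and a nonzero entry leaves it `true`. Rows and columns can then share their proofs.
record Sweep (n : ℕ) (e : ℕ → ℤ) (a : ℕ → Bool) : Set where
  field
    sweep    : ∀ {i} → i < n → a i ≡ isZero (e i) ∧ a (suc i)
    released : ∀ {i} → i < n → e i ≢ + 0 → a (suc i) ≡ true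

open Sweep

col-sweep : ∀ {n m E A B k} → Transfers n m E A B → k < m → Sweep n (λ i → E i k) (λ i → A i k)
col-sweep {E = E} {A} {B} {k} tr lk = record { sweep = λ li → go (tr li lk) ; released = λ li → go' (tr li lk) }
  where
  go : ∀ {e a b a' b'} → Transfer e a b a' b' → a ≡ isZero e ∧ a'
  go zero  = refl
  go plus  = refl
  go minus = refl
  go' : ∀ {e a b a' b'} → Transfer e a b a' b' → e ≢ + 0 → a' ≡ true
  go' zero  ne = ⊥-elim (ne refl)
  go' plus  ne = refl
  go' minus ne = refl

transfer-swap : ∀ {e a b a' b'} → Transfer e a b a' b' → Transfer e b a b' a'
transfer-swap zero  = zero
transfer-swap plus  = plus
transfer-swap minus = minus

row-sweep : ∀ {n m E A B i} → Transfers n m E A B → i < n → Sweep m (E i) (B i)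
row-sweep tr li = col-sweep (λ lk li → transfer-swap (tr li lk)) li

sweep-true : ∀ {n e a} → Sweep n e a → ∀ {i} j → i ≤ j → j ≤ n → a i ≡ true → a j ≡ true
sweep-true s j le ln ai with m≤n⇒m<n∨m≡n le
... | inj₂ refl = ai
sweep-true {e = e} s (suc j) le ln ai | inj₁ (s≤s lt) with sweep-true s j lt (<⇒≤ ln) ai
... | aj with isZero (e j) | trans (sym aj) (sweep s ln)
...   | true  | eq = sym eq
...   | false | ()

-- An indicator that is `true` stays `true`, and a nonzero entry makes it so; but at a nonzero entry
-- it has to be `false`. So no second nonzero entry can follow.
sweep-≮ : ∀ {n e a} → Sweep n e a → ∀ {i j} → i < n → j < n → e i ≢ + 0 → e j ≢ + 0 → ¬ i < j
sweep-≮ {e = e} {a} s {i} {j} li lj ni nj lt = true≢false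
  (trans (sym (sweep-true s j lt (<⇒≤ lj) (released s li ni)))
         (trans (sweep s lj) (cong (_∧ a (suc j)) (≢⇒isZero nj))))

sweep-unique : ∀ {n e a} → Sweep n e a → ∀ {i j} → i < n → j < n → e i ≢ + 0 → e j ≢ + 0 → i ≡ j
sweep-unique s li lj ni nj = ≤-antisym (≮⇒≥ (sweep-≮ s lj li nj ni)) (≮⇒≥ (sweep-≮ s li lj ni nj))

-- Unwinding the recursion from the saturated end turns the first indicator into the zero test for
-- the whole column or row.
sweep-zeros : ∀ n {e a} → Sweep n e a → a n ≡ true → a 0 ≡ zerosFrom e n 0
sweep-zeros zero    s an = an
sweep-zeros (suc n) {e} s an = trans (sweep s (s≤s z≤n)) (cong (isZero (e 0) ∧_)
  (sweep-zeros n (record { sweep = λ lt → sweep s (s≤s lt) ; released = λ lt → released s (s≤s lt) }) an))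

transfers⇒PPM : ∀ {n m} (M : Matrix n m) {A B} → Transfers n m (entry M) A B → IsPPM M
transfers⇒PPM {n} {m} M tr =
  (λ i k → subst (λ e → e ≡ + 1 ⊎ e ≡ -[1+ 0 ] ⊎ e ≡ + 0) (entry-toℕ M i k) (value (tr (toℕ<n i) (toℕ<n k)))) ,
  (λ i k k' ne ne' → toℕ-injective (sweep-unique (row-sweep tr (toℕ<n i)) (toℕ<n k) (toℕ<n k') (at ne) (at ne'))) ,
  (λ i i' k ne ne' → toℕ-injective (sweep-unique (col-sweep tr (toℕ<n k)) (toℕ<n i) (toℕ<n i') (at ne) (at ne')))
  where
  value : ∀ {e a b a' b'} → Transfer e a b a' b' → e ≡ + 1 ⊎ e ≡ -[1+ 0 ] ⊎ e ≡ + 0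
  value zero  = inj₂ (inj₂ refl)
  value plus  = inj₁ refl
  value minus = inj₂ (inj₁ refl)
  at : ∀ {i k} → ¬ M ⟨ i , k ⟩ ≡ + 0 → entry M (toℕ i) (toℕ k) ≢ + 0
  at {i} {k} ne z = ne (trans (sym (entry-toℕ M i k)) z)

count-shift : ∀ a k → count a (suc k) ≡ bit (a 0) + count (a ∘ suc) k
count-shift a zero    = sym (+-identityʳ _)
count-shift a (suc k) = trans (cong (_+ bit (a (suc k))) (count-shift a k)) (+-assoc (bit (a 0)) _ _)

countNZ-count : ∀ {m} (v : Vec ℤ m) → countNZ v ≡ count (nonZero ∘ lookupZ v) m
countNZ-count []              = refl
countNZ-count {suc m} (z ∷ v) = trans (cong₂ _+_ (flip (isZero z)) (countNZ-count v))
                                      (sym (count-shift (nonZero ∘ lookupZ (z ∷ v)) m))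
  where
  flip : ∀ b → (if b then 0 else 1) ≡ bit (not b)
  flip true  = refl
  flip false = refl

-- In each square a nonzero entry raises both the horizontal and the vertical indicator from 0 to 1.
-- Summed along a row, the horizontal contributions add up and the vertical ones telescope.
row-balance : ∀ m (e : ℕ → ℤ) (a b a' : ℕ → Bool) →
  (∀ {k} → k < m → Transfer (e k) (a k) (b k) (a' k) (b (suc k))) →
  count a' m ≡ count a m + count (nonZero ∘ e) m × bit (b m) ≡ bit (b 0) + count (nonZero ∘ e) m
row-balance zero    e a b a' tr = refl , sym (+-identityʳ _)
row-balance (suc m) e a b a' tr =
  let (p , q) = row-balance m e a b a' (λ lt → tr (≤-trans lt (n≤1+n m)))
      (p' , q') = one (tr ≤-refl)
  in trans (cong₂ _+_ p p') (interchange (count a m) (count (nonZero ∘ e) m) (bit (a m)) _) ,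
     trans q' (trans (cong (_+ bit (nonZero (e m))) q) (+-assoc (bit (b 0)) _ _))
  where
  one : ∀ {z a b a' b'} → Transfer z a b a' b' → bit a' ≡ bit a + bit (nonZero z) × bit b' ≡ bit b + bit (nonZero z)
  one zero  = sym (+-identityʳ _) , sym (+-identityʳ _)
  one plus  = refl , refl
  one minus = refl , refl

-- Going down the rows, the number of proper horizontal steps grows by the number of nonzero entries
-- until it is m; each row whose left step is trivial spends one nonzero entry to make its right
-- step proper. Hence β/μ and α/μ get m - j and n - j dominoes.
balance : ∀ {n m} (M : Matrix n m) {A B} → Transfers n m (entry M) A B →
  (∀ {k} → k < m → A n k ≡ true) → (∀ {i} → i < n → B i m ≡ true) →
  count (A 0) m + nonzeros M ≡ m × count (λ i → B i 0) n + nonzeros M ≡ n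
balance {m = m} [] tr bottom right =
  trans (+-identityʳ _) (trans (count-cong m bottom) (count-true m)) , refl
balance {suc n} {m} (r ∷ M) {A} {B} tr bottom right =
  let (p , q)   = balance M {A ∘ suc} {B ∘ suc} (λ li lk → tr (s≤s li) lk) bottom (λ li → right (s≤s li))
      (p' , q') = row-balance m (lookupZ r) (A 0) (B 0) (A 1) (λ lk → tr (s≤s z≤n) lk)
      nz        = countNZ-count r
  in trans (sym (+-assoc (count (A 0) m) _ _))
       (trans (cong (_+ nonzeros M) (trans (cong (λ c → count (A 0) m + c) nz) (sym p'))) p) ,
     trans (cong (_+ (countNZ r + nonzeros M)) (count-shift (λ i → B i 0) n))
       (trans (interchange (bit (B 0 0)) (count (λ i → B (suc i) 0) n) (countNZ r) (nonzeros M))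
         (cong₂ _+_ (trans (cong (λ c → bit (B 0 0) + c) nz) (trans (sym q') (cong bit (right (s≤s z≤n))))) q))

-- Tableaux along the sides of a growth array

always : ℕ → Bool
always _ = true

line-cong : ∀ {m t a b} → (∀ {k} → k < m → a k ≡ b k) → Line m t a → Line m t b
line-cong {t = t} eq l = record
  { partition = partition l ; step = λ {k} lt → subst (Step (t k) (t (suc k))) (eq lt) (step l lt) }

column : ∀ {n m Γ E A B k} → GrowthArray n m Γ E A B → k ≤ m → Line n (λ i → Γ i k) (λ i → B i k)
column g le = record { partition = λ li → partition (line g li) le ; step = λ li → rung (band g li) le }

transfers : ∀ {n m Γ E A B} → GrowthArray n m Γ E A B → Transfers n m E A B
transfers g li lk = transfer (band g li) lk

levels-cong : ∀ {μ l e t u z m} → (∀ {k} → k ≤ m → t k ≡ u k) → Levels μ l e t z m → Levels μ l e u z m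
levels-cong {μ} {l} {e} {z = z} eq L k le x =
  subst (λ p → I p x ⇔ (I μ x ⊎ (InSkew l μ x × e x ≤ 2 * z k))) (eq le) (L k le x)

levels-entries : ∀ {μ l e e' t z m} → (∀ {x} → InSkew l μ x → e x ≡ e' x) →
  Levels μ l e t z m → Levels μ l e' t z m
levels-entries {z = z} eq L k le x = mk⇔
  (λ s → [ inj₁ , (λ (o , b) → inj₂ (o , subst (_≤ 2 * z k) (eq o) b)) ]′ (to (L k le x) s))
  (λ s → from (L k le x) ([ inj₁ , (λ (o , b) → inj₂ (o , subst (_≤ 2 * z k) (sym (eq o)) b)) ]′ s))

line⇒SDT : ∀ m {t a} → Line m t a → Σ Tableau λ T → IsSDT (t m) (t 0) T ×
  size (t m) (t 0) ≡ 2 * count a m × Levels (t 0) (t m) (ent T (t 0)) t (count a) m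
line⇒SDT m {t} {a} L =
  let (e , F , lev) = line⇒filling m L
      sz = trans (cong (_∸ sum (t 0)) (line-sum L m ≤-refl)) (m+n∸m≡n (sum (t 0)) _)
  in tableau (t m) (t 0) e , filling⇒SDT (t m) (t 0) e (line-⊆ L z≤n ≤-refl) sz F , sz ,
     levels-entries {t 0} {t m} {e} {ent (tableau (t m) (t 0) e) (t 0)} {t} {count a}
       (λ s → sym (ent-tableau (t m) (t 0) e s)) lev

SDT-unique : ∀ l μ T T' m a t u → size l μ ≡ 2 * count a m → IsSDT l μ T → IsSDT l μ T' →
  Levels μ l (ent T μ) t (count a) m → Levels μ l (ent T' μ) u (count a) m →
  (∀ {k} → k ≤ m → t k ≡ u k) → T ≡ T'
SDT-unique l μ T T' m a t u sz s s' L L' eq = SDT-ext {l} {μ} s s'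
  (levels-filling-unique {a = a} {u} (SDT⇒filling {l} {μ} {T} {count a m} sz s) (SDT⇒filling {l} {μ} {T'} {count a m} sz s')
     (levels-cong {μ} {l} {ent T μ} {t} {u} {count a} eq L) L')

FinLabels : (μ l : List ℕ) (T : Tableau) (t : ℕ → List ℕ) (m : ℕ) → Set
FinLabels μ l T t m = ∀ (k : Fin m) x → InSkew l μ x →
  ((ent T μ x ≡ suc (2 * toℕ k) ⊎ ent T μ x ≡ 2 + 2 * toℕ k) ⇔ InSkew (t (suc (toℕ k))) (t (toℕ k)) x)

-- With every step proper, position and number of dominoes coincide, so the labels of `P` and `Q`
-- translate into the same kind of description as for `U` and `V`.
saturated-levels : ∀ {μ l T t a m} → size l μ ≡ 2 * m → IsSDT l μ T → Line m t a → t 0 ≡ μ → t m ≡ l →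
  FinLabels μ l T t m → Levels μ l (ent T μ) t (count always) m
saturated-levels {μ} {l} {T} {t} {m = m} sz s L start end lab =
  levels-z {μ} {l} {ent T μ} {t} (λ k _ → sym (count-true k))
    (labels⇒levels (SDT⇒filling {l} {μ} {T} {m} sz s) L start end λ {k} lt x o →
      subst (λ k → (ent T μ x ≡ suc (2 * k) ⊎ ent T μ x ≡ 2 + 2 * k) ⇔ InSkew (t (suc k)) (t k) x)
            (toℕ-fromℕ< lt) (lab (fromℕ< lt) x o))

saturated-labels : ∀ {μ l T t m} → Levels μ l (ent T μ) t (count always) m → FinLabels μ l T t m
saturated-labels {μ} {l} {T} {t} L k x o =
  levels⇒labels {μ} {l} {ent T μ} {t} (levels-z {μ} {l} {ent T μ} {t} (λ k _ → count-true k) L) (toℕ<n k) x o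

saturated-size : ∀ {l μ m} → size l μ ≡ 2 * m → size l μ ≡ 2 * count always m
saturated-size {m = m} eq = trans eq (cong (2 *_) (sym (count-true m)))

colSteps-count : ∀ {n m} (M : Matrix n m) k → count (colSteps M 0) k ≡ zeroColsBefore M k
colSteps-count M k = trans (count-cong k (λ _ → sym (colIsZero-zerosFrom M _))) (sym (zeroCols-count M k))

rowSteps-count : ∀ {n m} (M : Matrix n m) i → count (λ i → rowSteps M i 0) i ≡ zeroRowsBefore M i
rowSteps-count M i = trans (count-cong i (λ _ → sym (rowIsZero-zerosFrom M _))) (sym (zeroRows-count M i))

-- The graph of Φ as a growth array with four described sides, and its four properties

module _ {α β : List ℕ} {n m : ℕ} (hα : IsPartition α) (hβ : IsPartition β) where

  module Source (μ : List ℕ) (U V : Tableau) (M : Matrix n m) (d : InDomain α β n m (μ , U , V , M)) where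

    hμ : IsPartition μ
    hμ = proj₁ d

    A B : ℕ → ℕ → Bool
    A = colSteps M
    B = rowSteps M

    left-steps : ℕ → Bool
    left-steps i = B i 0

    μ⊆β : μ ⊆ₚ β
    μ⊆β = proj₁ (proj₂ d)

    μ⊆α : μ ⊆ₚ α
    μ⊆α = proj₁ (proj₂ (proj₂ d))

    PPM-transfers : Transfers n m (entry M) A B
    PPM-transfers = PPM⇒transfers M (proj₁ (proj₂ (proj₂ (proj₂ d))))

    bottom-steps : ∀ {k} → k < m → A n k ≡ true
    bottom-steps _ = zerosFrom-end _ n

    right-steps : ∀ {i} → i < n → B i m ≡ true
    right-steps _ = zerosFrom-end _ m

    zeros-balance : count (A 0) m + nonzeros M ≡ m × count left-steps n + nonzeros M ≡ n
    zeros-balance = balance M PPM-transfers bottom-steps right-steps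

    -- The domain measures β/μ by `m ∸ nonzeros M`; the balance identifies this with the number of
    -- zero columns, that is, of proper steps in the top row.
    sizeU : size β μ ≡ 2 * count (A 0) m
    sizeU = trans (proj₁ (proj₂ (proj₂ (proj₂ (proj₂ d)))))
      (cong (2 *_) (trans (cong (_∸ nonzeros M) (sym (proj₁ zeros-balance))) (m+n∸n≡m _ (nonzeros M))))

    sizeV : size α μ ≡ 2 * count left-steps n
    sizeV = trans (proj₁ (proj₂ (proj₂ (proj₂ (proj₂ (proj₂ d))))))
      (cong (2 *_) (trans (cong (_∸ nonzeros M) (sym (proj₂ zeros-balance))) (m+n∸n≡m _ (nonzeros M))))

    sdtU : IsSDT β μ U
    sdtU = proj₁ (proj₂ (proj₂ (proj₂ (proj₂ (proj₂ (proj₂ d))))))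

    sdtV : IsSDT α μ V
    sdtV = proj₂ (proj₂ (proj₂ (proj₂ (proj₂ (proj₂ (proj₂ d))))))

    fillingU : Filling β μ (count (A 0) m) (ent U μ)
    fillingU = SDT⇒filling {β} {μ} {U} sizeU sdtU

    fillingV : Filling α μ (count left-steps n) (ent V μ)
    fillingV = SDT⇒filling {α} {μ} {V} sizeV sdtV

  -- A symmetric version of the graph: all four sides are described by `Levels`, so either pair of
  -- adjacent sides can determine the array.
  record Target (μ : List ℕ) (U V : Tableau) (M : Matrix n m) (l : List ℕ) (P Q : Tableau) : Set where
    field
      Γ           : ℕ → ℕ → List ℕ
      {A B}       : ℕ → ℕ → Bool
      array       : GrowthArray n m Γ (entry M) A B
      start       : Γ 0 0 ≡ μ
      bottom-left : Γ n 0 ≡ α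
      top-right   : Γ 0 m ≡ β
      end         : Γ n m ≡ l
      levelsU     : Levels μ β (ent U μ) (Γ 0) (count (colSteps M 0)) m
      levelsV     : Levels μ α (ent V μ) (λ i → Γ i 0) (count (λ i → rowSteps M i 0)) n
      levelsP     : Levels α l (ent P α) (Γ n) (count always) m
      levelsQ     : Levels β l (ent Q β) (λ i → Γ i m) (count always) n

  analyse : ∀ μ U V M l P Q → InDomain α β n m (μ , U , V , M) → InCodomain α β n m (l , P , Q) →
    PhiGraph α β n m (μ , U , V , M) (l , P , Q) → Target μ U V M l P Q
  analyse μ U V M l P Q d (hl , _ , _ , szP , szQ , sdtP , sdtQ) (Γ , parts , top , side , locals , refl , labP , labQ) =
    record
      { Γ = Γ ; array = arr ; start = st ; bottom-left = bl ; top-right = tr ; end = refl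
      ; levelsU = LU ; levelsV = LV
      ; levelsP = saturated-levels {α} {l} {P} {Γ n} szP sdtP (line arr ≤-refl) bl refl labP
      ; levelsQ = saturated-levels {β} {l} {Q} {λ i → Γ i m} szQ sdtQ (column arr ≤-refl) tr refl labQ }
    where
    open Source μ U V M d
    LU : Levels μ β (ent U μ) (Γ 0) (count (A 0)) m
    LU = levels-z {μ} {β} {ent U μ} {Γ 0} (λ k _ → sym (colSteps-count M k)) top
    LV : Levels μ α (ent V μ) (λ i → Γ i 0) (count left-steps) n
    LV = levels-z {μ} {α} {ent V μ} {λ i → Γ i 0} (λ i _ → sym (rowSteps-count M i)) side
    hp : ∀ {i k} → i ≤ n → k ≤ m → IsPartition (Γ i k)
    hp = parts _ _
    local-at : ∀ {i k} → i < n → k < m →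
      Local (Γ i k) (Γ i (suc k)) (Γ (suc i) k) (entry M i k) (Γ (suc i) (suc k))
    local-at li lk = subst₂ (λ i k → Local (Γ i k) (Γ i (suc k)) (Γ (suc i) k) (entry M i k) (Γ (suc i) (suc k)))
      (toℕ-fromℕ< li) (toℕ-fromℕ< lk)
      (subst (λ e → Local _ _ _ e _) (sym (entry-toℕ M (fromℕ< li) (fromℕ< lk))) (locals (fromℕ< li) (fromℕ< lk)))
    -- Interior steps are not part of the graph; they are derived from the sides given by `U` and
    -- `V`.
    arr : GrowthArray n m Γ (entry M) A B
    arr = array-steps n hp
      (levels⇒line hμ hβ fillingU refl (λ _ lk → hp z≤n lk) LU)
      (λ li → step (levels⇒line hμ hα fillingV {a = left-steps} refl (λ _ li → hp li z≤n) LV) li)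
      PPM-transfers local-at
    st : Γ 0 0 ≡ μ
    st = levels-start hμ hβ fillingU {m} {count (A 0)} {Γ 0} refl (hp z≤n z≤n) LU
    tr : Γ 0 m ≡ β
    tr = levels-end hμ hβ fillingU {m} {count (A 0)} {Γ 0} μ⊆β refl (hp z≤n ≤-refl) LU
    bl : Γ n 0 ≡ α
    bl = levels-end hμ hα fillingV {n} {count left-steps} {λ i → Γ i 0} μ⊆α refl (hp ≤-refl z≤n) LV

  synthesise : ∀ μ U V M l P Q → Target μ U V M l P Q → PhiGraph α β n m (μ , U , V , M) (l , P , Q)
  synthesise μ U V M l P Q T =
    Γ , (λ i k li lk → partition (line array li) lk) ,
    levels-z {μ} {β} {ent U μ} {Γ 0} (λ k _ → colSteps-count M k) levelsU ,
    levels-z {μ} {α} {ent V μ} {λ i → Γ i 0} (λ i _ → rowSteps-count M i) levelsV ,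
    (λ i k → subst (λ e → Local _ _ _ e _) (entry-toℕ M i k) (local (band array (toℕ<n i)) (toℕ<n k))) ,
    sym end , saturated-labels {α} {l} {P} {Γ n} levelsP , saturated-labels {β} {l} {Q} {λ i → Γ i m} levelsQ
    where open Target T

  well-defined : ∀ x → InDomain α β n m x → Σ Output λ y → InCodomain α β n m y × PhiGraph α β n m x y
  well-defined (μ , U , V , M) d = build
    where
    open Source μ U V M d
    build : Σ Output λ y → InCodomain α β n m y × PhiGraph α β n m (μ , U , V , M) y
    build with levels-exist hμ hβ fillingU (count (A 0)) m | levels-exist hμ hα fillingV (count left-steps) n
    ... | t , ht , Lt | s , hs , Ls
      with levels-start hμ hβ fillingU {m} {count (A 0)} {t} refl (ht 0) Lt
         | levels-start hμ hα fillingV {n} {count left-steps} {s} refl (hs 0) Ls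
         | levels-end hμ hβ fillingU {m} {count (A 0)} {t} μ⊆β refl (ht m) Lt
         | levels-end hμ hα fillingV {n} {count left-steps} {s} μ⊆α refl (hs n) Ls
    ...   | t0 | s0 | tm | sn
      with fwd-array n m (levels⇒line hμ hβ fillingU refl (λ k _ → ht k) Lt)
             (levels⇒line hμ hα fillingV {a = left-steps} refl (λ i _ → hs i) Ls) (trans s0 (sym t0)) PPM-transfers
    ...     | Γ , refl , left-eq , arr
      -- The indicators at the far ends are empty zero tests, so every step of the bottom row and
      -- right column is proper and the tableaux have m and n dominoes.
      with trans (left-eq ≤-refl) sn
         | line⇒SDT m (line-cong bottom-steps (line arr ≤-refl)) | line⇒SDT n (line-cong right-steps (column arr ≤-refl))
    ...       | bl | P , sdtP , szP , LP | Q , sdtQ , szQ , LQ =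
      (Γ n m , P , Q) ,
      (partition (line arr ≤-refl) ≤-refl ,
       subst (_⊆ₚ Γ n m) bl (line-⊆ (line arr ≤-refl) z≤n ≤-refl) ,
       subst (_⊆ₚ Γ n m) tm (line-⊆ (column arr ≤-refl) z≤n ≤-refl) ,
       subst (λ α → size (Γ n m) α ≡ 2 * m) bl (trans szP (cong (2 *_) (count-true m))) ,
       subst (λ β → size (Γ n m) β ≡ 2 * n) tm (trans szQ (cong (2 *_) (count-true n))) ,
       subst (λ α → IsSDT (Γ n m) α P) bl sdtP , subst (λ β → IsSDT (Γ n m) β Q) tm sdtQ) ,
      synthesise μ U V M (Γ n m) P Q record
        { Γ = Γ ; array = arr ; start = t0 ; bottom-left = bl ; top-right = tm ; end = refl ; levelsU = Lt
        ; levelsV = levels-cong {μ} {α} {ent V μ} {s} {λ i → Γ i 0} {count left-steps} (λ le → sym (left-eq le)) Ls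
        ; levelsP = subst (λ α → Levels α (Γ n m) (ent P α) (Γ n) (count always) m) bl LP
        ; levelsQ = subst (λ β → Levels β (Γ n m) (ent Q β) (λ i → Γ i m) (count always) n) tm LQ }

  single-valued : ∀ x y y' → InDomain α β n m x → InCodomain α β n m y → InCodomain α β n m y' →
    PhiGraph α β n m x y → PhiGraph α β n m x y' → y ≡ y'
  single-valued (μ , U , V , M) (l , P , Q) (l' , P' , Q') d c c' φ φ' =
    -- Equality of the shapes comes first; only tableaux of a common shape can be compared cell by
    -- cell.
    finish c c' (trans (sym T.end) (trans (same n ≤-refl ≤-refl) T'.end))
    where
    module T = Target (analyse μ U V M l P Q d c φ)
    module T' = Target (analyse μ U V M l' P' Q' d c' φ')
    hp = λ {i} {k} (li : i ≤ n) (lk : k ≤ m) → partition (line T.array li) lk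
    hp' = λ {i} {k} (li : i ≤ n) (lk : k ≤ m) → partition (line T'.array li) lk
    same : ∀ i {k} → i ≤ n → k ≤ m → T.Γ i k ≡ T'.Γ i k
    same = fwd-array-unique T.array T'.array
      (levels-unique {μ} {β} {ent U μ} {T.Γ 0} {T'.Γ 0} {count (colSteps M 0)}
        (λ _ → hp z≤n) (λ _ → hp' z≤n) T.levelsU T'.levelsU)
      (levels-unique {μ} {α} {ent V μ} {λ i → T.Γ i 0} {λ i → T'.Γ i 0} {count (λ i → rowSteps M i 0)}
        (λ _ li → hp li z≤n) (λ _ li → hp' li z≤n) T.levelsV T'.levelsV)
    finish : InCodomain α β n m (l , P , Q) → InCodomain α β n m (l' , P' , Q') → l ≡ l' →
      (l , P , Q) ≡ (l' , P' , Q')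
    finish (_ , _ , _ , szP , szQ , sdtP , sdtQ) (_ , _ , _ , _ , _ , sdtP' , sdtQ') refl = cong₂ (λ P Q → l , P , Q)
      (SDT-unique l α P P' m always (T.Γ n) (T'.Γ n) (saturated-size {l} {α} {m} szP) sdtP sdtP' T.levelsP T'.levelsP (same n ≤-refl))
      (SDT-unique l β Q Q' n always (λ i → T.Γ i m) (λ i → T'.Γ i m) (saturated-size {l} {β} {n} szQ) sdtQ sdtQ' T.levelsQ T'.levelsQ
        (λ li → same _ li ≤-refl))

  injective : ∀ x x' y → InDomain α β n m x → InDomain α β n m x' → InCodomain α β n m y →
    PhiGraph α β n m x y → PhiGraph α β n m x' y → x ≡ x'
  injective (μ , U , V , M) (μ' , U' , V' , M') (l , P , Q) d d' c φ φ' =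
    finish (trans (sym T.start) (trans (proj₁ same z≤n z≤n) T'.start)) (entry-ext M M' (proj₂ same))
    where
    module S = Source μ U V M d
    module S' = Source μ' U' V' M' d'
    module T = Target (analyse μ U V M l P Q d c φ)
    module T' = Target (analyse μ' U' V' M' l P Q d' c φ')
    hp = λ {i} {k} (li : i ≤ n) (lk : k ≤ m) → partition (line T.array li) lk
    hp' = λ {i} {k} (li : i ≤ n) (lk : k ≤ m) → partition (line T'.array li) lk
    same : (∀ {i k} → i ≤ n → k ≤ m → T.Γ i k ≡ T'.Γ i k) × (∀ {i k} → i < n → k < m → entry M i k ≡ entry M' i k)
    same = bwd-array-unique n T.array T'.array
      (levels-unique {α} {l} {ent P α} {T.Γ n} {T'.Γ n} {count always}
        (λ _ → hp ≤-refl) (λ _ → hp' ≤-refl) T.levelsP T'.levelsP)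
      (levels-unique {β} {l} {ent Q β} {λ i → T.Γ i m} {λ i → T'.Γ i m} {count always}
        (λ _ li → hp li ≤-refl) (λ _ li → hp' li ≤-refl) T.levelsQ T'.levelsQ)
    finish : μ ≡ μ' → M ≡ M' → (μ , U , V , M) ≡ (μ' , U' , V' , M')
    finish refl refl = cong₂ (λ U V → μ , U , V , M)
      (SDT-unique β μ U U' m (colSteps M 0) (T.Γ 0) (T'.Γ 0) S.sizeU S.sdtU S'.sdtU
        T.levelsU T'.levelsU (proj₁ same z≤n))
      (SDT-unique α μ V V' n (λ i → rowSteps M i 0) (λ i → T.Γ i 0) (λ i → T'.Γ i 0) S.sizeV S.sdtV S'.sdtV
        T.levelsV T'.levelsV (λ li → proj₁ same li z≤n))

  surjective : ∀ y → InCodomain α β n m y → Σ (Input n m) λ x → InDomain α β n m x × PhiGraph α β n m x y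
  surjective (l , P , Q) (hl , α⊆l , β⊆l , szP , szQ , sdtP , sdtQ)
    with SDT⇒filling {l} {α} {P} {m} szP sdtP | SDT⇒filling {l} {β} {Q} {n} szQ sdtQ
  ... | FP | FQ
    with levels-exist hα hl FP (count always) m | levels-exist hβ hl FQ (count always) n
  ...   | t , ht , Lt | r , hr , Lr
    with levels-start hα hl FP {m} {count always} {t} refl (ht 0) Lt
       | levels-start hβ hl FQ {n} {count always} {r} refl (hr 0) Lr
       | levels-end hα hl FP {m} {count always} {t} α⊆l (count-true m) (ht m) Lt
       | levels-end hβ hl FQ {n} {count always} {r} β⊆l (count-true n) (hr n) Lr
  ...     | t0 | r0 | tm | rn
    with bwd-array n m (levels⇒line hα hl FP {a = always} (count-true m) (λ k _ → ht k) Lt)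
           (levels⇒line hβ hl FQ {a = always} (count-true n) (λ i _ → hr i) Lr) (trans rn (sym tm))
  ...       | Γ , E , A , B , refl , eqA , right-eq , eqB , g
    with line⇒SDT m (line g z≤n) | line⇒SDT n (column g z≤n) | trans (right-eq z≤n) r0
  ...         | U , sdtU , szU , LU | V , sdtV , szV , LV | top-right =
    (Γ 0 0 , U , V , M) ,
    (partition (line g z≤n) z≤n ,
     subst (Γ 0 0 ⊆ₚ_) top-right (line-⊆ (line g z≤n) z≤n ≤-refl) ,
     subst (Γ 0 0 ⊆ₚ_) t0 (line-⊆ (column g z≤n) z≤n ≤-refl) ,
     transfers⇒PPM M tr ,
     subst (λ β → size β (Γ 0 0) ≡ 2 * (m ∸ nonzeros M)) top-right (trans szU (cong (2 *_) (difference (proj₁ zeros)))) ,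
     subst (λ α → size α (Γ 0 0) ≡ 2 * (n ∸ nonzeros M)) t0 (trans szV (cong (2 *_) (difference (proj₂ zeros)))) ,
     subst (λ β → IsSDT β (Γ 0 0) U) top-right sdtU ,
     subst (λ α → IsSDT α (Γ 0 0) V) t0 sdtV) ,
    synthesise (Γ 0 0) U V M l P Q record
      { Γ = Γ ; array = array ; start = refl ; bottom-left = t0 ; top-right = top-right ; end = tm
      -- The levels of `U` count proper steps of the top row; `cols` turns these into zero columns
      -- of the matrix just found.
      ; levelsU = levels-z {Γ 0 0} {β} {ent U (Γ 0 0)} {Γ 0} (λ _ le → count-cong _ λ lt → cols (<-≤-trans lt le))
                    (subst (λ β → Levels (Γ 0 0) β (ent U (Γ 0 0)) (Γ 0) (count (A 0)) m) top-right LU)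
      ; levelsV = levels-z {Γ 0 0} {α} {ent V (Γ 0 0)} {λ i → Γ i 0} (λ _ le → count-cong _ λ lt → rows (<-≤-trans lt le))
                    (subst (λ α → Levels (Γ 0 0) α (ent V (Γ 0 0)) (λ i → Γ i 0) (count (λ i → B i 0)) n) t0 LV)
      ; levelsP = Lt
      ; levelsQ = levels-cong {β} {l} {ent Q β} {r} {λ i → Γ i m} {count always} (λ le → sym (right-eq le)) Lr }
    where
    -- Only the values of `E` inside the range come from inverted squares; the matrix keeps these
    -- and drops the defaults.
    M = fromFunction n m E
    E≡M : ∀ {i k} → i < n → k < m → E i k ≡ entry M i k
    E≡M li lk = sym (entry-fromFunction n m E li lk)
    array : GrowthArray n m Γ (entry M) A B
    array = record
      { line = line g
      ; band = λ {i} li → record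
        { rung     = rung (band g li)
        ; transfer = λ {k} lk → subst (λ e → Transfer e (A i k) (B i k) (A (suc i) k) (B i (suc k))) (E≡M li lk) (transfer (band g li) lk)
        ; local    = λ lk → subst (λ e → Local _ _ _ e _) (E≡M li lk) (local (band g li) lk) } }
    tr : Transfers n m (entry M) A B
    tr = transfers array
    bottom-steps : ∀ {k} → k < m → A n k ≡ true
    bottom-steps {k} _ = cong (λ a → a k) eqA
    zeros : count (A 0) m + nonzeros M ≡ m × count (λ i → B i 0) n + nonzeros M ≡ n
    zeros = balance M tr bottom-steps eqB
    difference : ∀ {c p} → c + nonzeros M ≡ p → c ≡ p ∸ nonzeros M
    difference {c} eq = trans (sym (m+n∸n≡m c (nonzeros M))) (cong (_∸ nonzeros M) eq)
    cols : ∀ {k} → k < m → A 0 k ≡ colSteps M 0 k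
    cols lk = sweep-zeros n (col-sweep tr lk) (bottom-steps lk)
    rows : ∀ {i} → i < n → B i 0 ≡ rowSteps M i 0
    rows li = sweep-zeros m (row-sweep tr li) (eqB li)

theorem3p3 : (α β : List ℕ) (n m : ℕ) → IsPartition α → IsPartition β →
    ((x : Input n m) → InDomain α β n m x →
    Σ Output λ y → InCodomain α β n m y × PhiGraph α β n m x y) ×
    ((x : Input n m) (y y' : Output) → InDomain α β n m x →
    InCodomain α β n m y → InCodomain α β n m y' →
    PhiGraph α β n m x y → PhiGraph α β n m x y' → y ≡ y') ×
    ((x x' : Input n m) (y : Output) → InDomain α β n m x → InDomain α β n m x' →
    InCodomain α β n m y → PhiGraph α β n m x y → PhiGraph α β n m x' y → x ≡ x') ×
    ((y : Output) → InCodomain α β n m y →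
    Σ (Input n m) λ x → InDomain α β n m x × PhiGraph α β n m x y)
theorem3p3 α β n m hα hβ =
  well-defined hα hβ , single-valued hα hβ , injective hα hβ , surjective hα hβ
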